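{- Let $H$ be a fixed finite simple graph with $v$ vertices and $\ell>1$ edges, such that every vertex of $H$ lies on at least one edge. Let $0<p<1$ and let $(E_n)$ be a sequence of integers, $0\le E_n\le N_n=\binom n2$, with $E_n=p\binom n2+O(1)$ as $n\to\infty$. For a random graph distributed according to $\mu_n(p)$ (uniform on the simple graphs on $n$ labeled vertices having exactly $E_n$ edges), the expectation and variance of the number $T_H$ of copies of $H$ satisfy, for $n\ge v$ (with all $O$-terms as $n\to\infty$), $$\langle T_H\rangle_{n,p}=c_n\,P(E_n,N_n,\ell)=c_n p^\ell+O(n^{v-2})=\frac{1}{|S_H|}\Big[n^v p^\ell-\frac{v(v-1)}{2}n^{v-1}p^\ell\Big]+O(n^{v-2}),$$ $$\mathrm{Var}(T_H)_{n,p}=C_2\,p^{2\ell-2}(1-p)^2+C_3\,p^{2\ell-3}(1-3p^2+2p^3)+O(n^{2v-4})=O(n^{2v-3}).$$ Moreover, if $H$ does not contain any triangles, then the term $C_3\,p^{2\ell-3}(1-3p^2+2p^3)$ is itself $O(n^{2v-4})$ (and so can be omitted from the formula for the variance).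
   Context: $G_n$ is the set of simple graphs on $n$ labeled vertices. For $g\in G_n$, $T_H(g)$ is the number of copies of $H$ in $g$, i.e. the number of (not necessarily induced) subgraphs of $g$ isomorphic to $H$. $\mu_n(p)$ is the uniform distribution on those $g\in G_n$ whose total number of edges is exactly $E_n$; $\langle\cdot\rangle_{n,p}$ and $\mathrm{Var}(\cdot)_{n,p}$ are expectation and variance with respect to $\mu_n(p)$. $N_n=\binom n2$. For a positive integer $k$, $$P(E_n,N_n,k)=\frac{E_n(E_n-1)\cdots(E_n+1-k)}{N_n(N_n-1)\cdots(N_n+1-k)}.$$ $S_H$ is the group of symmetries (automorphism group) of $H$. $c_n=n(n-1)\cdots(n+1-v)/|S_H|$ is the number of copies of $H$ in the complete graph on the $n$ vertices. For $0\le k\le\ell$, $C_k=C_k(n)$ is the number of ordered pairs of copies of $H$ in the complete graph on the $n$ vertices (the two copies being distinguishable as first and second, and allowed to coincide) that share exactly $k$ edges; $C_k=0$ for $k>\ell$. The constants implied in the $O$-terms may depend on $H$, $p$ and the sequence $(E_n)$, but not on $n$. -}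

module Defs where

open import Data.Fin.Base as Fin using (Fin)
import Data.Fin.Properties as Fin
open import Data.Fin.Subset using (Subset; _∈_; _⊆_; _∩_; ∣_∣; ⊤; inside; outside)
open import Data.Fin.Subset.Properties using (_∈?_; _⊆?_)
open import Data.Integer.Base using (+_)
open import Data.List.Base as List
  using (List; []; _∷_; length; filter; map; allFin; cartesianProduct; cartesianProductWith; foldr)
open import Data.List.Membership.Propositional as List using ()
open import Data.List.Membership.Propositional.Properties
  using (∈-cartesianProductWith⁺; ∈-allFin)
import Data.List.Relation.Unary.Any as Any
open import Data.Nat.Base as ℕ using (ℕ; zero; suc)
import Data.Nat.Properties as ℕ
open import Data.Nat.Combinatorics using (_P_)
open import Data.Product using (∃; ∃-syntax; _×_; _,_; proj₁; proj₂)
open import Data.Product.Properties using (≡-dec)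
open import Data.Rational.Base as ℚ using (ℚ; 0ℚ; 1ℚ; ½; _/_)
import Data.Rational.Properties as ℚ
open import Data.Rational.Solver using (module +-*-Solver)
open import Data.Sum using (_⊎_; inj₁; inj₂)
open import Data.Vec.Base as Vec using (Vec; lookup)
open import Function.Bundles using (_⇔_; mk⇔; Equivalence)
open import Function.Definitions using (Injective)
open import Relation.Binary.PropositionalEquality
  using (_≡_; refl; sym; trans; cong; cong₂; subst)
open import Relation.Nullary.Decidable using (Dec; map′; _×-dec_; _⊎-dec_; _→-dec_)
open import Relation.Nullary.Negation using (¬_)

------------------------------------------------------------------------
-- Real numbers

-- Cauchy sequences of rationals, with no prescribed rate of convergence.
-- The field operations are then pointwise.  Equality of reals is never
-- needed below, only the order relations.

record ℝ : Set where
  constructor mkℝ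
  field
    seq    : ℕ → ℚ
    cauchy : ∀ ε → 0ℚ ℚ.< ε →
             ∃[ N ] ∀ m n → N ℕ.≤ m → N ℕ.≤ n → ℚ.∣ seq m ℚ.- seq n ∣ ℚ.≤ ε

open ℝ public

private
  halves : ∀ ε → ε ℚ.* ½ ℚ.+ ε ℚ.* ½ ≡ ε
  halves ε = trans (sym (ℚ.*-distribˡ-+ ε ½ ½)) (ℚ.*-identityʳ ε)

  pos-* : ∀ {p q} → 0ℚ ℚ.< p → 0ℚ ℚ.< q → 0ℚ ℚ.< p ℚ.* q
  pos-* {p} {q} 0<p 0<q =
    ℚ.positive⁻¹ (p ℚ.* q)
      {{ℚ.pos*pos⇒pos p {{ℚ.positive 0<p}} q {{ℚ.positive 0<q}}}}

  half-pos : ∀ {ε} → 0ℚ ℚ.< ε → 0ℚ ℚ.< ε ℚ.* ½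
  half-pos 0<ε = pos-* 0<ε (ℚ.positive⁻¹ ½)

  -- ∣ x ∣ ≤ B, ∣ y ∣ ≤ D imply ∣ x * y ∣ ≤ B * D
  ∣*∣-mono : ∀ {x y B D} → ℚ.∣ x ∣ ℚ.≤ B → ℚ.∣ y ∣ ℚ.≤ D → ℚ.∣ x ℚ.* y ∣ ℚ.≤ B ℚ.* D
  ∣*∣-mono {x} {y} {B} {D} x≤B y≤D = begin
    ℚ.∣ x ℚ.* y ∣          ≡⟨ ℚ.∣p*q∣≡∣p∣*∣q∣ x y ⟩
    ℚ.∣ x ∣ ℚ.* ℚ.∣ y ∣    ≤⟨ ℚ.*-monoʳ-≤-nonNeg ℚ.∣ y ∣ {{ℚ.nonNegative (ℚ.0≤∣p∣ y)}} x≤B ⟩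
    B ℚ.* ℚ.∣ y ∣          ≤⟨ ℚ.*-monoˡ-≤-nonNeg B
                                {{ℚ.nonNegative (ℚ.≤-trans (ℚ.0≤∣p∣ x) x≤B)}} y≤D ⟩
    B ℚ.* D                ∎
    where open ℚ.≤-Reasoning

  ∣+∣-mono : ∀ {x y B D} → ℚ.∣ x ∣ ℚ.≤ B → ℚ.∣ y ∣ ℚ.≤ D → ℚ.∣ x ℚ.+ y ∣ ℚ.≤ B ℚ.+ D
  ∣+∣-mono {x} {y} x≤B y≤D = ℚ.≤-trans (ℚ.∣p+q∣≤∣p∣+∣q∣ x y) (ℚ.+-mono-≤ x≤B y≤D)

  ∣∣-∣∣-one-sided : ∀ x y → ℚ.∣ x ∣ ℚ.- ℚ.∣ y ∣ ℚ.≤ ℚ.∣ x ℚ.- y ∣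
  ∣∣-∣∣-one-sided x y = begin
    ℚ.∣ x ∣ ℚ.- ℚ.∣ y ∣
      ≡⟨ cong (λ t → ℚ.∣ t ∣ ℚ.- ℚ.∣ y ∣)
           (+-*-Solver.solve 2 (λ s t → s := (s :- t) :+ t) refl x y) ⟩
    ℚ.∣ (x ℚ.- y) ℚ.+ y ∣ ℚ.- ℚ.∣ y ∣
      ≤⟨ ℚ.+-monoˡ-≤ (ℚ.- ℚ.∣ y ∣) (ℚ.∣p+q∣≤∣p∣+∣q∣ (x ℚ.- y) y) ⟩
    ℚ.∣ x ℚ.- y ∣ ℚ.+ ℚ.∣ y ∣ ℚ.- ℚ.∣ y ∣
      ≡⟨ +-*-Solver.solve 2 (λ s t → (s :+ t) :- t := s) refl ℚ.∣ x ℚ.- y ∣ ℚ.∣ y ∣ ⟩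
    ℚ.∣ x ℚ.- y ∣ ∎
    where open ℚ.≤-Reasoning
          open +-*-Solver using (_:=_; _:+_; _:-_)

  reverse-triangle : ∀ x y → ℚ.∣ ℚ.∣ x ∣ ℚ.- ℚ.∣ y ∣ ∣ ℚ.≤ ℚ.∣ x ℚ.- y ∣
  reverse-triangle x y with ℚ.∣p∣≡p∨∣p∣≡-p (ℚ.∣ x ∣ ℚ.- ℚ.∣ y ∣)
  ... | inj₁ eq = subst (ℚ._≤ ℚ.∣ x ℚ.- y ∣) (sym eq) (∣∣-∣∣-one-sided x y)
  ... | inj₂ eq = begin
    ℚ.∣ ℚ.∣ x ∣ ℚ.- ℚ.∣ y ∣ ∣    ≡⟨ trans eq (flip ℚ.∣ x ∣ ℚ.∣ y ∣) ⟩
    ℚ.∣ y ∣ ℚ.- ℚ.∣ x ∣          ≤⟨ ∣∣-∣∣-one-sided y x ⟩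
    ℚ.∣ y ℚ.- x ∣                ≡⟨ cong ℚ.∣_∣ (sym (flip x y)) ⟩
    ℚ.∣ ℚ.- (x ℚ.- y) ∣          ≡⟨ ℚ.∣-p∣≡∣p∣ (x ℚ.- y) ⟩
    ℚ.∣ x ℚ.- y ∣                ∎
    where
    open ℚ.≤-Reasoning
    open +-*-Solver using (_:=_; _:-_; :-_)
    flip : ∀ a b → ℚ.- (a ℚ.- b) ≡ b ℚ.- a
    flip = +-*-Solver.solve 2 (λ s t → :- (s :- t) := t :- s) refl

  bounded : (x : ℝ) → ∃[ B ] 0ℚ ℚ.< B × ∃[ N ] (∀ m → N ℕ.≤ m → ℚ.∣ seq x m ∣ ℚ.≤ B)
  bounded x with cauchy x 1ℚ (ℚ.positive⁻¹ 1ℚ)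
  ... | N , near = B , 0<B , N , bound
    where
    open ℚ.≤-Reasoning
    open +-*-Solver using (_:=_; _:+_; _:-_)
    B : ℚ
    B = 1ℚ ℚ.+ ℚ.∣ seq x N ∣
    0<B : 0ℚ ℚ.< B
    0<B = ℚ.+-mono-<-≤ (ℚ.positive⁻¹ 1ℚ) (ℚ.0≤∣p∣ (seq x N))
    bound : ∀ m → N ℕ.≤ m → ℚ.∣ seq x m ∣ ℚ.≤ B
    bound m N≤m = begin
      ℚ.∣ seq x m ∣
        ≡⟨ cong ℚ.∣_∣ (+-*-Solver.solve 2 (λ s t → s := (s :- t) :+ t) refl (seq x m) (seq x N)) ⟩
      ℚ.∣ (seq x m ℚ.- seq x N) ℚ.+ seq x N ∣
        ≤⟨ ∣+∣-mono (near m N N≤m ℕ.≤-refl) ℚ.≤-refl ⟩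
      B ∎

infix  8 -ℝ_
infixl 7 _*ℝ_
infixl 6 _+ℝ_ _-ℝ_
infixr 8 _^ℝ_
infix  4 _≤ℝ_ _<ℝ_

fromℚ : ℚ → ℝ
fromℚ q = mkℝ (λ _ → q) λ ε 0<ε → 0 , λ _ _ _ _ →
  subst (ℚ._≤ ε) (sym (cong ℚ.∣_∣ (ℚ.+-inverseʳ q))) (ℚ.<⇒≤ 0<ε)

fromℕ : ℕ → ℝ
fromℕ n = fromℚ (+ n / 1)

_+ℝ_ : ℝ → ℝ → ℝ
x +ℝ y = mkℝ (λ n → seq x n ℚ.+ seq y n) λ ε 0<ε →
  let M , x-near = cauchy x (ε ℚ.* ½) (half-pos 0<ε)
      N , y-near = cauchy y (ε ℚ.* ½) (half-pos 0<ε)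
  in M ℕ.⊔ N , λ m n le₁ le₂ → begin
    ℚ.∣ (seq x m ℚ.+ seq y m) ℚ.- (seq x n ℚ.+ seq y n) ∣
      ≡⟨ cong ℚ.∣_∣ (+-*-Solver.solve 4
           (λ a b c d → (a :+ b) :- (c :+ d) := (a :- c) :+ (b :- d))
           refl (seq x m) (seq y m) (seq x n) (seq y n)) ⟩
    ℚ.∣ (seq x m ℚ.- seq x n) ℚ.+ (seq y m ℚ.- seq y n) ∣
      ≤⟨ ∣+∣-mono
           (x-near m n (ℕ.m⊔n≤o⇒m≤o M N le₁) (ℕ.m⊔n≤o⇒m≤o M N le₂))
           (y-near m n (ℕ.m⊔n≤o⇒n≤o M N le₁) (ℕ.m⊔n≤o⇒n≤o M N le₂)) ⟩
    ε ℚ.* ½ ℚ.+ ε ℚ.* ½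
      ≡⟨ halves ε ⟩
    ε ∎
  where open ℚ.≤-Reasoning
        open +-*-Solver using (_:=_; _:+_; _:-_)

-ℝ_ : ℝ → ℝ
-ℝ x = mkℝ (λ n → ℚ.- seq x n) λ ε 0<ε →
  let N , near = cauchy x ε 0<ε
  in N , λ m n le₁ le₂ → begin
    ℚ.∣ (ℚ.- seq x m) ℚ.- (ℚ.- seq x n) ∣
      ≡⟨ cong ℚ.∣_∣ (+-*-Solver.solve 2 (λ a b → (:- a) :- (:- b) := :- (a :- b))
           refl (seq x m) (seq x n)) ⟩
    ℚ.∣ ℚ.- (seq x m ℚ.- seq x n) ∣
      ≡⟨ ℚ.∣-p∣≡∣p∣ (seq x m ℚ.- seq x n) ⟩
    ℚ.∣ seq x m ℚ.- seq x n ∣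
      ≤⟨ near m n le₁ le₂ ⟩
    ε ∎
  where open ℚ.≤-Reasoning
        open +-*-Solver using (_:=_; _:-_; :-_)

_-ℝ_ : ℝ → ℝ → ℝ
x -ℝ y = x +ℝ (-ℝ y)

_*ℝ_ : ℝ → ℝ → ℝ
x *ℝ y = mkℝ (λ n → seq x n ℚ.* seq y n) prod-cauchy
  where
  open ℚ.≤-Reasoning
  open +-*-Solver using (_:=_; _:+_; _:-_)

  distrib-- : ∀ a b d → a ℚ.* b ℚ.- a ℚ.* d ≡ a ℚ.* (b ℚ.- d)
  distrib-- a b d = trans (cong (a ℚ.* b ℚ.+_) (ℚ.neg-distribʳ-* a d))
                          (sym (ℚ.*-distribˡ-+ a b (ℚ.- d)))

  split : ∀ a b c d →
    a ℚ.* b ℚ.- c ℚ.* d ≡ a ℚ.* (b ℚ.- d) ℚ.+ d ℚ.* (a ℚ.- c)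
  split a b c d = begin-equality
    a ℚ.* b ℚ.- c ℚ.* d
      ≡⟨ +-*-Solver.solve 3 (λ s t u → s :- u := (s :- t) :+ (t :- u))
           refl (a ℚ.* b) (a ℚ.* d) (c ℚ.* d) ⟩
    (a ℚ.* b ℚ.- a ℚ.* d) ℚ.+ (a ℚ.* d ℚ.- c ℚ.* d)
      ≡⟨ cong₂ ℚ._+_ (distrib-- a b d)
           (trans (cong₂ ℚ._-_ (ℚ.*-comm a d) (ℚ.*-comm c d)) (distrib-- d a c)) ⟩
    a ℚ.* (b ℚ.- d) ℚ.+ d ℚ.* (a ℚ.- c) ∎

  prod-bound : ∀ a b c d {A α B β ε} →
    ℚ.∣ a ∣ ℚ.≤ A → ℚ.∣ b ℚ.- d ∣ ℚ.≤ α →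
    ℚ.∣ d ∣ ℚ.≤ B → ℚ.∣ a ℚ.- c ∣ ℚ.≤ β →
    A ℚ.* α ℚ.+ B ℚ.* β ≡ ε → ℚ.∣ a ℚ.* b ℚ.- c ℚ.* d ∣ ℚ.≤ ε
  prod-bound a b c d {A} {α} {B} {β} {ε} a≤A b-d≤α d≤B a-c≤β eq = begin
    ℚ.∣ a ℚ.* b ℚ.- c ℚ.* d ∣
      ≡⟨ cong ℚ.∣_∣ (split a b c d) ⟩
    ℚ.∣ a ℚ.* (b ℚ.- d) ℚ.+ d ℚ.* (a ℚ.- c) ∣
      ≤⟨ ∣+∣-mono {a ℚ.* (b ℚ.- d)} {d ℚ.* (a ℚ.- c)}
           (∣*∣-mono {a} {b ℚ.- d} a≤A b-d≤α) (∣*∣-mono {d} {a ℚ.- c} d≤B a-c≤β) ⟩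
    A ℚ.* α ℚ.+ B ℚ.* β
      ≡⟨ eq ⟩
    ε ∎

  -- δ with B * δ = ε / 2
  share : ∀ B → 0ℚ ℚ.< B → ∀ ε → 0ℚ ℚ.< ε → ∃[ δ ] 0ℚ ℚ.< δ × B ℚ.* δ ≡ ε ℚ.* ½
  share B 0<B ε 0<ε = 1/B ℚ.* (ε ℚ.* ½) , pos-* 0<1/B (half-pos 0<ε) ,
    trans (sym (ℚ.*-assoc B 1/B (ε ℚ.* ½)))
      (trans (cong (ℚ._* (ε ℚ.* ½)) (ℚ.*-inverseʳ B {{B≢0}})) (ℚ.*-identityˡ (ε ℚ.* ½)))
    where
    B≢0 : ℚ.NonZero B
    B≢0 = ℚ.pos⇒nonZero B {{ℚ.positive 0<B}}
    1/B : ℚ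
    1/B = (ℚ.1/ B) {{B≢0}}
    0<1/B : 0ℚ ℚ.< 1/B
    0<1/B = ℚ.positive⁻¹ 1/B {{ℚ.1/pos⇒pos B {{ℚ.positive 0<B}}}}

  prod-cauchy : ∀ ε → 0ℚ ℚ.< ε → ∃[ N ] ∀ m n → N ℕ.≤ m → N ℕ.≤ n →
    ℚ.∣ seq x m ℚ.* seq y m ℚ.- seq x n ℚ.* seq y n ∣ ℚ.≤ ε
  prod-cauchy ε 0<ε =
    let A , 0<A , K , x≤A = bounded x
        B , 0<B , L , y≤B = bounded y
        α , 0<α , Aα      = share A 0<A ε 0<ε
        β , 0<β , Bβ      = share B 0<B ε 0<ε
        M , x-near        = cauchy x β 0<β
        N , y-near        = cauchy y α 0<α
    in (K ℕ.⊔ L) ℕ.⊔ (M ℕ.⊔ N) , λ m n le₁ le₂ →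
    let KL₁ = ℕ.m⊔n≤o⇒m≤o (K ℕ.⊔ L) (M ℕ.⊔ N) le₁
        MN₁ = ℕ.m⊔n≤o⇒n≤o (K ℕ.⊔ L) (M ℕ.⊔ N) le₁
        KL₂ = ℕ.m⊔n≤o⇒m≤o (K ℕ.⊔ L) (M ℕ.⊔ N) le₂
        MN₂ = ℕ.m⊔n≤o⇒n≤o (K ℕ.⊔ L) (M ℕ.⊔ N) le₂
    in prod-bound (seq x m) (seq y m) (seq x n) (seq y n)
      (x≤A m (ℕ.m⊔n≤o⇒m≤o K L KL₁))
      (y-near m n (ℕ.m⊔n≤o⇒n≤o M N MN₁) (ℕ.m⊔n≤o⇒n≤o M N MN₂))
      (y≤B n (ℕ.m⊔n≤o⇒n≤o K L KL₂))
      (x-near m n (ℕ.m⊔n≤o⇒m≤o M N MN₁) (ℕ.m⊔n≤o⇒m≤o M N MN₂))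
      (trans (cong₂ ℚ._+_ Aα Bβ) (halves ε))

_^ℝ_ : ℝ → ℕ → ℝ
x ^ℝ zero  = fromℕ 1
x ^ℝ suc k = x *ℝ x ^ℝ k

∣_∣ℝ : ℝ → ℝ
∣ x ∣ℝ = mkℝ (λ n → ℚ.∣ seq x n ∣) λ ε 0<ε →
  let N , near = cauchy x ε 0<ε
  in N , λ m n le₁ le₂ →
       ℚ.≤-trans (reverse-triangle (seq x m) (seq x n)) (near m n le₁ le₂)

_≤ℝ_ : ℝ → ℝ → Set
x ≤ℝ y = ∀ ε → 0ℚ ℚ.< ε → ∃[ N ] ∀ n → N ℕ.≤ n → seq x n ℚ.≤ seq y n ℚ.+ ε

_<ℝ_ : ℝ → ℝ → Set
x <ℝ y = ∃[ ε ] 0ℚ ℚ.< ε × ∃[ N ] ∀ n → N ℕ.≤ n → seq x n ℚ.+ ε ℚ.≤ seq y n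

infix 4 _∈O_

_∈O_ : (ℕ → ℝ) → (ℕ → ℕ) → Set
f ∈O g = ∃[ C ] ∃[ n₀ ] ∀ n → n₀ ℕ.≤ n → ∣ f n ∣ℝ ≤ℝ C *ℝ fromℕ (g n)

------------------------------------------------------------------------
-- Rational-valued quantities

-- a / b, with junk value 0 when b is zero.  Below, b is N P ℓ (positive once
-- n ≥ v), the order of an automorphism group, the number of graphs with E ≤ N
-- edges, or 2, so the junk value plays no role.
ratio : ℕ → ℕ → ℚ
ratio a zero    = 0ℚ
ratio a (suc b) = + a / suc b

sumℚ : List ℚ → ℚ
sumℚ = foldr ℚ._+_ 0ℚ

-- The standard library's  n P k  is the falling factorial
-- n (n - 1) ⋯ (n + 1 - k), so this is P(E, N, k).
Pr : ℕ → ℕ → ℕ → ℚ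
Pr E N k = ratio (E P k) (N P k)

------------------------------------------------------------------------
-- Graphs on the vertex set Fin n

allVecs : ∀ {A : Set} → List A → ∀ n → List (Vec A n)
allVecs xs zero    = Vec.[] ∷ []
allVecs xs (suc n) = cartesianProductWith Vec._∷_ xs (allVecs xs n)

allSubsets : ∀ n → List (Subset n)
allSubsets = allVecs (inside ∷ outside ∷ [])

-- The unordered pairs of distinct vertices, each listed once.
pairs : ∀ n → List (Fin n × Fin n)
pairs n = filter (λ e → proj₁ e Fin.<? proj₂ e) (cartesianProduct (allFin n) (allFin n))

-- A simple graph is the set of (indices in  pairs n  of) its edges.  Thus
-- ∣ g ∣, _⊆_, _∩_ and ⊤ are the number of edges, inclusion of edge sets,
-- the common edges, and the complete graph.
Graph : ℕ → Set
Graph n = Subset (length (pairs n))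

complete : ∀ n → Graph n
complete n = ⊤

allGraphs : ∀ n → List (Graph n)
allGraphs n = allSubsets (length (pairs n))

Adj : ∀ {n} → Graph n → Fin n → Fin n → Set
Adj {n} g i j = ∃[ e ] e ∈ g ×
  (List.lookup (pairs n) e ≡ (i , j) ⊎ List.lookup (pairs n) e ≡ (j , i))

Adj? : ∀ {n} (g : Graph n) i j → Dec (Adj g i j)
Adj? {n} g i j = Fin.any? λ e → (e ∈? g) ×-dec
  (≡-dec Fin._≟_ Fin._≟_ (List.lookup (pairs n) e) (i , j) ⊎-dec
   ≡-dec Fin._≟_ Fin._≟_ (List.lookup (pairs n) e) (j , i))

NoIsolatedVertex : ∀ n → Graph n → Set
NoIsolatedVertex n g = ∀ (i : Fin n) → ∃[ j ] Adj g i j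

TriangleFree : ∀ n → Graph n → Set
TriangleFree n g = ∀ (i j k : Fin n) → ¬ (Adj g i j × Adj g j k × Adj g i k)

------------------------------------------------------------------------
-- Subgraphs and isomorphisms

-- A vertex set together with an edge set.
Subgraph : ℕ → Set
Subgraph n = Subset n × Graph n

edges : ∀ n → Subgraph n → Graph n
edges n = proj₂

allSubgraphs : ∀ n → List (Subgraph n)
allSubgraphs n = cartesianProduct (allSubsets n) (allGraphs n)

IsSubgraph : ∀ n → Subgraph n → Graph n → Set
IsSubgraph n (W , F) g =
  F ⊆ g × (∀ (i j : Fin n) → Adj F i j → i ∈ W × j ∈ W)

isSubgraph? : ∀ n S g → Dec (IsSubgraph n S g)
isSubgraph? n (W , F) g = (F ⊆? g) ×-dec
  Fin.all? λ i → Fin.all? λ j → Adj? F i j →-dec ((i ∈? W) ×-dec (j ∈? W))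

-- f, given by its table of values, is an isomorphism from H onto (W , F).
IsIso : ∀ v n → Graph v → Subgraph n → Vec (Fin n) v → Set
IsIso v n H (W , F) f =
  Injective _≡_ _≡_ (lookup f) ×
  (∀ x → x ∈ W ⇔ (∃[ i ] lookup f i ≡ x)) ×
  (∀ i j → Adj H i j ⇔ Adj F (lookup f i) (lookup f j))

private
  _⇔-dec_ : ∀ {A B : Set} → Dec A → Dec B → Dec (A ⇔ B)
  a? ⇔-dec b? = map′ (λ (f , g) → mk⇔ f g)
                     (λ e → Equivalence.to e , Equivalence.from e)
                     ((a? →-dec b?) ×-dec (b? →-dec a?))

isIso? : ∀ v n H S f → Dec (IsIso v n H S f)
isIso? v n H (W , F) f =
  map′ (λ inj {i} {j} → inj i j) (λ inj i j → inj {i} {j})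
    (Fin.all? λ i → Fin.all? λ j → (lookup f i Fin.≟ lookup f j) →-dec (i Fin.≟ j))
  ×-dec (Fin.all? λ x → (x ∈? W) ⇔-dec Fin.any? (λ i → lookup f i Fin.≟ x))
  ×-dec (Fin.all? λ i → Fin.all? λ j → Adj? H i j ⇔-dec Adj? F (lookup f i) (lookup f j))

Isomorphic : ∀ v n → Graph v → Subgraph n → Set
Isomorphic v n H S = ∃[ f ] IsIso v n H S f

private
  ∈-allVecs : ∀ {A : Set} {xs : List A} → (∀ x → x List.∈ xs) →
              ∀ {n} (w : Vec A n) → w List.∈ allVecs xs n
  ∈-allVecs all Vec.[]      = Any.here refl
  ∈-allVecs all (x Vec.∷ w) = ∈-cartesianProductWith⁺ Vec._∷_ (all x) (∈-allVecs all w)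

isomorphic? : ∀ v n H S → Dec (Isomorphic v n H S)
isomorphic? v n H S =
  map′ Any.satisfied
       (λ (f , iso) → List.lose (∈-allVecs ∈-allFin f) iso)
       (Any.any? (isIso? v n H S) (allVecs (allFin n) v))

-- ∣ S_H ∣
symmetries : ∀ v → Graph v → ℕ
symmetries v H = length (filter (isIso? v v H (⊤ , H)) (allVecs (allFin v) v))

------------------------------------------------------------------------
-- Copies of H

copies : ∀ v n → Graph v → Graph n → List (Subgraph n)
copies v n H g =
  filter (λ S → isSubgraph? n S g ×-dec isomorphic? v n H S) (allSubgraphs n)

T : ∀ v n → Graph v → Graph n → ℚ
T v n H g = + length (copies v n H g) / 1

c : ∀ v → Graph v → ℕ → ℚ
c v H n = ratio (n P v) (symmetries v H)

Cpairs : ∀ v → Graph v → ℕ → ℕ → ℕ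
Cpairs v H k n =
  length (filter (λ (S , S′) → ∣ edges n S ∩ edges n S′ ∣ ℕ.≟ k)
                 (cartesianProduct Kn-copies Kn-copies))
  where
  Kn-copies : List (Subgraph n)
  Kn-copies = copies v n H (complete n)

------------------------------------------------------------------------
-- The uniform distribution on the graphs with exactly E edges

Ω : ∀ n → ℕ → List (Graph n)
Ω n E = filter (λ g → ∣ g ∣ ℕ.≟ E) (allGraphs n)

𝔼 : ∀ n → ℕ → (Graph n → ℚ) → ℚ
𝔼 n E X = sumℚ (map X (Ω n E)) ℚ.* ratio 1 (length (Ω n E))

Var : ∀ n → ℕ → (Graph n → ℚ) → ℚ
Var n E X = 𝔼 n E λ g → (X g ℚ.- μ) ℚ.* (X g ℚ.- μ)
  where
  μ : ℚ
  μ = 𝔼 n E X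

{-# OPTIONS --safe #-}
module Submission where

-- Sums over copies of H become sums over injections Fin v → Fin n, each copy being the
-- image of |S_H| of them.  A fixed set of m edges lies in a random graph with probability
-- P(E, N, m), which gives the mean, and
--   Var = ∑ C_k (P(E, N, 2ℓ - k) - P(E, N, ℓ)²).
-- Two copies with 1, 2 or at least 4 common edges have at least 2, 3 or 4 common vertices
-- (4 already for 3 common edges if H is triangle-free), which bounds the C_k.  All edges
-- of K_n lie in equally many copies, so N ∑ k C_k = ℓ² ∑ C_k; hence λ (k - ℓ²/N) may be
-- subtracted from the bracket for any λ.  For λ = p^(2ℓ-1) (1 - p) this cancels the
-- dominant contributions of k = 0 and k = 1 and turns those of k = 2 and k = 3 into the
-- stated main terms.

open import Defs
open import Data.Bool.Base using (true; if_then_else_)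
open import Data.Empty using (⊥; ⊥-elim)
open import Data.Fin.Base as Fin using (Fin; zero; suc)
open import Data.Fin.Permutation
  using (Permutation′; _⟨$⟩ʳ_; _⟨$⟩ˡ_; inverseˡ; inverseʳ; transpose; _∘ₚ_)
import Data.Fin.Properties as Fin
open import Data.Fin.Subset using (Subset; _∈_; _⊆_; _∩_; _∪_; ∁; ∣_∣; ⊤; inside; outside)
import Data.Fin.Subset as Subset
open import Data.Fin.Subset.Properties using (_∈?_; _⊆?_)
import Data.Fin.Subset.Properties as Subset
import Data.Integer.Base as ℤ
import Data.Integer.Properties as ℤ
open import Data.List.Base as List
  using (List; []; _∷_; _++_; length; filter; map; allFin; cartesianProduct; cartesianProductWith)
open import Data.List.Membership.Propositional renaming (_∈_ to _∈ˡ_)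
open import Data.List.Membership.Propositional.Properties
open import Data.List.Membership.Propositional.Properties.WithK using (unique∧set⇒bag)
import Data.List.Properties as List
open import Data.List.Relation.Binary.BagAndSetEquality using (∼bag⇒↭)
import Data.List.Relation.Binary.Permutation.Propositional.Properties as Perm
open import Data.List.Relation.Unary.All as All using (All; []; _∷_)
import Data.List.Relation.Unary.All.Properties as All
open import Data.List.Relation.Unary.AllPairs using ([]; _∷_)
open import Data.List.Relation.Unary.Any as Any using (here; there)
open import Data.List.Relation.Unary.Any.Properties using (lookup-index)
open import Data.List.Relation.Unary.Unique.Propositional using (Unique)
import Data.List.Relation.Unary.Unique.Propositional.Properties as Unique
open import Data.Nat.Base as ℕ using (ℕ; zero; suc; _+_; _*_; _∸_; _^_; _≤_; _<_; z≤n; s≤s)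
open import Data.Nat.Combinatorics using (_C_; _P_; nCk+nC[k+1]≡[n+1]C[k+1]; nC1≡n)
open import Data.Nat.Combinatorics.Base using (_P′_)
open import Data.Nat.Combinatorics.Specification using (k>n⇒nPk≡0)
open import Data.Nat.ListAction using (sum)
open import Data.Nat.ListAction.Properties using (sum-++; sum-↭)
import Data.Nat.Properties as ℕ
open import Data.Nat.Solver using (module +-*-Solver)
open import Data.Product using (∃-syntax; _×_; _,_; proj₁; proj₂)
open import Data.Rational.Base as ℚ using (ℚ; 0ℚ; 1ℚ)
import Data.Rational.Properties as ℚ
import Data.Rational.Solver as ℚ
open import Data.Rational.Unnormalised.Base as ℚᵘ using (mkℚᵘ; *≡*; *≤*)
import Data.Rational.Unnormalised.Properties as ℚᵘ
open import Data.Sum.Base as Sum using (_⊎_; inj₁; inj₂; [_,_]′)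
open import Data.Vec.Base as Vec using (Vec; lookup)
import Data.Vec.Properties as Vec
open import Function.Base using (_∘_; id)
open import Function.Bundles using (_⇔_; mk⇔; Equivalence)
open import Function.Definitions using (Injective)
open import Relation.Binary.Definitions using (tri<; tri≈; tri>)
open import Relation.Binary.PropositionalEquality
  using (_≡_; _≢_; refl; sym; trans; cong; cong₂; subst; module ≡-Reasoning)
open import Relation.Nullary.Decidable
  using (Dec; yes; no; does; map′; _×-dec_; _→-dec_; ¬?; dec-true; dec-false)
open import Relation.Nullary.Negation using (¬_; contradiction)
open import Relation.Unary using (Decidable)

-- The variance is O(n^(2v-3)), while the bounds for the terms k = 0 and k = 1 of its formula are
-- only O(n^(2v-2)): C_0 may be of order n^(2v) with a covariance of order 1/N, and C_1 =
-- O(n^(2v-2)) comes with a covariance of order 1. These terms have opposite signs, but separate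
-- bounds for C_0 and C_1 cannot show that they cancel, still less with remainder O(n^(2v-4)); an
-- exact linear relation between the C_k can. One λ serves both. For k = 1 it has to be p^(2ℓ-1) -
-- p^(2ℓ). For k = 0, λ ℓ²/N has to be opposite to the covariance of two edge-disjoint copies, which
-- is -ℓ² p^(2ℓ-1) (1 - p)/N + O(1/N²). Both give the same value, and p^(2ℓ-k) - p^(2ℓ) - λ k is
-- then p^(2ℓ-2) (1 - p)² for k = 2 and p^(2ℓ-3) (1 - 3p² + 2p³) for k = 3. Hence P(E, N, m) = p^m +
-- O(1/N) is enough except for k = 0, where the coefficient of 1/N must be known although E - pN is
-- merely bounded; only differences in which E - pN drops out are expanded that far.

private variable
  A B : Set
  Q : A → Set

-- Indicators and finite sums

⟦_⟧ : Dec A → ℕ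
⟦ a? ⟧ = if does a? then 1 else 0

⟦⟧-yes : (a? : Dec A) → A → ⟦ a? ⟧ ≡ 1
⟦⟧-yes (yes _) _ = refl
⟦⟧-yes (no ¬a) a = ⊥-elim (¬a a)

⟦⟧-no : (a? : Dec A) → ¬ A → ⟦ a? ⟧ ≡ 0
⟦⟧-no (yes a) ¬a = ⊥-elim (¬a a)
⟦⟧-no (no _)  _  = refl

⟦⟧-mono : (a? : Dec A) (b? : Dec B) → (A → B) → ⟦ a? ⟧ ≤ ⟦ b? ⟧
⟦⟧-mono (yes a) b? f = ℕ.≤-reflexive (sym (⟦⟧-yes b? (f a)))
⟦⟧-mono (no _)  b? f = z≤n

⟦⟧-cong : (a? : Dec A) (b? : Dec B) → (A → B) → (B → A) → ⟦ a? ⟧ ≡ ⟦ b? ⟧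
⟦⟧-cong a? b? f g = ℕ.≤-antisym (⟦⟧-mono a? b? f) (⟦⟧-mono b? a? g)

⟦⟧-× : (a? : Dec A) (b? : Dec B) → ⟦ a? ×-dec b? ⟧ ≡ ⟦ a? ⟧ * ⟦ b? ⟧
⟦⟧-× (yes _) (yes _) = refl
⟦⟧-× (yes _) (no _)  = refl
⟦⟧-× (no _)  _       = refl

⟦⟧≡1⁻ : (a? : Dec A) → ⟦ a? ⟧ ≡ 1 → A
⟦⟧≡1⁻ (yes a) _ = a

⟦⟧-idem : (a? : Dec A) → ⟦ a? ⟧ * ⟦ a? ⟧ ≡ ⟦ a? ⟧
⟦⟧-idem (yes _) = refl
⟦⟧-idem (no _)  = refl

⟦⟧-*cong : (a? : Dec A) {m n : ℕ} → (A → m ≡ n) → ⟦ a? ⟧ * m ≡ ⟦ a? ⟧ * n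
⟦⟧-*cong (yes a) eq = cong (_+ 0) (eq a)
⟦⟧-*cong (no _)  eq = refl

∑ : List A → (A → ℕ) → ℕ
∑ xs f = sum (map f xs)

syntax ∑ xs (λ x → e) = ∑[ x ← xs ] e

module _ {f g : A → ℕ} where

  ∑-cong-∈ : ∀ xs → (∀ {x} → x ∈ˡ xs → f x ≡ g x) → ∑ xs f ≡ ∑ xs g
  ∑-cong-∈ []       eq = refl
  ∑-cong-∈ (x ∷ xs) eq = cong₂ _+_ (eq (here refl)) (∑-cong-∈ xs (eq ∘ there))

  ∑-cong : ∀ xs → (∀ x → f x ≡ g x) → ∑ xs f ≡ ∑ xs g
  ∑-cong xs eq = ∑-cong-∈ xs (λ {x} _ → eq x)

  ∑-mono : ∀ xs → (∀ x → f x ≤ g x) → ∑ xs f ≤ ∑ xs g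
  ∑-mono []       le = z≤n
  ∑-mono (x ∷ xs) le = ℕ.+-mono-≤ (le x) (∑-mono xs le)

  -- No term can be strictly smaller when the totals agree. Applied to rows and then to entries of a
  -- matrix, this reads off the equality case of the bound on common edges.
  ∑-tight : ∀ xs → (∀ x → f x ≤ g x) → ∑ xs g ≤ ∑ xs f → ∀ {x} → x ∈ˡ xs → f x ≡ g x
  ∑-tight (y ∷ xs) le ge (here refl) = ℕ.≤-antisym (le y)
    (ℕ.+-cancelʳ-≤ (∑ xs g) _ _ (ℕ.≤-trans ge (ℕ.+-monoʳ-≤ (f y) (∑-mono xs le))))
  ∑-tight (y ∷ xs) le ge (there x∈) = ∑-tight xs le
    (ℕ.+-cancelˡ-≤ (g y) _ _ (ℕ.≤-trans ge (ℕ.+-monoˡ-≤ (∑ xs f) (le y)))) x∈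

∑-zero : ∀ (xs : List A) → ∑[ x ← xs ] 0 ≡ 0
∑-zero []       = refl
∑-zero (_ ∷ xs) = ∑-zero xs

∑-const : ∀ (xs : List A) k → ∑[ x ← xs ] k ≡ length xs * k
∑-const []       k = refl
∑-const (_ ∷ xs) k = cong (k +_) (∑-const xs k)

∑-+ : ∀ xs (f g : A → ℕ) → ∑[ x ← xs ] (f x + g x) ≡ ∑ xs f + ∑ xs g
∑-+ []       f g = refl
∑-+ (x ∷ xs) f g = trans (cong (f x + g x +_) (∑-+ xs f g))
  (solve 4 (λ a b c d → a :+ b :+ (c :+ d) := a :+ c :+ (b :+ d)) refl
    (f x) (g x) (∑ xs f) (∑ xs g))
  where open +-*-Solver using (solve; _:=_; _:+_; _:*_; con)

∑-*ˡ : ∀ xs k (f : A → ℕ) → ∑[ x ← xs ] (k * f x) ≡ k * ∑ xs f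
∑-*ˡ []       k f = sym (ℕ.*-zeroʳ k)
∑-*ˡ (x ∷ xs) k f = trans (cong (k * f x +_) (∑-*ˡ xs k f)) (sym (ℕ.*-distribˡ-+ k (f x) _))

∑-*ʳ : ∀ xs k (f : A → ℕ) → ∑[ x ← xs ] (f x * k) ≡ ∑ xs f * k
∑-*ʳ xs k f = trans (∑-cong xs (λ x → ℕ.*-comm (f x) k)) (trans (∑-*ˡ xs k f) (ℕ.*-comm k _))

∑-swap : ∀ xs ys (f : A → B → ℕ) → ∑[ x ← xs ] ∑ ys (f x) ≡ ∑[ y ← ys ] ∑[ x ← xs ] f x y
∑-swap []       ys f = sym (∑-zero ys)
∑-swap (x ∷ xs) ys f = trans (cong (∑ ys (f x) +_) (∑-swap xs ys f)) (sym (∑-+ ys (f x) _))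

∑-*-∑ : ∀ xs ys (f : A → ℕ) (g : B → ℕ) →
        ∑ xs f * ∑ ys g ≡ ∑[ x ← xs ] ∑[ y ← ys ] (f x * g y)
∑-*-∑ xs ys f g = trans (sym (∑-*ʳ xs (∑ ys g) f)) (∑-cong xs (λ x → sym (∑-*ˡ ys (f x) g)))

∑-++ : ∀ xs ys (f : A → ℕ) → ∑ (xs ++ ys) f ≡ ∑ xs f + ∑ ys f
∑-++ xs ys f = trans (cong sum (List.map-++ f xs ys)) (sum-++ (map f xs) (map f ys))

∑-map : ∀ xs (h : A → B) (f : B → ℕ) → ∑ (map h xs) f ≡ ∑ xs (f ∘ h)
∑-map xs h f = cong sum (sym (List.map-∘ xs))

∑-prodWith : ∀ {Z : Set} (h : A → B → Z) xs ys f →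
             ∑ (cartesianProductWith h xs ys) f ≡ ∑[ x ← xs ] ∑[ y ← ys ] f (h x y)
∑-prodWith h []       ys f = refl
∑-prodWith h (x ∷ xs) ys f = trans (∑-++ (map (h x) ys) _ f)
  (cong₂ _+_ (∑-map ys (h x) f) (∑-prodWith h xs ys f))

∑-prod : ∀ (xs : List A) (ys : List B) f →
         ∑ (cartesianProduct xs ys) f ≡ ∑[ x ← xs ] ∑[ y ← ys ] f (x , y)
∑-prod xs ys f = ∑-prodWith _,_ xs ys f

module _ (Q? : Decidable Q) where

  ∑-filter : ∀ xs f → ∑ (filter Q? xs) f ≡ ∑[ x ← xs ] (⟦ Q? x ⟧ * f x)
  ∑-filter []       f = refl
  ∑-filter (x ∷ xs) f with Q? x
  ... | yes _ = cong₂ _+_ (sym (ℕ.+-identityʳ (f x))) (∑-filter xs f)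
  ... | no _  = ∑-filter xs f

  length-filter≡∑ : ∀ xs → length (filter Q? xs) ≡ ∑[ x ← xs ] ⟦ Q? x ⟧
  length-filter≡∑ []       = refl
  length-filter≡∑ (x ∷ xs) with Q? x
  ... | yes _ = cong suc (length-filter≡∑ xs)
  ... | no _  = length-filter≡∑ xs

-- Without duplicates, equal sets of elements are equal multisets, hence permutations of each other;
-- so the order in which graphs or maps are enumerated never enters.
∑-sameElements : ∀ {xs ys : List A} → Unique xs → Unique ys → (∀ {x} → x ∈ˡ xs ⇔ x ∈ˡ ys) →
                 ∀ f → ∑ xs f ≡ ∑ ys f
∑-sameElements xs! ys! eq f = sum-↭ (Perm.map⁺ f (∼bag⇒↭ (unique∧set⇒bag xs! ys! eq)))

map-unique : ∀ (φ : A → B) xs → (∀ {x y} → x ∈ˡ xs → y ∈ˡ xs → φ x ≡ φ y → x ≡ y) →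
             Unique xs → Unique (map φ xs)
map-unique φ []       inj xs!          = []
map-unique φ (x ∷ xs) inj (x∉xs ∷ xs!) =
  All.map⁺ (All.tabulate λ y∈ eq → All.lookup x∉xs y∈ (inj (here refl) (there y∈) eq))
  ∷ map-unique φ xs (λ x∈ y∈ → inj (there x∈) (there y∈)) xs!

∑-bijection : ∀ {xs : List A} {ys : List B} → Unique xs → Unique ys → (φ : A → B) →
  (∀ {x} → x ∈ˡ xs → φ x ∈ˡ ys) →
  (∀ {x y} → x ∈ˡ xs → y ∈ˡ xs → φ x ≡ φ y → x ≡ y) →
  (∀ {y} → y ∈ˡ ys → ∃[ x ] x ∈ˡ xs × y ≡ φ x) →
  ∀ w → ∑ ys w ≡ ∑ xs (w ∘ φ)
∑-bijection {xs = xs} xs! ys! φ into inj onto w =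
  trans (∑-sameElements ys! (map-unique φ xs inj xs!) (mk⇔ to from) w) (∑-map xs φ w)
  where
  to : ∀ {y} → y ∈ˡ _ → y ∈ˡ map φ xs
  to y∈ with onto y∈
  ... | x , x∈ , refl = ∈-map⁺ φ x∈
  from : ∀ {y} → y ∈ˡ map φ xs → y ∈ˡ _
  from y∈ with ∈-map⁻ φ y∈
  ... | x , x∈ , refl = into x∈

∑-single : ∀ {xs : List A} → Unique xs → (Q? : Decidable Q) → ∀ {a} → a ∈ˡ xs → Q a →
           (∀ {x} → Q x → x ≡ a) → ∀ f → ∑[ x ← xs ] (⟦ Q? x ⟧ * f x) ≡ f a
∑-single {Q = Q} {xs = xs} xs! Q? {a} a∈ Qa unique f = begin
  ∑[ x ← xs ] (⟦ Q? x ⟧ * f x)  ≡⟨ ∑-filter Q? xs f ⟨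
  ∑ (filter Q? xs) f            ≡⟨ ∑-sameElements (Unique.filter⁺ Q? xs!) ([] ∷ [])
                                     (mk⇔ (λ x∈ → here (unique (proj₂ (∈-filter⁻ Q? {xs = xs} x∈)))) from) f ⟩
  f a + 0                       ≡⟨ ℕ.+-identityʳ (f a) ⟩
  f a                           ∎
  where
  open ≡-Reasoning
  from : ∀ {x} → x ∈ˡ a ∷ [] → x ∈ˡ filter Q? xs
  from (here refl) = ∈-filter⁺ Q? a∈ Qa

∑-⟦⟧-single : ∀ {xs : List A} → Unique xs → (Q? : Decidable Q) → ∀ {a} → a ∈ˡ xs → Q a →
              (∀ {x} → Q x → x ≡ a) → ∑[ x ← xs ] ⟦ Q? x ⟧ ≡ 1
∑-⟦⟧-single {xs = xs} xs! Q? a∈ Qa unique =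
  trans (∑-cong xs (λ x → sym (ℕ.*-identityʳ ⟦ Q? x ⟧))) (∑-single xs! Q? a∈ Qa unique (λ _ → 1))

∑-⟦⟧-none : ∀ (xs : List A) (Q? : Decidable Q) → (∀ x → ¬ Q x) → ∑[ x ← xs ] ⟦ Q? x ⟧ ≡ 0
∑-⟦⟧-none xs Q? none = trans (∑-cong xs (λ x → ⟦⟧-no (Q? x) (none x))) (∑-zero xs)

-- Enumerations, sums over `Fin n`, and sizes of subsets

allVecs-unique : ∀ {xs : List A} → Unique xs → ∀ n → Unique (allVecs xs n)
allVecs-unique xs! zero    = [] ∷ []
allVecs-unique xs! (suc n) =
  Unique.cartesianProductWith⁺ Vec._∷_ Vec.∷-injective xs! (allVecs-unique xs! n)

∈-allVecs : ∀ {xs : List A} → (∀ x → x ∈ˡ xs) → ∀ {n} (w : Vec A n) → w ∈ˡ allVecs xs n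
∈-allVecs all Vec.[]      = here refl
∈-allVecs all (x Vec.∷ w) = ∈-cartesianProductWith⁺ Vec._∷_ (all x) (∈-allVecs all w)

allSubsets-unique : ∀ n → Unique (allSubsets n)
allSubsets-unique = allVecs-unique (((λ ()) ∷ []) ∷ [] ∷ [])

∈-allSubsets : ∀ {n} (p : Subset n) → p ∈ˡ allSubsets n
∈-allSubsets = ∈-allVecs λ where
  inside  → here refl
  outside → there (here refl)

∑Fin : ∀ n → (Fin n → ℕ) → ℕ
∑Fin n f = ∑ (allFin n) f

syntax ∑Fin n (λ x → e) = ∑[ x < n ] e

∑Fin-suc : ∀ n f → ∑Fin (suc n) f ≡ f zero + ∑Fin n (f ∘ suc)
∑Fin-suc n f = cong (f zero +_) (trans
  (cong (λ xs → ∑ xs f) (sym (List.map-tabulate id suc)))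
  (∑-map (allFin n) suc f))

∑Fin-lookup : ∀ (xs : List A) f → ∑Fin (length xs) (f ∘ List.lookup xs) ≡ ∑ xs f
∑Fin-lookup xs f = trans (sym (∑-map (allFin _) (List.lookup xs) f))
  (cong (λ ys → ∑ ys f) (trans (List.map-tabulate id (List.lookup xs)) (List.tabulate-lookup xs)))

length-allFin : ∀ n → length (allFin n) ≡ n
length-allFin n = List.length-tabulate id

∑Fin-const : ∀ n k → ∑[ x < n ] k ≡ n * k
∑Fin-const n k = trans (∑-const (allFin n) k) (cong (_* k) (length-allFin n))

∑Fin-single : ∀ {n} {P : Fin n → Set} (P? : Decidable P) a → P a → (∀ {x} → P x → x ≡ a) →
              ∀ f → ∑[ x < n ] (⟦ P? x ⟧ * f x) ≡ f a
∑Fin-single {n} P? a = ∑-single (Unique.allFin⁺ n) P? (∈-allFin a)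

∑Fin-⟦⟧-single : ∀ {n} {P : Fin n → Set} (P? : Decidable P) a → P a → (∀ {x} → P x → x ≡ a) →
                 ∑[ x < n ] ⟦ P? x ⟧ ≡ 1
∑Fin-⟦⟧-single {n} P? a = ∑-⟦⟧-single (Unique.allFin⁺ n) P? (∈-allFin a)

∣p∣≡∑ : ∀ {n} (p : Subset n) → ∣ p ∣ ≡ ∑[ x < n ] ⟦ x ∈? p ⟧
∣p∣≡∑ {zero}  Vec.[]        = refl
∣p∣≡∑ {suc n} (b Vec.∷ p) = sym (trans (∑Fin-suc n _) (trans (cong (⟦ zero ∈? b Vec.∷ p ⟧ +_)
   (trans (∑-cong (allFin n) (λ x → ⟦⟧-cong (suc x ∈? b Vec.∷ p) (x ∈? p) Subset.drop-there Vec.there))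
          (sym (∣p∣≡∑ p)))) (head b)))
  where
  head : ∀ b → ⟦ zero ∈? b Vec.∷ p ⟧ + ∣ p ∣ ≡ ∣ b Vec.∷ p ∣
  head inside  = refl
  head outside = refl

∣p∪q∣+∣p∩q∣ : ∀ {n} (p q : Subset n) → ∣ p ∪ q ∣ + ∣ p ∩ q ∣ ≡ ∣ p ∣ + ∣ q ∣
∣p∪q∣+∣p∩q∣ Vec.[]              Vec.[]              = refl
∣p∪q∣+∣p∩q∣ (outside Vec.∷ p) (outside Vec.∷ q) = ∣p∪q∣+∣p∩q∣ p q
∣p∪q∣+∣p∩q∣ (outside Vec.∷ p) (inside  Vec.∷ q) =
  trans (cong suc (∣p∪q∣+∣p∩q∣ p q)) (sym (ℕ.+-suc ∣ p ∣ ∣ q ∣))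
∣p∪q∣+∣p∩q∣ (inside  Vec.∷ p) (outside Vec.∷ q) = cong suc (∣p∪q∣+∣p∩q∣ p q)
∣p∪q∣+∣p∩q∣ (inside  Vec.∷ p) (inside  Vec.∷ q) = cong suc
  (trans (ℕ.+-suc ∣ p ∪ q ∣ ∣ p ∩ q ∣)
         (trans (cong suc (∣p∪q∣+∣p∩q∣ p q)) (sym (ℕ.+-suc ∣ p ∣ ∣ q ∣))))


-- Edges and adjacency

edge : ∀ n → Fin (length (pairs n)) → Fin n × Fin n
edge n = List.lookup (pairs n)

lookup-injective : ∀ {xs : List A} → Unique xs → ∀ {i j} → List.lookup xs i ≡ List.lookup xs j → i ≡ j
lookup-injective (x∉ ∷ xs!) {zero}  {zero}  eq = refl
lookup-injective {xs = x ∷ xs} (x∉ ∷ xs!) {zero}  {suc j} eq = ⊥-elim (All.lookup x∉ (∈-lookup {xs = xs} j) eq)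
lookup-injective {xs = x ∷ xs} (x∉ ∷ xs!) {suc i} {zero}  eq = ⊥-elim (All.lookup x∉ (∈-lookup {xs = xs} i) (sym eq))
lookup-injective (x∉ ∷ xs!) {suc i} {suc j} eq = cong suc (lookup-injective xs! eq)

module _ (n : ℕ) where

  edge-injective : ∀ {e e′} → edge n e ≡ edge n e′ → e ≡ e′
  edge-injective = lookup-injective
    (Unique.filter⁺ _ (Unique.cartesianProduct⁺ (Unique.allFin⁺ n) (Unique.allFin⁺ n)))

  edge-ordered : ∀ e {x y} → edge n e ≡ (x , y) → x Fin.< y
  edge-ordered e eq = subst (λ (x , y) → x Fin.< y) eq
    (proj₂ (∈-filter⁻ _ {xs = cartesianProduct (allFin n) (allFin n)} (∈-lookup e)))

  edge-index : ∀ {x y} → x Fin.< y → ∃[ e ] edge n e ≡ (x , y)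
  edge-index {x} {y} x<y = Any.index xy∈ , sym (lookup-index xy∈)
    where
    xy∈ : (x , y) ∈ˡ pairs n
    xy∈ = ∈-filter⁺ _ (∈-cartesianProduct⁺ (∈-allFin x) (∈-allFin y)) x<y

  ∑-edges : ∀ f → ∑[ e < length (pairs n) ] f (edge n e) ≡
                  ∑[ x < n ] ∑[ y < n ] (⟦ x Fin.<? y ⟧ * f (x , y))
  ∑-edges f = trans (∑Fin-lookup (pairs n) f) (trans
    (∑-filter _ (cartesianProduct (allFin n) (allFin n)) f)
    (∑-prod (allFin n) (allFin n) _))

  same-edge : ∀ {e e′ x y} → edge n e ≡ (x , y) ⊎ edge n e ≡ (y , x) →
              edge n e′ ≡ (x , y) ⊎ edge n e′ ≡ (y , x) → e ≡ e′
  same-edge (inj₁ p) (inj₁ q) = edge-injective (trans p (sym q))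
  same-edge (inj₂ p) (inj₂ q) = edge-injective (trans p (sym q))
  -- Every pair is stored with its smaller end first, so the crossed cases would give both x < y and
  -- y < x.
  same-edge {e} {e′} (inj₁ p) (inj₂ q) = ⊥-elim (Fin.<-asym (edge-ordered e p) (edge-ordered e′ q))
  same-edge {e} {e′} (inj₂ p) (inj₁ q) = ⊥-elim (Fin.<-asym (edge-ordered e p) (edge-ordered e′ q))

  module _ (F : Graph n) where

    Adj-sym : ∀ {x y : Fin n} → Adj F x y → Adj F y x
    Adj-sym (e , e∈F , eq) = e , e∈F , Sum.swap eq

    Adj-irrefl : ∀ {x : Fin n} → ¬ Adj F x x
    Adj-irrefl (e , _ , eq) = Fin.<-irrefl refl (edge-ordered e ([ id , id ]′ eq))

    Adj⇒∈ : ∀ {e} → Adj F (proj₁ (edge n e)) (proj₂ (edge n e)) → e ∈ F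
    Adj⇒∈ {e} (e′ , e′∈F , eq) = subst (_∈ F) (same-edge {e′} {e} eq (inj₁ refl)) e′∈F

    ∈⇒Adj : ∀ {e} → e ∈ F → Adj F (proj₁ (edge n e)) (proj₂ (edge n e))
    ∈⇒Adj {e} e∈F = e , e∈F , inj₁ refl

  Adj-∩⁻ : ∀ F G {x y} → Adj {n} (F ∩ G) x y → Adj F x y × Adj G x y
  Adj-∩⁻ F G (e , e∈ , eq) = let e∈F , e∈G = Subset.x∈p∩q⁻ F G e∈ in (e , e∈F , eq) , (e , e∈G , eq)

  Adj-⊆ : ∀ F G → (∀ {x y} → Adj {n} F x y → Adj G x y) → F ⊆ G
  Adj-⊆ F G sub e∈F = Adj⇒∈ G (sub (∈⇒Adj F e∈F))

  Adj-ext : ∀ F G → (∀ {x y} → Adj {n} F x y → Adj G x y) → (∀ {x y} → Adj G x y → Adj F x y) → F ≡ G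
  Adj-ext F G to from = Subset.⊆-antisym (Adj-⊆ F G to) (Adj-⊆ G F from)

  trichotomy : ∀ (x y : Fin n) → ⟦ x Fin.<? y ⟧ + ⟦ y Fin.<? x ⟧ + ⟦ x Fin.≟ y ⟧ ≡ 1
  trichotomy x y with Fin.<-cmp x y
  ... | tri< a b c
    rewrite ⟦⟧-yes (x Fin.<? y) a | ⟦⟧-no (y Fin.<? x) c | ⟦⟧-no (x Fin.≟ y) b = refl
  ... | tri≈ a b c
    rewrite ⟦⟧-no (x Fin.<? y) a | ⟦⟧-no (y Fin.<? x) c | ⟦⟧-yes (x Fin.≟ y) b = refl
  ... | tri> a b c
    rewrite ⟦⟧-no (x Fin.<? y) a | ⟦⟧-yes (y Fin.<? x) c | ⟦⟧-no (x Fin.≟ y) b = refl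

  -- The square is cut along its diagonal, and the parts above and below agree by symmetry. The
  -- constant 1 gives the length of `pairs n`, an adjacency indicator gives the handshake lemma.
  ∑-symmetric : ∀ (f : Fin n → Fin n → ℕ) → (∀ x y → f x y ≡ f y x) →
    ∑[ x < n ] ∑[ y < n ] f x y ≡
    2 * ∑[ e < length (pairs n) ] f (proj₁ (edge n e)) (proj₂ (edge n e)) + ∑[ x < n ] f x x
  ∑-symmetric f f-sym = begin
    ∑[ x < n ] ∑[ y < n ] f x y
      ≡⟨ ∑∑-cong (λ x y → trans (sym (trans (cong (_* f x y) (trichotomy x y)) (ℕ.*-identityˡ _)))
           (solve 4 (λ a b c d → (a :+ b :+ c) :* d := a :* d :+ b :* d :+ c :* d) refl
             ⟦ x Fin.<? y ⟧ ⟦ y Fin.<? x ⟧ ⟦ x Fin.≟ y ⟧ (f x y))) ⟩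
    ∑[ x < n ] ∑[ y < n ] (L x y + M x y + D x y)
      ≡⟨ trans (∑∑-+ (λ x y → L x y + M x y) D) (cong (_+ ∑∑ D) (∑∑-+ L M)) ⟩
    ∑∑ L + ∑∑ M + ∑∑ D
      ≡⟨ cong₂ (λ a b → ∑∑ L + a + b)
           (trans (∑-swap (allFin n) (allFin n) M)
                  (∑∑-cong (λ y x → cong (⟦ y Fin.<? x ⟧ *_) (f-sym x y))))
           (∑-cong (allFin n) (λ x → ∑Fin-single (x Fin.≟_) x refl sym (f x))) ⟩
    ∑∑ L + ∑∑ L + ∑[ x < n ] f x x
      ≡⟨ cong (_+ ∑[ x < n ] f x x) (cong (∑∑ L +_) (sym (ℕ.+-identityʳ (∑∑ L)))) ⟩
    2 * ∑∑ L + ∑[ x < n ] f x x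
      ≡⟨ cong (λ s → 2 * s + ∑[ x < n ] f x x) (sym (∑-edges (λ (x , y) → f x y))) ⟩
    2 * ∑[ e < length (pairs n) ] f (proj₁ (edge n e)) (proj₂ (edge n e)) + ∑[ x < n ] f x x ∎
    where
    open ≡-Reasoning
    open +-*-Solver using (solve; _:=_; _:+_; _:*_; con)
    ∑∑ : (Fin n → Fin n → ℕ) → ℕ
    ∑∑ g = ∑[ x < n ] ∑[ y < n ] g x y
    ∑∑-cong : ∀ {g h} → (∀ x y → g x y ≡ h x y) → ∑∑ g ≡ ∑∑ h
    ∑∑-cong eq = ∑-cong (allFin n) (λ x → ∑-cong (allFin n) (eq x))
    ∑∑-+ : ∀ g h → ∑∑ (λ x y → g x y + h x y) ≡ ∑∑ g + ∑∑ h
    ∑∑-+ g h = trans (∑-cong (allFin n) (λ x → ∑-+ (allFin n) (g x) (h x))) (∑-+ (allFin n) _ _)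
    L M D : Fin n → Fin n → ℕ
    L x y = ⟦ x Fin.<? y ⟧ * f x y
    M x y = ⟦ y Fin.<? x ⟧ * f x y
    D x y = ⟦ x Fin.≟ y ⟧ * f x y

  -- Unlike indices into `pairs n`, ordered pairs of vertices can be transported along an embedding,
  -- so edge counts are compared in this form.
  handshake : ∀ (F : Graph n) → ∑[ x < n ] ∑[ y < n ] ⟦ Adj? F x y ⟧ ≡ 2 * ∣ F ∣
  handshake F = begin
    ∑[ x < n ] ∑[ y < n ] ⟦ Adj? F x y ⟧
      ≡⟨ ∑-symmetric (λ x y → ⟦ Adj? F x y ⟧)
           (λ x y → ⟦⟧-cong (Adj? F x y) (Adj? F y x) (Adj-sym F) (Adj-sym F)) ⟩
    2 * ∑[ e < length (pairs n) ] ⟦ Adj? F (proj₁ (edge n e)) (proj₂ (edge n e)) ⟧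
      + ∑[ x < n ] ⟦ Adj? F x x ⟧
      ≡⟨ cong₂ (λ a b → 2 * a + b)
           (trans (∑-cong (allFin _) (λ e → ⟦⟧-cong (Adj? F _ _) (e ∈? F) (Adj⇒∈ F) (∈⇒Adj F)))
                  (sym (∣p∣≡∑ F)))
           (∑-⟦⟧-none (allFin n) (λ x → Adj? F x x) (λ x → Adj-irrefl F)) ⟩
    2 * ∣ F ∣ + 0
      ≡⟨ ℕ.+-identityʳ (2 * ∣ F ∣) ⟩
    2 * ∣ F ∣ ∎
    where open ≡-Reasoning

2*nC2+n≡n*n : ∀ n → 2 * (n C 2) + n ≡ n * n
2*nC2+n≡n*n zero    = refl
2*nC2+n≡n*n (suc n) = begin
  2 * (suc n C 2) + suc n          ≡⟨ cong (λ t → 2 * t + suc n)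
                                       (trans (sym (nCk+nC[k+1]≡[n+1]C[k+1] n 1)) (cong (_+ n C 2) (nC1≡n n))) ⟩
  2 * (n + n C 2) + suc n          ≡⟨ solve 2 (λ n c → con 2 :* (n :+ c) :+ (con 1 :+ n)
                                        := (con 2 :* c :+ n) :+ (con 1 :+ n :+ n)) refl n (n C 2) ⟩
  2 * (n C 2) + n + (1 + n + n)    ≡⟨ cong (_+ (1 + n + n)) (2*nC2+n≡n*n n) ⟩
  n * n + (1 + n + n)              ≡⟨ solve 1 (λ n → n :* n :+ (con 1 :+ n :+ n)
                                        := (con 1 :+ n) :* (con 1 :+ n)) refl n ⟩
  suc n * suc n                    ∎
  where open ≡-Reasoning
        open +-*-Solver using (solve; _:=_; _:+_; _:*_; con)

length-pairs : ∀ n → length (pairs n) ≡ n C 2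
length-pairs n = ℕ.*-cancelˡ-≡ _ _ 2 (ℕ.+-cancelʳ-≡ n _ _ (begin
  2 * length (pairs n) + n
    ≡⟨ cong₂ (λ a b → 2 * a + b) (units (length (pairs n))) (units n) ⟩
  2 * ∑[ e < length (pairs n) ] 1 + ∑[ x < n ] 1
    ≡⟨ ∑-symmetric n (λ _ _ → 1) (λ _ _ → refl) ⟨
  ∑[ x < n ] ∑[ y < n ] 1
    ≡⟨ trans (∑-cong (allFin n) (λ _ → sym (units n))) (∑Fin-const n n) ⟩
  n * n
    ≡⟨ 2*nC2+n≡n*n n ⟨
  2 * (n C 2) + n ∎))
  where
  open ≡-Reasoning
  units : ∀ m → m ≡ ∑[ x < m ] 1
  units m = sym (trans (∑Fin-const m 1) (ℕ.*-identityʳ m))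

comprehension : ∀ {n} {P : Fin n → Set} → Decidable P → Subset n
comprehension P? = Vec.tabulate (does ∘ P?)

module _ {n} {P : Fin n → Set} (P? : Decidable P) where

  ∈-comprehension⁺ : ∀ {x} → P x → x ∈ comprehension P?
  ∈-comprehension⁺ {x} Px = Vec.lookup⇒[]= x _
    (trans (Vec.lookup∘tabulate (does ∘ P?) x) (dec-true (P? x) Px))

  ∈-comprehension⁻ : ∀ {x} → x ∈ comprehension P? → P x
  ∈-comprehension⁻ {x} x∈ with P? x | trans (sym (Vec.lookup∘tabulate (does ∘ P?) x)) (Vec.[]=⇒lookup x∈)
  ... | yes Px | _ = Px

vec-ext : ∀ {A : Set} {n} {f g : Vec A n} → (∀ i → lookup f i ≡ lookup g i) → f ≡ g
vec-ext {f = f} {g} eq =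
  trans (sym (Vec.tabulate∘lookup f)) (trans (Vec.tabulate-cong eq) (Vec.tabulate∘lookup g))

-- Embeddings and copies

Inj : ∀ {n v} → Vec (Fin n) v → Set
Inj f = Injective _≡_ _≡_ (lookup f)

inj? : ∀ {n v} (f : Vec (Fin n) v) → Dec (Inj f)
inj? f = map′ (λ inj {i} {j} → inj i j) (λ inj i j → inj {i} {j})
  (Fin.all? λ i → Fin.all? λ j → (lookup f i Fin.≟ lookup f j) →-dec (i Fin.≟ j))

InImage : ∀ {n v} → Vec (Fin n) v → Fin n → Set
InImage f x = ∃[ i ] lookup f i ≡ x

inImage? : ∀ {n v} (f : Vec (Fin n) v) → Decidable (InImage f)
inImage? f x = Fin.any? λ i → lookup f i Fin.≟ x

maps : ∀ v n → List (Vec (Fin n) v)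
maps v n = allVecs (allFin n) v

maps-unique : ∀ v n → Unique (maps v n)
maps-unique v n = allVecs-unique (Unique.allFin⁺ n) v

embeddings : ∀ v n → List (Vec (Fin n) v)
embeddings v n = filter inj? (maps v n)

embeddings-unique : ∀ v n → Unique (embeddings v n)
embeddings-unique v n = Unique.filter⁺ inj? (maps-unique v n)

∈-embeddings⁺ : ∀ {v n} {f : Vec (Fin n) v} → Inj f → f ∈ˡ embeddings v n
∈-embeddings⁺ {f = f} inj = ∈-filter⁺ inj? (∈-allVecs ∈-allFin f) inj

∈-embeddings⁻ : ∀ {v n} {f : Vec (Fin n) v} → f ∈ˡ embeddings v n → Inj f
∈-embeddings⁻ {v} {n} f∈ = proj₂ (∈-filter⁻ inj? {xs = maps v n} f∈)

∑-image : ∀ {n v} (f : Vec (Fin n) v) → Inj f → ∀ K → (∀ x → ¬ InImage f x → K x ≡ 0) →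
          ∑[ x < n ] K x ≡ ∑[ i < v ] K (lookup f i)
∑-image {n} {v} f inj K vanish = sym (begin
  ∑[ i < v ] K (lookup f i)
    ≡⟨ ∑-cong (allFin v) (λ i → sym (∑Fin-single (lookup f i Fin.≟_) (lookup f i) refl sym K)) ⟩
  ∑[ i < v ] ∑[ x < n ] (⟦ lookup f i Fin.≟ x ⟧ * K x)
    ≡⟨ ∑-swap (allFin v) (allFin n) _ ⟩
  ∑[ x < n ] ∑[ i < v ] (⟦ lookup f i Fin.≟ x ⟧ * K x)
    ≡⟨ ∑-cong (allFin n) (λ x → trans (∑-*ʳ (allFin v) (K x) _) (fibre x)) ⟩
  ∑[ x < n ] K x ∎)
  where
  open ≡-Reasoning
  fibre : ∀ x → (∑[ i < v ] ⟦ lookup f i Fin.≟ x ⟧) * K x ≡ K x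
  fibre x with inImage? f x
  ... | yes (i , refl) = trans
    (cong (_* K x) (∑Fin-⟦⟧-single (λ j → lookup f j Fin.≟ x) i refl inj)) (ℕ.*-identityˡ (K x))
  ... | no x∉ = trans (cong ((∑[ i < v ] ⟦ lookup f i Fin.≟ x ⟧) *_) (vanish x x∉))
    (trans (ℕ.*-zeroʳ (∑[ i < v ] ⟦ lookup f i Fin.≟ x ⟧)) (sym (vanish x x∉)))

∑-inImage : ∀ {n v} (f : Vec (Fin n) v) → Inj f → ∑[ x < n ] ⟦ inImage? f x ⟧ ≡ v
∑-inImage {n} {v} f inj = begin
  ∑[ x < n ] ⟦ inImage? f x ⟧             ≡⟨ ∑-image f inj _ (λ x → ⟦⟧-no (inImage? f x)) ⟩
  ∑[ i < v ] ⟦ inImage? f (lookup f i) ⟧  ≡⟨ ∑-cong (allFin v) (λ i → ⟦⟧-yes (inImage? f (lookup f i)) (i , refl)) ⟩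
  ∑[ i < v ] 1                            ≡⟨ ∑Fin-const v 1 ⟩
  v * 1                                   ≡⟨ ℕ.*-identityʳ v ⟩
  v                                       ∎
  where open ≡-Reasoning

length≡∑ : ∀ {A : Set} (xs : List A) → length xs ≡ ∑[ x ← xs ] 1
length≡∑ xs = sym (trans (∑-const xs 1) (ℕ.*-identityʳ (length xs)))

-- `_P_` returns 0 outright when k > n, whereas `_P′_` is the bare product of truncated differences.
-- Such a product contains the factor `n ∸ n`, so the recursion of `_P′_` is valid for `_P_` without
-- a condition.
P≡P′ : ∀ n k → n P k ≡ n P′ k
P≡P′ n k with k ℕ.≤? n
... | yes k≤n with k ℕ.≤ᵇ n | ℕ.≤⇒≤ᵇ k≤n
...   | true | _ = refl
P≡P′ n k | no k≰n = trans (k>n⇒nPk≡0 (ℕ.≰⇒> k≰n)) (sym (vanish k (ℕ.≰⇒> k≰n)))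
  where
  vanish : ∀ k → n < k → n P′ k ≡ 0
  vanish (suc k) n<1+k with ℕ.m≤n⇒m<n∨m≡n (ℕ.≤-pred n<1+k)
  ... | inj₁ n<k = trans (cong ((n ∸ k) *_) (vanish k n<k)) (ℕ.*-zeroʳ (n ∸ k))
  ... | inj₂ n≡k = cong (_* (n P′ k)) (ℕ.m≤n⇒m∸n≡0 (ℕ.≤-reflexive n≡k))

P-suc : ∀ n k → n P suc k ≡ (n ∸ k) * (n P k)
P-suc n k = trans (P≡P′ n (suc k)) (cong ((n ∸ k) *_) (sym (P≡P′ n k)))

-- The first value of an injection must avoid the image of the rest, which is again an injection and
-- leaves `n ∸ v` choices.
length-embeddings : ∀ v n → length (embeddings v n) ≡ n P v
length-embeddings zero    n = refl
length-embeddings (suc v) n = begin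
  length (embeddings (suc v) n)
    ≡⟨ length-filter≡∑ inj? (maps (suc v) n) ⟩
  ∑[ f ← maps (suc v) n ] ⟦ inj? f ⟧
    ≡⟨ ∑-prodWith Vec._∷_ (allFin n) (maps v n) (λ f → ⟦ inj? f ⟧) ⟩
  ∑[ x < n ] ∑[ f ← maps v n ] ⟦ inj? (x Vec.∷ f) ⟧
    ≡⟨ ∑-cong (allFin n) (λ x → ∑-cong (maps v n) (λ f → trans
         (⟦⟧-cong (inj? (x Vec.∷ f)) (inj? f ×-dec ¬? (inImage? f x)) uncons (λ (p , q) → cons p q))
         (⟦⟧-× (inj? f) (¬? (inImage? f x))))) ⟩
  ∑[ x < n ] ∑[ f ← maps v n ] (⟦ inj? f ⟧ * ⟦ ¬? (inImage? f x) ⟧)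
    ≡⟨ ∑-swap (allFin n) (maps v n) _ ⟩
  ∑[ f ← maps v n ] ∑[ x < n ] (⟦ inj? f ⟧ * ⟦ ¬? (inImage? f x) ⟧)
    ≡⟨ ∑-cong (maps v n) (λ f → trans (∑-*ˡ (allFin n) ⟦ inj? f ⟧ _) (⟦⟧-*cong (inj? f) (avoiding f))) ⟩
  ∑[ f ← maps v n ] (⟦ inj? f ⟧ * (n ∸ v))
    ≡⟨ ∑-*ʳ (maps v n) (n ∸ v) _ ⟩
  (∑[ f ← maps v n ] ⟦ inj? f ⟧) * (n ∸ v)
    ≡⟨ cong (_* (n ∸ v)) (trans (sym (length-filter≡∑ inj? (maps v n))) (length-embeddings v n)) ⟩
  (n P v) * (n ∸ v)
    ≡⟨ trans (ℕ.*-comm (n P v) (n ∸ v)) (sym (P-suc n v)) ⟩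
  n P suc v ∎
  where
  open ≡-Reasoning
  uncons : ∀ {x} {f : Vec (Fin n) v} → Inj (x Vec.∷ f) → Inj f × ¬ InImage f x
  uncons inj = (λ eq → Fin.suc-injective (inj eq)) , λ (i , eq) → Fin.0≢1+n (sym (inj {suc i} {zero} eq))
  cons : ∀ {x} {f : Vec (Fin n) v} → Inj f → ¬ InImage f x → Inj (x Vec.∷ f)
  cons inj x∉ {zero}  {zero}  eq = refl
  cons inj x∉ {zero}  {suc j} eq = contradiction (j , sym eq) x∉
  cons inj x∉ {suc i} {zero}  eq = contradiction (i , eq) x∉
  cons inj x∉ {suc i} {suc j} eq = cong suc (inj eq)
  complementary : ∀ {A : Set} (a? : Dec A) → ⟦ ¬? a? ⟧ + ⟦ a? ⟧ ≡ 1
  complementary (yes _) = refl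
  complementary (no _)  = refl
  avoiding : ∀ f → Inj f → ∑[ x < n ] ⟦ ¬? (inImage? f x) ⟧ ≡ n ∸ v
  -- The `v` values in the image complete the sum to `n`, so `n ∸ v` is a true difference as soon as
  -- an injection exists.
  avoiding f inj = trans (sym (ℕ.m+n∸n≡m (∑[ x < n ] ⟦ ¬? (inImage? f x) ⟧) v)) (cong (_∸ v) (begin
    (∑[ x < n ] ⟦ ¬? (inImage? f x) ⟧) + v
      ≡⟨ cong ((∑[ x < n ] ⟦ ¬? (inImage? f x) ⟧) +_) (sym (∑-inImage f inj)) ⟩
    (∑[ x < n ] ⟦ ¬? (inImage? f x) ⟧) + (∑[ x < n ] ⟦ inImage? f x ⟧)
      ≡⟨ sym (∑-+ (allFin n) _ _) ⟩
    ∑[ x < n ] (⟦ ¬? (inImage? f x) ⟧ + ⟦ inImage? f x ⟧)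
      ≡⟨ ∑-cong (allFin n) (λ x → complementary (inImage? f x)) ⟩
    ∑[ x < n ] 1
      ≡⟨ trans (∑Fin-const n 1) (ℕ.*-identityʳ n) ⟩
    n ∎))

module Copies (v : ℕ) (H : Graph v) (n : ℕ) where

  ImageEdge : Vec (Fin n) v → Fin n → Fin n → Set
  ImageEdge f x y = ∃[ i ] ∃[ j ] Adj H i j × lookup f i ≡ x × lookup f j ≡ y

  imageEdge? : ∀ f x y → Dec (ImageEdge f x y)
  imageEdge? f x y = Fin.any? λ i → Fin.any? λ j →
    Adj? H i j ×-dec (lookup f i Fin.≟ x) ×-dec (lookup f j Fin.≟ y)

  InImageEdges : Vec (Fin n) v → Fin (length (pairs n)) → Set
  InImageEdges f e = ImageEdge f (proj₁ (edge n e)) (proj₂ (edge n e))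

  inImageEdges? : ∀ f → Decidable (InImageEdges f)
  inImageEdges? f e = imageEdge? f (proj₁ (edge n e)) (proj₂ (edge n e))

  image : Vec (Fin n) v → Subgraph n
  image f = comprehension (inImage? f) , comprehension (inImageEdges? f)

  imageEdges : Vec (Fin n) v → Graph n
  imageEdges f = edges n (image f)

  ImageEdge-sym : ∀ f {x y} → ImageEdge f x y → ImageEdge f y x
  ImageEdge-sym f (i , j , ij , p , q) = j , i , Adj-sym v H ij , q , p

  Adj-image⁻ : ∀ f {x y : Fin n} → Adj (imageEdges f) x y → ImageEdge f x y
  Adj-image⁻ f (e , e∈ , inj₁ eq) =
    subst (λ (x , y) → ImageEdge f x y) eq (∈-comprehension⁻ (inImageEdges? f) e∈)
  Adj-image⁻ f (e , e∈ , inj₂ eq) =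
    ImageEdge-sym f (subst (λ (x , y) → ImageEdge f x y) eq (∈-comprehension⁻ (inImageEdges? f) e∈))

  Adj-image⁺ : ∀ f → Inj f → ∀ {x y : Fin n} → ImageEdge f x y → Adj (imageEdges f) x y
  Adj-image⁺ f inj {x} {y} xy@(i , j , ij , p , q) with Fin.<-cmp x y
  ... | tri< x<y _ _ = let e , eq = edge-index n x<y in
    e , ∈-comprehension⁺ (inImageEdges? f) (subst (λ (x , y) → ImageEdge f x y) (sym eq) xy) , inj₁ eq
  ... | tri> _ _ y<x = let e , eq = edge-index n y<x in
    e , ∈-comprehension⁺ (inImageEdges? f) (subst (λ (x , y) → ImageEdge f x y) (sym eq) (ImageEdge-sym f xy)) , inj₂ eq
  -- By injectivity, a loop in the image would come from a loop of `H`.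
  ... | tri≈ _ x≡y _ = contradiction
    (subst (Adj H i) (sym (inj (trans p (trans x≡y (sym q))))) ij) (Adj-irrefl v H)

  image-isIso : ∀ f → Inj f → IsIso v n H (image f) f
  image-isIso f inj =
    inj ,
    (λ x → mk⇔ (∈-comprehension⁻ (inImage? f)) (∈-comprehension⁺ (inImage? f))) ,
    (λ i j → mk⇔ (λ ij → Adj-image⁺ f inj (i , j , ij , refl , refl)) from)
    where
    from : ∀ {i j} → Adj (imageEdges f) (lookup f i) (lookup f j) → Adj H i j
    from adj with Adj-image⁻ f adj
    ... | i′ , j′ , ij , p , q with refl ← inj {i′} p | refl ← inj {j′} q = ij

  image-isSubgraph : ∀ f → IsSubgraph n (image f) (complete n)
  image-isSubgraph f = Subset.⊆⊤ , λ x y xy → let i , j , _ , p , q = Adj-image⁻ f xy in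
    ∈-comprehension⁺ (inImage? f) (i , p) , ∈-comprehension⁺ (inImage? f) (j , q)

  -- The ends of an edge of `F` lie in `W` because `S` is a subgraph, hence have preimages under
  -- `f`; so `F` has no edges besides the images of edges of `H`. An embedding therefore belongs to
  -- exactly one copy.
  isIso⇒≡image : ∀ S f → IsSubgraph n S (complete n) → IsIso v n H S f → S ≡ image f
  isIso⇒≡image (W , F) f (_ , ends) (inj , onto , adj) = cong₂ _,_
    (Subset.⊆-antisym (λ x∈W → ∈-comprehension⁺ (inImage? f) (Equivalence.to (onto _) x∈W))
                      (λ x∈ → Equivalence.from (onto _) (∈-comprehension⁻ (inImage? f) x∈)))
    (Adj-ext n F (imageEdges f) to from)
    where
    to : ∀ {x y : Fin n} → Adj F x y → Adj (imageEdges f) x y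
    to {x} {y} xy with Equivalence.to (onto x) (proj₁ (ends x y xy)) | Equivalence.to (onto y) (proj₂ (ends x y xy))
    ... | i , refl | j , refl = Adj-image⁺ f inj (i , j , Equivalence.from (adj i j) xy , refl , refl)
    from : ∀ {x y : Fin n} → Adj (imageEdges f) x y → Adj F x y
    from xy with Adj-image⁻ f xy
    ... | i , j , ij , refl , refl = Equivalence.to (adj i j) ij

  Kn-copies : List (Subgraph n)
  Kn-copies = copies v n H (complete n)

  allSubgraphs-unique : Unique (allSubgraphs n)
  allSubgraphs-unique = Unique.cartesianProduct⁺ (allSubsets-unique n) (allSubsets-unique _)

  ∈-copies⁺ : ∀ {S} g → IsSubgraph n S g → Isomorphic v n H S → S ∈ˡ copies v n H g
  ∈-copies⁺ g sub iso =
    ∈-filter⁺ (λ S → isSubgraph? n S g ×-dec isomorphic? v n H S)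
      (∈-cartesianProduct⁺ (∈-allSubsets _) (∈-allSubsets _)) (sub , iso)

  ∈-copies⁻ : ∀ {S} g → S ∈ˡ copies v n H g → IsSubgraph n S g × Isomorphic v n H S
  ∈-copies⁻ g S∈ = proj₂ (∈-filter⁻ (λ S → isSubgraph? n S g ×-dec isomorphic? v n H S)
                           {xs = allSubgraphs n} S∈)

  copies-unique : ∀ g → Unique (copies v n H g)
  copies-unique g = Unique.filter⁺ _ allSubgraphs-unique

  image∈Kn : ∀ f → Inj f → image f ∈ˡ Kn-copies
  image∈Kn f inj = ∈-copies⁺ _ (image-isSubgraph f) (f , image-isIso f inj)

  module _ {W : Subset n} {F : Graph n} {f₀ : Vec (Fin n) v}
           (inj₀ : Inj f₀) (onto₀ : ∀ x → x ∈ W ⇔ InImage f₀ x)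
           (adj₀ : ∀ i j → Adj H i j ⇔ Adj F (lookup f₀ i) (lookup f₀ j)) where

    private
      φ : Vec (Fin v) v → Vec (Fin n) v
      φ σ = Vec.map (lookup f₀) σ

      φ-lookup : ∀ σ i → lookup (φ σ) i ≡ lookup f₀ (lookup σ i)
      φ-lookup σ i = Vec.lookup-map i (lookup f₀) σ

    isIso-∘ : ∀ σ → IsIso v v H (⊤ , H) σ → IsIso v n H (W , F) (φ σ)
    isIso-∘ σ (inj , onto , adj) = inj′ , onto′ , adj′
      where
      inj′ : Inj (φ σ)
      inj′ {i} {j} eq = inj (inj₀ (trans (sym (φ-lookup σ i)) (trans eq (φ-lookup σ j))))
      onto′ : ∀ x → x ∈ W ⇔ InImage (φ σ) x
      onto′ x = mk⇔
        (λ x∈W → let k , p = Equivalence.to (onto₀ x) x∈W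
                     i , q = Equivalence.to (onto k) Subset.∈⊤
                 in i , trans (φ-lookup σ i) (trans (cong (lookup f₀) q) p))
        (λ (i , p) → Equivalence.from (onto₀ x) (lookup σ i , trans (sym (φ-lookup σ i)) p))
      adj′ : ∀ i j → Adj H i j ⇔ Adj F (lookup (φ σ) i) (lookup (φ σ) j)
      adj′ i j = mk⇔
        (λ ij → subst (λ (x , y) → Adj F x y) (sym eq) (Equivalence.to (adj₀ _ _) (Equivalence.to (adj i j) ij)))
        (λ xy → Equivalence.from (adj i j) (Equivalence.from (adj₀ _ _) (subst (λ (x , y) → Adj F x y) eq xy)))
        where
        eq : (lookup (φ σ) i , lookup (φ σ) j) ≡ (lookup f₀ (lookup σ i) , lookup f₀ (lookup σ j))
        eq = cong₂ _,_ (φ-lookup σ i) (φ-lookup σ j)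

    -- The automorphism is f₀⁻¹ ∘ f, which is defined because both maps have image `W`.
    isIso-factor : ∀ f → IsIso v n H (W , F) f → ∃[ σ ] IsIso v v H (⊤ , H) σ × f ≡ φ σ
    isIso-factor f (inj , onto , adj) =
      σ , (σ-inj , σ-onto , σ-adj) , vec-ext (λ i → sym (trans (φ-lookup σ i) (f₀σ i)))
      where
      preimage : ∀ i → InImage f₀ (lookup f i)
      preimage i = Equivalence.to (onto₀ _) (Equivalence.from (onto _) (i , refl))
      σ : Vec (Fin v) v
      σ = Vec.tabulate (proj₁ ∘ preimage)
      f₀σ : ∀ i → lookup f₀ (lookup σ i) ≡ lookup f i
      f₀σ i = trans (cong (lookup f₀) (Vec.lookup∘tabulate (proj₁ ∘ preimage) i)) (proj₂ (preimage i))
      σ-inj : Inj σ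
      σ-inj {i} {j} eq = inj (trans (sym (f₀σ i)) (trans (cong (lookup f₀) eq) (f₀σ j)))
      σ-adj : ∀ i j → Adj H i j ⇔ Adj H (lookup σ i) (lookup σ j)
      σ-adj i j = mk⇔
        (λ ij → Equivalence.from (adj₀ _ _) (subst (λ (x , y) → Adj F x y) (sym eq) (Equivalence.to (adj i j) ij)))
        (λ xy → Equivalence.from (adj i j) (subst (λ (x , y) → Adj F x y) eq (Equivalence.to (adj₀ _ _) xy)))
        where
        eq : (lookup f₀ (lookup σ i) , lookup f₀ (lookup σ j)) ≡ (lookup f i , lookup f j)
        eq = cong₂ _,_ (f₀σ i) (f₀σ j)
      σ-onto : ∀ k → k ∈ ⊤ ⇔ InImage σ k
      σ-onto k = mk⇔
        (λ _ → let i , p = Equivalence.to (onto (lookup f₀ k)) (Equivalence.from (onto₀ _) (k , refl))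
               in i , inj₀ (trans (f₀σ i) p))
        (λ _ → Subset.∈⊤)

    -- Once one isomorphism `f₀` onto the copy is fixed, composition with it is a bijection from the
    -- automorphisms of `H` to all isomorphisms onto that copy.
    length-isos : ∑[ f ← embeddings v n ] ⟦ isIso? v n H (W , F) f ⟧ ≡ symmetries v H
    length-isos = begin
      ∑[ f ← embeddings v n ] ⟦ iso? f ⟧  ≡⟨ length-filter≡∑ iso? (embeddings v n) ⟨
      length isos                         ≡⟨ length≡∑ isos ⟩
      ∑[ f ← isos ] 1                     ≡⟨ ∑-bijection (Unique.filter⁺ aut? (maps-unique v v))
                                               (Unique.filter⁺ iso? (embeddings-unique v n))
                                               φ into (λ _ _ → φ-inj) onto (λ _ → 1) ⟩
      ∑[ σ ← filter aut? (maps v v) ] 1   ≡⟨ length≡∑ (filter aut? (maps v v)) ⟨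
      symmetries v H                      ∎
      where
      open ≡-Reasoning
      iso? : Decidable (IsIso v n H (W , F))
      iso? = isIso? v n H (W , F)
      aut? : Decidable (IsIso v v H (⊤ , H))
      aut? = isIso? v v H (⊤ , H)
      isos : List (Vec (Fin n) v)
      isos = filter iso? (embeddings v n)
      into : ∀ {σ} → σ ∈ˡ filter aut? (maps v v) → φ σ ∈ˡ isos
      into {σ} σ∈ = ∈-filter⁺ iso? (∈-embeddings⁺ (proj₁ iso)) iso
        where
        iso : IsIso v n H (W , F) (φ σ)
        iso = isIso-∘ σ (proj₂ (∈-filter⁻ aut? {xs = maps v v} σ∈))
      φ-inj : ∀ {σ τ} → φ σ ≡ φ τ → σ ≡ τ
      φ-inj {σ} {τ} eq = vec-ext λ i →
        inj₀ (trans (sym (φ-lookup σ i)) (trans (cong (λ w → lookup w i) eq) (φ-lookup τ i)))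
      onto : ∀ {f} → f ∈ˡ isos → ∃[ σ ] σ ∈ˡ filter aut? (maps v v) × f ≡ φ σ
      onto {f} f∈ = let σ , aut , eq = isIso-factor f (proj₂ (∈-filter⁻ iso? {xs = embeddings v n} f∈))
                    in σ , ∈-filter⁺ aut? (∈-allVecs ∈-allFin σ) aut , eq

  -- Double counting of the pairs (f, S) with `f` an isomorphism onto `S`: each `f` has one `S`,
  -- each `S` has |S_H| many `f`. Counting problems for copies thereby become counting problems for
  -- injections; `G` = 1 yields the formula for c_n.
  ∑-embeddings : ∀ (G : Subgraph n → ℕ) →
                 ∑[ f ← embeddings v n ] G (image f) ≡ symmetries v H * ∑ Kn-copies G
  ∑-embeddings G = begin
    ∑[ f ← embeddings v n ] G (image f)
      ≡⟨ ∑-cong-∈ (embeddings v n) (λ {f} f∈ → sym (restrict f (∈-embeddings⁻ f∈))) ⟩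
    ∑[ f ← embeddings v n ] ∑[ S ← Kn-copies ] (⟦ isIso? v n H S f ⟧ * G S)
      ≡⟨ ∑-swap (embeddings v n) Kn-copies _ ⟩
    ∑[ S ← Kn-copies ] ∑[ f ← embeddings v n ] (⟦ isIso? v n H S f ⟧ * G S)
      ≡⟨ ∑-cong-∈ Kn-copies (λ {S} S∈ → trans (∑-*ʳ (embeddings v n) (G S) _) (cong (_* G S) (count S∈))) ⟩
    ∑[ S ← Kn-copies ] (symmetries v H * G S)
      ≡⟨ ∑-*ˡ Kn-copies (symmetries v H) G ⟩
    symmetries v H * ∑ Kn-copies G ∎
    where
    open ≡-Reasoning
    count : ∀ {S} → S ∈ˡ Kn-copies → ∑[ f ← embeddings v n ] ⟦ isIso? v n H S f ⟧ ≡ symmetries v H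
    count S∈ = let _ , f , inj , onto , adj = ∈-copies⁻ (complete n) S∈ in length-isos {f₀ = f} inj onto adj
    restrict : ∀ f → Inj f → ∑[ S ← Kn-copies ] (⟦ isIso? v n H S f ⟧ * G S) ≡ G (image f)
    restrict f inj = trans
      -- `∑-single` asks for uniqueness among all `S`, not only those listed, so the subgraph
      -- condition is moved into the predicate.
      (∑-cong-∈ Kn-copies (λ {S} S∈ → cong (_* G S) (⟦⟧-cong (isIso? v n H S f)
        (isIso? v n H S f ×-dec isSubgraph? n S (complete n))
        (λ iso → iso , proj₁ (∈-copies⁻ (complete n) S∈)) proj₁)))
      (∑-single (copies-unique (complete n)) (λ S → isIso? v n H S f ×-dec isSubgraph? n S (complete n))
        (image∈Kn f inj) (image-isIso f inj , image-isSubgraph f)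
        (λ {S} (iso , sub) → isIso⇒≡image S f sub iso) G)

  Kn-copies-count : symmetries v H * length Kn-copies ≡ n P v
  Kn-copies-count = begin
    symmetries v H * length Kn-copies   ≡⟨ cong (symmetries v H *_) (length≡∑ Kn-copies) ⟩
    symmetries v H * (∑[ S ← Kn-copies ] 1)  ≡⟨ ∑-embeddings (λ _ → 1) ⟨
    ∑[ f ← embeddings v n ] 1           ≡⟨ length≡∑ (embeddings v n) ⟨
    length (embeddings v n)             ≡⟨ length-embeddings v n ⟩
    n P v                               ∎
    where
    open ≡-Reasoning

  -- Twice each edge count is a sum over ordered pairs of vertices. The one for the image vanishes
  -- off the image of `f`, and `f` carries the rest to the pairs of vertices of `H`.
  ∣imageEdges∣ : ∀ f → Inj f → ∣ imageEdges f ∣ ≡ ∣ H ∣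
  ∣imageEdges∣ f inj = ℕ.*-cancelˡ-≡ _ _ 2 (begin
    2 * ∣ imageEdges f ∣
      ≡⟨ handshake n (imageEdges f) ⟨
    ∑[ x < n ] ∑[ y < n ] ⟦ Adj? (imageEdges f) x y ⟧
      ≡⟨ ∑-image f inj _ (λ x x∉ → ∑-⟦⟧-none (allFin n) (Adj? (imageEdges f) x)
           (λ y xy → let i , _ , _ , p , _ = Adj-image⁻ f xy in x∉ (i , p))) ⟩
    ∑[ i < v ] ∑[ y < n ] ⟦ Adj? (imageEdges f) (lookup f i) y ⟧
      ≡⟨ ∑-cong (allFin v) (λ i → ∑-image f inj _ (λ y y∉ → ⟦⟧-no (Adj? (imageEdges f) (lookup f i) y)
           (λ xy → let _ , j , _ , _ , q = Adj-image⁻ f xy in y∉ (j , q)))) ⟩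
    ∑[ i < v ] ∑[ j < v ] ⟦ Adj? (imageEdges f) (lookup f i) (lookup f j) ⟧
      ≡⟨ ∑-cong (allFin v) (λ i → ∑-cong (allFin v) (λ j → ⟦⟧-cong (Adj? (imageEdges f) _ _) (Adj? H i j)
           (Equivalence.from (proj₂ (proj₂ (image-isIso f inj)) i j))
           (Equivalence.to (proj₂ (proj₂ (image-isIso f inj)) i j)))) ⟩
    ∑[ i < v ] ∑[ j < v ] ⟦ Adj? H i j ⟧
      ≡⟨ handshake v H ⟩
    2 * ∣ H ∣ ∎)
    where open ≡-Reasoning

  ∣edges∣ : ∀ {S} → S ∈ˡ Kn-copies → ∣ edges n S ∣ ≡ ∣ H ∣
  ∣edges∣ {S} S∈ with ∈-copies⁻ (complete n) S∈
  ... | sub , f , iso = trans (cong (∣_∣ ∘ edges n) (isIso⇒≡image S f sub iso)) (∣imageEdges∣ f (proj₁ iso))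

symmetries>0 : ∀ v H → 0 < symmetries v H
symmetries>0 v H = ∈-length (∈-filter⁺ (isIso? v v H (⊤ , H)) (∈-allVecs ∈-allFin identity)
  ((λ {i} {j} eq → trans (sym (at i)) (trans eq (at j))) ,
   (λ x → mk⇔ (λ _ → x , at x) (λ _ → Subset.∈⊤)) ,
   (λ i j → mk⇔ (subst (λ (x , y) → Adj H x y) (cong₂ _,_ (sym (at i)) (sym (at j))))
                (subst (λ (x , y) → Adj H x y) (cong₂ _,_ (at i) (at j))))))
  where
  identity : Vec (Fin v) v
  identity = Vec.tabulate id
  at : ∀ i → lookup identity i ≡ i
  at = Vec.lookup∘tabulate id

-- Shared edges of two copies

transpose-matchˡ : ∀ {n} (i j : Fin n) → transpose i j ⟨$⟩ʳ i ≡ j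
transpose-matchˡ i j rewrite dec-true (i Fin.≟ i) refl = refl

transpose-mismatch : ∀ {n} (i j : Fin n) {k} → k ≢ i → k ≢ j → transpose i j ⟨$⟩ʳ k ≡ k
transpose-mismatch i j {k} k≢i k≢j
  rewrite dec-false (k Fin.≟ i) k≢i | dec-false (k Fin.≟ j) k≢j = refl

⟨$⟩ʳ-injective : ∀ {n} (π : Permutation′ n) {x y} → π ⟨$⟩ʳ x ≡ π ⟨$⟩ʳ y → x ≡ y
⟨$⟩ʳ-injective π eq = trans (sym (inverseˡ π)) (trans (cong (π ⟨$⟩ˡ_) eq) (inverseˡ π))

-- One transposition takes `x` to `x′`. A second takes the new position of `y` to `y′`; it fixes
-- `x′`, which differs from both points that it exchanges.
2-transitive : ∀ {n} {x y x′ y′ : Fin n} → x ≢ y → x′ ≢ y′ →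
               ∃[ π ] (π ⟨$⟩ʳ x ≡ x′ × π ⟨$⟩ʳ y ≡ y′)
2-transitive {x = x} {y} {x′} {y′} x≢y x′≢y′ =
  τ ∘ₚ transpose y₁ y′ ,
  trans (cong (transpose y₁ y′ ⟨$⟩ʳ_) τx) (transpose-mismatch y₁ y′ x′≢y₁ x′≢y′) ,
  transpose-matchˡ y₁ y′
  where
  τ : Permutation′ _
  τ = transpose x x′
  y₁ : Fin _
  y₁ = τ ⟨$⟩ʳ y
  τx : τ ⟨$⟩ʳ x ≡ x′
  τx = transpose-matchˡ x x′
  x′≢y₁ : x′ ≢ y₁
  x′≢y₁ eq = x≢y (⟨$⟩ʳ-injective τ (trans τx eq))


module SharedEdges (v : ℕ) (H : Graph v) (n : ℕ) where

  open Copies v H n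

  embeddingsThrough : Fin n → Fin n → ℕ
  embeddingsThrough x y = ∑[ f ← embeddings v n ] ⟦ imageEdge? f x y ⟧

  -- Composition with `π` permutes the embeddings and carries those through (x, y) to those through
  -- the image pair.
  embeddingsThrough-permute : ∀ (π : Permutation′ n) x y →
    embeddingsThrough (π ⟨$⟩ʳ x) (π ⟨$⟩ʳ y) ≡ embeddingsThrough x y
  embeddingsThrough-permute π x y = trans
    (∑-bijection (embeddings-unique v n) (embeddings-unique v n) φ into (λ _ _ → φ-inj) onto _)
    (∑-cong (embeddings v n) (λ f → ⟦⟧-cong (imageEdge? (φ f) _ _) (imageEdge? f x y) (from f) (to f)))
    where
    φ : Vec (Fin n) v → Vec (Fin n) v
    φ = Vec.map (π ⟨$⟩ʳ_)
    at : ∀ f i → lookup (φ f) i ≡ π ⟨$⟩ʳ (lookup f i)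
    at f i = Vec.lookup-map i (π ⟨$⟩ʳ_) f
    into : ∀ {f} → f ∈ˡ embeddings v n → φ f ∈ˡ embeddings v n
    into {f} f∈ = ∈-embeddings⁺ λ {i} {j} eq →
      ∈-embeddings⁻ f∈ (⟨$⟩ʳ-injective π (trans (sym (at f i)) (trans eq (at f j))))
    φ-inj : ∀ {f g} → φ f ≡ φ g → f ≡ g
    φ-inj {f} {g} eq = vec-ext λ i →
      ⟨$⟩ʳ-injective π (trans (sym (at f i)) (trans (cong (λ w → lookup w i) eq) (at g i)))
    onto : ∀ {g} → g ∈ˡ embeddings v n → ∃[ f ] f ∈ˡ embeddings v n × g ≡ φ f
    onto {g} g∈ = f , ∈-embeddings⁺ f-inj , vec-ext (λ i → sym (trans (at f i) (πf i)))
      where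
      f : Vec (Fin n) v
      f = Vec.map (π ⟨$⟩ˡ_) g
      πf : ∀ i → π ⟨$⟩ʳ (lookup f i) ≡ lookup g i
      πf i = trans (cong (π ⟨$⟩ʳ_) (Vec.lookup-map i (π ⟨$⟩ˡ_) g)) (inverseʳ π)
      f-inj : Inj f
      f-inj {i} {j} eq = ∈-embeddings⁻ g∈ (trans (sym (πf i)) (trans (cong (π ⟨$⟩ʳ_) eq) (πf j)))
    from : ∀ f → ImageEdge (φ f) (π ⟨$⟩ʳ x) (π ⟨$⟩ʳ y) → ImageEdge f x y
    from f (i , j , ij , p , q) = i , j , ij ,
      ⟨$⟩ʳ-injective π (trans (sym (at f i)) p) , ⟨$⟩ʳ-injective π (trans (sym (at f j)) q)
    to : ∀ f → ImageEdge f x y → ImageEdge (φ f) (π ⟨$⟩ʳ x) (π ⟨$⟩ʳ y)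
    to f (i , j , ij , p , q) = i , j , ij ,
      trans (at f i) (cong (π ⟨$⟩ʳ_) p) , trans (at f j) (cong (π ⟨$⟩ʳ_) q)

  copiesThrough : Fin (length (pairs n)) → ℕ
  copiesThrough e = ∑[ S ← Kn-copies ] ⟦ e ∈? edges n S ⟧

  symmetries*copiesThrough : ∀ e → symmetries v H * copiesThrough e ≡
    embeddingsThrough (proj₁ (edge n e)) (proj₂ (edge n e))
  symmetries*copiesThrough e = trans
    (sym (∑-embeddings (λ S → ⟦ e ∈? edges n S ⟧)))
    (∑-cong (embeddings v n) (λ f → ⟦⟧-cong (e ∈? imageEdges f) (inImageEdges? f e)
      (∈-comprehension⁻ (inImageEdges? f)) (∈-comprehension⁺ (inImageEdges? f))))

  -- Some permutation of the vertices takes one edge to the other. It acts on embeddings by mere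
  -- composition, so the argument is made there and the factor |S_H| cancelled.
  copiesThrough-constant : ∀ e e′ → copiesThrough e ≡ copiesThrough e′
  copiesThrough-constant e e′ = ℕ.*-cancelˡ-≡ _ _ (symmetries v H) {{ℕ.>-nonZero (symmetries>0 v H)}}
    (begin
      symmetries v H * copiesThrough e
        ≡⟨ symmetries*copiesThrough e ⟩
      embeddingsThrough (proj₁ (edge n e)) (proj₂ (edge n e))
        ≡⟨ embeddingsThrough-permute π _ _ ⟨
      embeddingsThrough (π ⟨$⟩ʳ proj₁ (edge n e)) (π ⟨$⟩ʳ proj₂ (edge n e))
        ≡⟨ cong₂ embeddingsThrough πx πy ⟩
      embeddingsThrough (proj₁ (edge n e′)) (proj₂ (edge n e′))
        ≡⟨ symmetries*copiesThrough e′ ⟨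
      symmetries v H * copiesThrough e′ ∎)
    where
    open ≡-Reasoning
    distinct : ∀ e → proj₁ (edge n e) ≢ proj₂ (edge n e)
    distinct e eq = Fin.<-irrefl eq (edge-ordered n e refl)
    moving = 2-transitive (distinct e) (distinct e′)
    π = proj₁ moving
    πx = proj₁ (proj₂ moving)
    πy = proj₂ (proj₂ moving)

  -- Both sides count the triples (S, S′, e) with `e` an edge of both copies.
  ∑-∩ : ∑[ S ← Kn-copies ] ∑[ S′ ← Kn-copies ] ∣ edges n S ∩ edges n S′ ∣ ≡
        ∑[ e < length (pairs n) ] (copiesThrough e * copiesThrough e)
  ∑-∩ = begin
    ∑[ S ← Kn-copies ] ∑[ S′ ← Kn-copies ] ∣ edges n S ∩ edges n S′ ∣
      ≡⟨ ∑-cong Kn-copies (λ S → ∑-cong Kn-copies (λ S′ → ∣∩∣ (edges n S) (edges n S′))) ⟩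
    ∑[ S ← Kn-copies ] ∑[ S′ ← Kn-copies ] ∑[ e < length (pairs n) ] (⟦ e ∈? edges n S ⟧ * ⟦ e ∈? edges n S′ ⟧)
      ≡⟨ ∑-cong Kn-copies (λ S → ∑-swap Kn-copies (allFin (length (pairs n))) _) ⟩
    ∑[ S ← Kn-copies ] ∑[ e < length (pairs n) ] ∑[ S′ ← Kn-copies ] (⟦ e ∈? edges n S ⟧ * ⟦ e ∈? edges n S′ ⟧)
      ≡⟨ ∑-swap Kn-copies (allFin (length (pairs n))) _ ⟩
    ∑[ e < length (pairs n) ] ∑[ S ← Kn-copies ] ∑[ S′ ← Kn-copies ] (⟦ e ∈? edges n S ⟧ * ⟦ e ∈? edges n S′ ⟧)
      ≡⟨ ∑-cong (allFin (length (pairs n))) (λ e → ∑-*-∑ Kn-copies Kn-copies _ _) ⟨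
    ∑[ e < length (pairs n) ] (copiesThrough e * copiesThrough e) ∎
    where
    open ≡-Reasoning
    ∣∩∣ : ∀ F G → ∣ F ∩ G ∣ ≡ ∑[ e < length (pairs n) ] (⟦ e ∈? F ⟧ * ⟦ e ∈? G ⟧)
    ∣∩∣ F G = trans (∣p∣≡∑ (F ∩ G)) (∑-cong (allFin (length (pairs n))) (λ e → trans
      (⟦⟧-cong (e ∈? F ∩ G) ((e ∈? F) ×-dec (e ∈? G)) (Subset.x∈p∩q⁻ F G) Subset.x∈p∩q⁺)
      (⟦⟧-× (e ∈? F) (e ∈? G))))

  ∑-copiesThrough : ∑[ e < length (pairs n) ] copiesThrough e ≡ ∣ H ∣ * length Kn-copies
  ∑-copiesThrough = begin
    ∑[ e < length (pairs n) ] copiesThrough e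
      ≡⟨ ∑-swap (allFin (length (pairs n))) Kn-copies _ ⟩
    ∑[ S ← Kn-copies ] ∑[ e < length (pairs n) ] ⟦ e ∈? edges n S ⟧
      ≡⟨ ∑-cong-∈ Kn-copies (λ {S} S∈ → trans (sym (∣p∣≡∑ (edges n S))) (∣edges∣ S∈)) ⟩
    ∑[ S ← Kn-copies ] ∣ H ∣
      ≡⟨ trans (∑-const Kn-copies ∣ H ∣) (ℕ.*-comm _ ∣ H ∣) ⟩
    ∣ H ∣ * length Kn-copies ∎
    where open ≡-Reasoning

  -- Each edge of K_n lies in the same number of copies, so Cauchy-Schwarz is an equality here.
  mean-shared-edges :
    (n C 2) * ∑[ S ← Kn-copies ] ∑[ S′ ← Kn-copies ] ∣ edges n S ∩ edges n S′ ∣ ≡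
    (∣ H ∣ * length Kn-copies) * (∣ H ∣ * length Kn-copies)
  mean-shared-edges = begin
    (n C 2) * ∑[ S ← Kn-copies ] ∑[ S′ ← Kn-copies ] ∣ edges n S ∩ edges n S′ ∣
      ≡⟨ cong₂ _*_ (sym (length-pairs n)) ∑-∩ ⟩
    M * ∑[ e < M ] (copiesThrough e * copiesThrough e)
      ≡⟨ ∑Fin-const M _ ⟨
    ∑[ e′ < M ] ∑[ e < M ] (copiesThrough e * copiesThrough e)
      ≡⟨ ∑-cong (allFin M) (λ e′ → ∑-cong (allFin M) (λ e →
           cong (_* copiesThrough e) (copiesThrough-constant e e′))) ⟩
    ∑[ e′ < M ] ∑[ e < M ] (copiesThrough e′ * copiesThrough e)
      ≡⟨ ∑-*-∑ (allFin M) (allFin M) _ _ ⟨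
    (∑[ e < M ] copiesThrough e) * ∑[ e < M ] copiesThrough e
      ≡⟨ cong₂ _*_ ∑-copiesThrough ∑-copiesThrough ⟩
    (∣ H ∣ * length Kn-copies) * (∣ H ∣ * length Kn-copies) ∎
    where
    open ≡-Reasoning
    M : ℕ
    M = length (pairs n)

  -- The number of common vertices of the two images, when `g` is injective. As a sum over the
  -- coordinates of `g` it makes `n ^ common f g` a product of one factor per coordinate.
  common : (f g : Vec (Fin n) v) → ℕ
  common f g = ∑[ j < v ] ⟦ inImage? f (lookup g j) ⟧

  module _ (f g : Vec (Fin n) v) (f-inj : Inj f) (g-inj : Inj g) where

    private
      I : Graph n
      I = imageEdges f ∩ imageEdges g
      a : Fin n → ℕ
      a x = ⟦ inImage? f x ⟧ * ⟦ inImage? g x ⟧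

      a≡1 : ∀ {x} → InImage f x → InImage g x → a x ≡ 1
      a≡1 {x} p q = cong₂ _*_ (⟦⟧-yes (inImage? f x) p) (⟦⟧-yes (inImage? g x) q)

      a-ends : ∀ {x y} → Adj I x y → a x ≡ 1 × a y ≡ 1
      a-ends {x} {y} xy =
        let i , j , _ , p , q = Adj-image⁻ f (proj₁ (Adj-∩⁻ n (imageEdges f) (imageEdges g) xy))
            i′ , j′ , _ , p′ , q′ = Adj-image⁻ g (proj₂ (Adj-∩⁻ n (imageEdges f) (imageEdges g) xy))
        in a≡1 (i , p) (i′ , p′) , a≡1 (j , q) (j′ , q′)

      a-idem : ∀ x → a x * a x ≡ a x
      a-idem x = trans
        (sym (cong₂ _*_ (⟦⟧-× (inImage? f x) (inImage? g x)) (⟦⟧-× (inImage? f x) (inImage? g x))))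
        (trans (⟦⟧-idem (inImage? f x ×-dec inImage? g x)) (⟦⟧-× (inImage? f x) (inImage? g x)))

      ∑a : ∑[ x < n ] a x ≡ common f g
      ∑a = trans
        (∑-image g g-inj a (λ x x∉ → trans (cong (⟦ inImage? f x ⟧ *_) (⟦⟧-no (inImage? g x) x∉))
                                            (ℕ.*-zeroʳ ⟦ inImage? f x ⟧)))
        (∑-cong (allFin v) (λ j → trans
          (cong (⟦ inImage? f (lookup g j) ⟧ *_) (⟦⟧-yes (inImage? g (lookup g j)) (j , refl)))
          (ℕ.*-identityʳ _)))

      -- `left` is the adjacency matrix of the common graph `I` with the common vertices marked on
      -- the diagonal, `right` the all-ones matrix on the common vertices. The entrywise comparison
      -- says that s common vertices carry at most s(s - 1)/2 common edges, in a form free of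
      -- subtraction and division.
      left right : Fin n → Fin n → ℕ
      left x y = ⟦ Adj? I x y ⟧ + ⟦ x Fin.≟ y ⟧ * a x
      right x y = a x * a y

      left≤right : ∀ x y → left x y ≤ right x y
      left≤right x y with x Fin.≟ y
      ... | yes refl = ℕ.≤-reflexive (trans
              (cong₂ _+_ (⟦⟧-no (Adj? I x x) (Adj-irrefl n I)) (ℕ.+-identityʳ (a x))) (sym (a-idem x)))
      ... | no _ with Adj? I x y
      ...   | yes xy = ℕ.≤-reflexive (sym (cong₂ _*_ (proj₁ (a-ends xy)) (proj₂ (a-ends xy))))
      ...   | no _   = z≤n

      ∑left : ∑[ x < n ] ∑[ y < n ] left x y ≡ 2 * ∣ I ∣ + common f g
      ∑left = trans (∑-cong (allFin n) (λ x → trans (∑-+ (allFin n) _ _)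
          (cong (∑[ y < n ] ⟦ Adj? I x y ⟧ +_) (∑Fin-single (x Fin.≟_) x refl sym (λ _ → a x)))))
        (trans (∑-+ (allFin n) _ a) (cong₂ _+_ (handshake n I) ∑a))

      ∑right : ∑[ x < n ] ∑[ y < n ] right x y ≡ common f g * common f g
      ∑right = trans (sym (∑-*-∑ (allFin n) (allFin n) a a)) (cong₂ _*_ ∑a ∑a)

    shared-edges≤ : 2 * ∣ imageEdges f ∩ imageEdges g ∣ + common f g ≤ common f g * common f g
    shared-edges≤ = begin
      2 * ∣ I ∣ + common f g                ≡⟨ ∑left ⟨
      ∑[ x < n ] ∑[ y < n ] left x y        ≤⟨ ∑-mono (allFin n) (λ x → ∑-mono (allFin n) (left≤right x)) ⟩
      ∑[ x < n ] ∑[ y < n ] right x y       ≡⟨ ∑right ⟩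
      common f g * common f g               ∎
      where open ℕ.≤-Reasoning

    -- Equal totals force equal entries, so any two common vertices are joined in both copies; `g`
    -- pulls this back to `H`.
    shared-edges-tight : 2 * ∣ imageEdges f ∩ imageEdges g ∣ + common f g ≡ common f g * common f g →
      ∀ {i j} → InImage f (lookup g i) → InImage f (lookup g j) → i ≢ j → Adj H i j
    shared-edges-tight tight {i} {j} p q i≢j =
      Equivalence.from (proj₂ (proj₂ (image-isIso g g-inj)) i j)
        (proj₂ (Adj-∩⁻ n (imageEdges f) (imageEdges g) (⟦⟧≡1⁻ (Adj? I _ _) adjacent)))
      where
      x y : Fin n
      x = lookup g i
      y = lookup g j
      rows : ∑[ y < n ] left x y ≡ ∑[ y < n ] right x y
      rows = ∑-tight (allFin n) (λ x → ∑-mono (allFin n) (left≤right x))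
        (ℕ.≤-reflexive (trans ∑right (trans (sym tight) (sym ∑left)))) (∈-allFin x)
      entry : left x y ≡ right x y
      entry = ∑-tight (allFin n) (left≤right x) (ℕ.≤-reflexive (sym rows)) (∈-allFin y)
      adjacent : ⟦ Adj? I x y ⟧ ≡ 1
      adjacent = begin
        ⟦ Adj? I x y ⟧                           ≡⟨ ℕ.+-identityʳ _ ⟨
        ⟦ Adj? I x y ⟧ + 0                       ≡⟨ cong (λ t → ⟦ Adj? I x y ⟧ + t * a x) (⟦⟧-no (x Fin.≟ y) (i≢j ∘ g-inj)) ⟨
        left x y                                 ≡⟨ entry ⟩
        a x * a y                                ≡⟨ cong₂ _*_ (a≡1 p (i , refl)) (a≡1 q (j , refl)) ⟩
        1                                        ∎
        where open ≡-Reasoning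

    -- Here and in the next two lemmas 2k ≤ s(s - 1) is evaluated for small s: two vertices carry
    -- one edge, three vertices three edges.
    common≥2 : 1 ≤ ∣ imageEdges f ∩ imageEdges g ∣ → 2 ≤ common f g
    common≥2 = lemma _ _ shared-edges≤
      where
      lemma : ∀ k s → 2 * k + s ≤ s * s → 1 ≤ k → 2 ≤ s
      lemma (suc k) 0 ()
      lemma (suc k) 1 le _ with ℕ.≤-trans (ℕ.+-monoˡ-≤ 1 (ℕ.*-monoʳ-≤ 2 (s≤s (z≤n {k})))) le
      ... | s≤s ()
      lemma k (suc (suc s)) _ _ = s≤s (s≤s z≤n)

    common≥3 : 2 ≤ ∣ imageEdges f ∩ imageEdges g ∣ → 3 ≤ common f g
    common≥3 = lemma _ _ shared-edges≤
      where
      lemma : ∀ k s → 2 * k + s ≤ s * s → 2 ≤ k → 3 ≤ s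
      lemma k s le 2≤k with ℕ.≤-trans (ℕ.+-monoˡ-≤ s (ℕ.*-monoʳ-≤ 2 2≤k)) le
      lemma k 0 le 2≤k | ()
      lemma k 1 le 2≤k | s≤s ()
      lemma k 2 le 2≤k | s≤s (s≤s (s≤s (s≤s ())))
      lemma k (suc (suc (suc s))) le 2≤k | _ = s≤s (s≤s (s≤s z≤n))

    common≥4 : 4 ≤ ∣ imageEdges f ∩ imageEdges g ∣ → 4 ≤ common f g
    common≥4 = lemma _ _ shared-edges≤
      where
      lemma : ∀ k s → 2 * k + s ≤ s * s → 4 ≤ k → 4 ≤ s
      lemma k s le 4≤k with ℕ.≤-trans (ℕ.+-monoˡ-≤ s (ℕ.*-monoʳ-≤ 2 4≤k)) le
      lemma k 0 le 4≤k | ()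
      lemma k 1 le 4≤k | s≤s ()
      lemma k 2 le 4≤k | s≤s (s≤s (s≤s (s≤s ())))
      lemma k 3 le 4≤k | s≤s (s≤s (s≤s (s≤s (s≤s (s≤s (s≤s (s≤s (s≤s ()))))))))
      lemma k (suc (suc (suc (suc s)))) le 4≤k | _ = s≤s (s≤s (s≤s (s≤s z≤n)))

    -- Three common edges on only three common vertices would be the equality case, and those
    -- vertices, pulled back along `g`, would form a triangle in `H`.
    triangleFree⇒common≥4 : TriangleFree v H → 3 ≤ ∣ imageEdges f ∩ imageEdges g ∣ → 4 ≤ common f g
    triangleFree⇒common≥4 H-free 3≤k with common f g ℕ.≟ 3
    ... | no ≢3 = ℕ.≤∧≢⇒< (common≥3 (ℕ.≤-trans (s≤s (s≤s z≤n)) 3≤k)) (≢3 ∘ sym)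
    ... | yes ≡3 = ⊥-elim (triangle (filter hit? (allFin v)) refl hits≡3 (Unique.filter⁺ hit? (Unique.allFin⁺ v)))
      where
      hit? : Decidable (λ j → InImage f (lookup g j))
      hit? j = inImage? f (lookup g j)
      tight : 2 * ∣ imageEdges f ∩ imageEdges g ∣ + common f g ≡ common f g * common f g
      tight = ℕ.≤-antisym shared-edges≤ (begin
        common f g * common f g        ≡⟨ cong₂ _*_ ≡3 ≡3 ⟩
        2 * 3 + 3                      ≡⟨ cong (2 * 3 +_) ≡3 ⟨
        2 * 3 + common f g             ≤⟨ ℕ.+-monoˡ-≤ (common f g) (ℕ.*-monoʳ-≤ 2 3≤k) ⟩
        2 * ∣ I ∣ + common f g         ∎)
        where open ℕ.≤-Reasoning
      hits≡3 : length (filter hit? (allFin v)) ≡ 3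
      hits≡3 = trans (length-filter≡∑ hit? (allFin v)) ≡3
      triangle : ∀ js → filter hit? (allFin v) ≡ js → length js ≡ 3 → Unique js → ⊥
      triangle (i ∷ j ∷ k ∷ []) eq _ ((i≢j ∷ i≢k ∷ []) ∷ (j≢k ∷ []) ∷ _) =
        H-free i j k (adj (here refl) (there (here refl)) i≢j ,
                      adj (there (here refl)) (there (there (here refl))) j≢k ,
                      adj (here refl) (there (there (here refl))) i≢k)
        where
        hit : ∀ {j′} → j′ ∈ˡ i ∷ j ∷ k ∷ [] → InImage f (lookup g j′)
        hit {j′} j∈ = proj₂ (∈-filter⁻ hit? {xs = allFin v} (subst (j′ ∈ˡ_) (sym eq) j∈))
        adj : ∀ {x y} → x ∈ˡ i ∷ j ∷ k ∷ [] → y ∈ˡ i ∷ j ∷ k ∷ [] → x ≢ y → Adj H x y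
        adj x∈ y∈ = shared-edges-tight tight (hit x∈) (hit y∈)

-- Upper bounds for the numbers C_k

∑-maps-^ : ∀ n v (a : Fin n → ℕ) →
  ∑[ g ← maps v n ] (n ^ ∑[ j < v ] a (lookup g j)) ≡ (∑[ x < n ] (n ^ a x)) ^ v
∑-maps-^ n zero    a = refl
∑-maps-^ n (suc v) a = begin
  ∑[ g ← maps (suc v) n ] (n ^ ∑[ j < suc v ] a (lookup g j))
    ≡⟨ ∑-prodWith Vec._∷_ (allFin n) (maps v n) _ ⟩
  ∑[ x < n ] ∑[ g ← maps v n ] (n ^ ∑[ j < suc v ] a (lookup (x Vec.∷ g) j))
    ≡⟨ ∑-cong (allFin n) (λ x → ∑-cong (maps v n) (λ g → trans
         (cong (n ^_) (∑Fin-suc v (a ∘ lookup (x Vec.∷ g))))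
         (ℕ.^-distribˡ-+-* n (a x) _))) ⟩
  ∑[ x < n ] ∑[ g ← maps v n ] (n ^ a x * n ^ ∑[ j < v ] a (lookup g j))
    ≡⟨ ∑-*-∑ (allFin n) (maps v n) _ _ ⟨
  (∑[ x < n ] (n ^ a x)) * ∑[ g ← maps v n ] (n ^ ∑[ j < v ] a (lookup g j))
    ≡⟨ cong ((∑[ x < n ] (n ^ a x)) *_) (∑-maps-^ n v a) ⟩
  (∑[ x < n ] (n ^ a x)) ^ suc v ∎
  where open ≡-Reasoning

^-distribʳ-* : ∀ m n k → (m * n) ^ k ≡ m ^ k * n ^ k
^-distribʳ-* m n zero    = refl
^-distribʳ-* m n (suc k) = trans (cong (m * n *_) (^-distribʳ-* m n k))
  (solve 4 (λ a b c d → a :* b :* (c :* d) := a :* c :* (b :* d)) refl m n (m ^ k) (n ^ k))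
  where open +-*-Solver using (solve; _:=_; _:*_)

P≤^ : ∀ n k → n P k ≤ n ^ k
P≤^ n zero    = ℕ.≤-refl
P≤^ n (suc k) = ℕ.≤-trans (ℕ.≤-reflexive (P-suc n k)) (ℕ.*-mono-≤ (ℕ.m∸n≤m n k) (P≤^ n k))

module PairBounds (v : ℕ) (H : Graph v) (n : ℕ) .{{_ : ℕ.NonZero n}} where

  open Copies v H n
  open SharedEdges v H n

  Cpairs≡∑ : ∀ k → Cpairs v H k n ≡
    ∑[ S ← Kn-copies ] ∑[ S′ ← Kn-copies ] ⟦ ∣ edges n S ∩ edges n S′ ∣ ℕ.≟ k ⟧
  Cpairs≡∑ k = trans
    (length-filter≡∑ (λ (S , S′) → ∣ edges n S ∩ edges n S′ ∣ ℕ.≟ k) (cartesianProduct Kn-copies Kn-copies))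
    (∑-prod Kn-copies Kn-copies _)

  ∑-embeddings² : ∀ (G : Subgraph n → Subgraph n → ℕ) →
    ∑[ f ← embeddings v n ] ∑[ g ← embeddings v n ] G (image f) (image g) ≡
    symmetries v H * (symmetries v H * ∑[ S ← Kn-copies ] ∑[ S′ ← Kn-copies ] G S S′)
  ∑-embeddings² G = begin
    ∑[ f ← embeddings v n ] ∑[ g ← embeddings v n ] G (image f) (image g)
      ≡⟨ ∑-cong (embeddings v n) (λ f → ∑-embeddings (G (image f))) ⟩
    ∑[ f ← embeddings v n ] (symmetries v H * ∑ Kn-copies (G (image f)))
      ≡⟨ ∑-*ˡ (embeddings v n) (symmetries v H) _ ⟩
    symmetries v H * ∑[ f ← embeddings v n ] (∑ Kn-copies (G (image f)))
      ≡⟨ cong (symmetries v H *_) (∑-embeddings (λ S → ∑ Kn-copies (G S))) ⟩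
    symmetries v H * (symmetries v H * ∑[ S ← Kn-copies ] ∑[ S′ ← Kn-copies ] G S S′) ∎
    where open ≡-Reasoning

  -- Markov's inequality for n ^ common f g, whose sum over all maps g factorises.
  common-tail : ∀ f → Inj f → ∀ t →
    (∑[ g ← maps v n ] ⟦ t ℕ.≤? common f g ⟧) * n ^ t ≤ (n * suc v) ^ v
  common-tail f inj t = begin
    (∑[ g ← maps v n ] ⟦ t ℕ.≤? common f g ⟧) * n ^ t
      ≡⟨ ∑-*ʳ (maps v n) (n ^ t) _ ⟨
    ∑[ g ← maps v n ] (⟦ t ℕ.≤? common f g ⟧ * n ^ t)
      ≤⟨ ∑-mono (maps v n) (λ g → markov (t ℕ.≤? common f g)) ⟩
    ∑[ g ← maps v n ] (n ^ common f g)
      ≡⟨ ∑-maps-^ n v (λ x → ⟦ inImage? f x ⟧) ⟩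
    (∑[ x < n ] (n ^ ⟦ inImage? f x ⟧)) ^ v
      ≤⟨ ℕ.^-monoˡ-≤ v (∑-mono (allFin n) (λ x → linear (inImage? f x))) ⟩
    (∑[ x < n ] (1 + n * ⟦ inImage? f x ⟧)) ^ v
      ≡⟨ cong (_^ v) (trans (∑-+ (allFin n) (λ _ → 1) _) (cong₂ _+_ (∑Fin-const n 1)
           (trans (∑-*ˡ (allFin n) n _) (cong (n *_) (∑-inImage f inj))))) ⟩
    (n * 1 + n * v) ^ v
      ≡⟨ cong (_^ v) (sym (ℕ.*-distribˡ-+ n 1 v)) ⟩
    (n * suc v) ^ v ∎
    where
    open ℕ.≤-Reasoning
    markov : ∀ {s} (t≤s? : Dec (t ≤ s)) → ⟦ t≤s? ⟧ * n ^ t ≤ n ^ s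
    markov (yes t≤s) = ℕ.≤-trans (ℕ.≤-reflexive (ℕ.+-identityʳ (n ^ t))) (ℕ.^-monoʳ-≤ n t≤s)
    markov (no _)    = z≤n
    linear : ∀ {A : Set} (a? : Dec A) → n ^ ⟦ a? ⟧ ≤ 1 + n * ⟦ a? ⟧
    linear (yes _) = ℕ.n≤1+n (n * 1)
    linear (no _)  = s≤s z≤n

  -- This is C_k = O(n^(2v-t)) when k common edges force t common vertices: there are at most n^v
  -- choices of `f`, and for each `f` the maps `g` with t common vertices are bounded by
  -- `common-tail`. The constant (v + 1)^v arises there: the v vertices in the image of `f` have
  -- weight n and the others weight 1, in total at most n(v + 1) per coordinate.
  Cpairs≤ : ∀ k t →
    (∀ f g → Inj f → Inj g → ∣ imageEdges f ∩ imageEdges g ∣ ≡ k → t ≤ common f g) →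
    Cpairs v H k n * n ^ t ≤ suc v ^ v * n ^ (v + v)
  Cpairs≤ k t sharing = begin
    Cpairs v H k n * n ^ t
      -- The factor |S_H|² ≥ 1 is inserted to pass from pairs of copies to pairs of embeddings.
      ≤⟨ ℕ.*-monoˡ-≤ (n ^ t) (ℕ.m≤n*m (Cpairs v H k n) (s * s) {{ℕ.m*n≢0 s s}}) ⟩
    (s * s) * Cpairs v H k n * n ^ t
      ≡⟨ cong (_* n ^ t) (trans (ℕ.*-assoc s s _) (trans (cong (λ c → s * (s * c)) (Cpairs≡∑ k))
           (sym (∑-embeddings² (λ S S′ → ⟦ ∣ edges n S ∩ edges n S′ ∣ ℕ.≟ k ⟧))))) ⟩
    (∑[ f ← embeddings v n ] ∑[ g ← embeddings v n ] ⟦ ∣ imageEdges f ∩ imageEdges g ∣ ℕ.≟ k ⟧) * n ^ t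
      ≡⟨ cong (_* n ^ t) (∑-filter inj? (maps v n) _) ⟩
    (∑[ f ← maps v n ] (⟦ inj? f ⟧ * ∑[ g ← embeddings v n ] ⟦ ∣ imageEdges f ∩ imageEdges g ∣ ℕ.≟ k ⟧)) * n ^ t
      ≡⟨ ∑-*ʳ (maps v n) (n ^ t) _ ⟨
    ∑[ f ← maps v n ] (⟦ inj? f ⟧ * (∑[ g ← embeddings v n ] ⟦ ∣ imageEdges f ∩ imageEdges g ∣ ℕ.≟ k ⟧) * n ^ t)
      ≤⟨ ∑-mono (maps v n) (λ f → row f (inj? f)) ⟩
    ∑[ f ← maps v n ] (⟦ inj? f ⟧ * (n * suc v) ^ v)
      ≡⟨ trans (∑-*ʳ (maps v n) ((n * suc v) ^ v) _) (cong (_* (n * suc v) ^ v)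
           (trans (sym (length-filter≡∑ inj? (maps v n))) (length-embeddings v n))) ⟩
    (n P v) * (n * suc v) ^ v
      ≤⟨ ℕ.*-monoˡ-≤ ((n * suc v) ^ v) (P≤^ n v) ⟩
    n ^ v * (n * suc v) ^ v
      ≡⟨ cong (n ^ v *_) (^-distribʳ-* n (suc v) v) ⟩
    n ^ v * (n ^ v * suc v ^ v)
      ≡⟨ trans (sym (ℕ.*-assoc (n ^ v) (n ^ v) _)) (trans (ℕ.*-comm _ (suc v ^ v))
           (cong (suc v ^ v *_) (sym (ℕ.^-distribˡ-+-* n v v)))) ⟩
    suc v ^ v * n ^ (v + v) ∎
    where
    open ℕ.≤-Reasoning
    s : ℕ
    s = symmetries v H
    instance
      s≢0 : ℕ.NonZero s
      s≢0 = ℕ.>-nonZero (symmetries>0 v H)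
    entry : ∀ f → Inj f → ∀ g →
      ⟦ inj? g ⟧ * ⟦ ∣ imageEdges f ∩ imageEdges g ∣ ℕ.≟ k ⟧ ≤ ⟦ t ℕ.≤? common f g ⟧
    entry f f-inj g = ℕ.≤-trans
      (ℕ.≤-reflexive (sym (⟦⟧-× (inj? g) (∣ imageEdges f ∩ imageEdges g ∣ ℕ.≟ k))))
      (⟦⟧-mono (inj? g ×-dec (∣ imageEdges f ∩ imageEdges g ∣ ℕ.≟ k)) (t ℕ.≤? common f g)
        (λ (g-inj , ∣∩∣≡k) → sharing f g f-inj g-inj ∣∩∣≡k))
    row : ∀ f (i? : Dec (Inj f)) →
      ⟦ i? ⟧ * (∑[ g ← embeddings v n ] ⟦ ∣ imageEdges f ∩ imageEdges g ∣ ℕ.≟ k ⟧) * n ^ t ≤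
      ⟦ i? ⟧ * (n * suc v) ^ v
    row f (no _)      = z≤n
    row f (yes f-inj) = begin
      1 * (∑[ g ← embeddings v n ] ⟦ ∣ imageEdges f ∩ imageEdges g ∣ ℕ.≟ k ⟧) * n ^ t
        ≡⟨ cong (_* n ^ t) (trans (ℕ.*-identityˡ _) (∑-filter inj? (maps v n) _)) ⟩
      (∑[ g ← maps v n ] (⟦ inj? g ⟧ * ⟦ ∣ imageEdges f ∩ imageEdges g ∣ ℕ.≟ k ⟧)) * n ^ t
        ≤⟨ ℕ.*-monoˡ-≤ (n ^ t) (∑-mono (maps v n) (entry f f-inj)) ⟩
      (∑[ g ← maps v n ] ⟦ t ℕ.≤? common f g ⟧) * n ^ t
        ≤⟨ common-tail f f-inj t ⟩
      (n * suc v) ^ v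
        ≡⟨ ℕ.*-identityˡ _ ⟨
      1 * (n * suc v) ^ v ∎

-- Counting the graphs with E edges that contain a given graph

suc-P-suc : ∀ n k → suc n P suc k ≡ suc n * (n P k)
suc-P-suc n zero    = P-suc (suc n) 0
suc-P-suc n (suc k) = begin
  suc n P suc (suc k)          ≡⟨ P-suc (suc n) (suc k) ⟩
  (n ∸ k) * (suc n P suc k)    ≡⟨ cong ((n ∸ k) *_) (suc-P-suc n k) ⟩
  (n ∸ k) * (suc n * (n P k))  ≡⟨ solve 3 (λ a b c → a :* (b :* c) := b :* (a :* c)) refl (n ∸ k) (suc n) (n P k) ⟩
  suc n * ((n ∸ k) * (n P k))  ≡⟨ cong (suc n *_) (sym (P-suc n k)) ⟩
  suc n * (n P suc k)          ∎
  where open ≡-Reasoning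
        open +-*-Solver using (solve; _:=_; _:*_)

C-absorption : ∀ n k → suc k * (suc n C suc k) ≡ suc n * (n C k)
C-absorption zero    zero    = refl
C-absorption zero    (suc k) = ℕ.*-zeroʳ (suc (suc k))
C-absorption (suc n) zero    = trans (ℕ.*-identityˡ _) (trans (nC1≡n (suc (suc n))) (sym (ℕ.*-identityʳ _)))
C-absorption (suc n) (suc k) = begin
  suc (suc k) * (suc (suc n) C suc (suc k))
    ≡⟨ cong (suc (suc k) *_) (sym (nCk+nC[k+1]≡[n+1]C[k+1] (suc n) (suc k))) ⟩
  suc (suc k) * (x + (suc n C suc (suc k)))
    ≡⟨ ℕ.*-distribˡ-+ (suc (suc k)) x _ ⟩
  (x + suc k * x) + suc (suc k) * (suc n C suc (suc k))
    ≡⟨ cong₂ (λ a b → (x + a) + b) (C-absorption n k) (C-absorption n (suc k)) ⟩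
  (x + suc n * (n C k)) + suc n * (n C suc k)
    ≡⟨ trans (ℕ.+-assoc x _ _) (cong (x +_) (sym (ℕ.*-distribˡ-+ (suc n) (n C k) (n C suc k)))) ⟩
  x + suc n * ((n C k) + (n C suc k))
    ≡⟨ cong (λ t → x + suc n * t) (nCk+nC[k+1]≡[n+1]C[k+1] n k) ⟩
  suc (suc n) * x ∎
  where
  open ≡-Reasoning
  x : ℕ
  x = suc n C suc k

-- With N = f + c and E = f + j this is binom(N-f, E-f) / binom(N, E) = P(E, N, f), cleared of
-- denominators. Every step of the induction on `f` is one absorption.
P*C≡C*P : ∀ f c j → ((f + c) P f) * (c C j) ≡ ((f + c) C (f + j)) * ((f + j) P f)
P*C≡C*P zero    c j = ℕ.*-comm 1 (c C j)
P*C≡C*P (suc f) c j = begin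
  (suc (f + c) P suc f) * (c C j)
    ≡⟨ cong (_* (c C j)) (suc-P-suc (f + c) f) ⟩
  suc (f + c) * ((f + c) P f) * (c C j)
    ≡⟨ trans (ℕ.*-assoc (suc (f + c)) ((f + c) P f) (c C j)) (cong (suc (f + c) *_) (P*C≡C*P f c j)) ⟩
  suc (f + c) * (((f + c) C (f + j)) * ((f + j) P f))
    ≡⟨ trans (sym (ℕ.*-assoc (suc (f + c)) ((f + c) C (f + j)) ((f + j) P f))) (cong (_* ((f + j) P f)) (sym (C-absorption (f + c) (f + j)))) ⟩
  suc (f + j) * (suc (f + c) C suc (f + j)) * ((f + j) P f)
    ≡⟨ solve 3 (λ a b c → a :* b :* c := b :* (a :* c)) refl (suc (f + j)) (suc (f + c) C suc (f + j)) ((f + j) P f) ⟩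
  (suc (f + c) C suc (f + j)) * (suc (f + j) * ((f + j) P f))
    ≡⟨ cong ((suc (f + c) C suc (f + j)) *_) (sym (suc-P-suc (f + j) f)) ⟩
  (suc (f + c) C suc (f + j)) * (suc (f + j) P suc f) ∎
  where open ≡-Reasoning
        open +-*-Solver using (solve; _:=_; _:*_)

C>0 : ∀ {n k} → k ≤ n → 0 < n C k
C>0 {n} {zero} _ = ℕ.≤-refl
C>0 {suc n} {suc k} (s≤s k≤n) = ℕ.≤-trans (C>0 k≤n)
  (ℕ.≤-trans (ℕ.m≤m+n (n C k) (n C suc k)) (ℕ.≤-reflexive (nCk+nC[k+1]≡[n+1]C[k+1] n k)))

supersets : ∀ {m} → Subset m → ℕ → ℕ
supersets {m} F E = ∑[ g ← allSubsets m ] (⟦ ∣ g ∣ ℕ.≟ E ⟧ * ⟦ F ⊆? g ⟧)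

∑-allSubsets-suc : ∀ m f → ∑ (allSubsets (suc m)) f ≡
  ∑[ g ← allSubsets m ] f (inside Vec.∷ g) + ∑[ g ← allSubsets m ] f (outside Vec.∷ g)
∑-allSubsets-suc m f = trans (∑-prodWith Vec._∷_ (inside ∷ outside ∷ []) (allSubsets m) f)
  (cong (∑[ g ← allSubsets m ] f (inside Vec.∷ g) +_) (ℕ.+-identityʳ _))

private
  ∑-vanish : ∀ {m} (f : Subset m → ℕ) → (∀ g → f g ≡ 0) → ∑ (allSubsets m) f ≡ 0
  ∑-vanish {m} f vanish = trans (∑-cong (allSubsets m) vanish) (∑-zero (allSubsets m))

  suc-≟ : ∀ m n → ⟦ suc m ℕ.≟ suc n ⟧ ≡ ⟦ m ℕ.≟ n ⟧
  suc-≟ m n = ⟦⟧-cong (suc m ℕ.≟ suc n) (m ℕ.≟ n) ℕ.suc-injective (cong suc)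

  in⊆in : ∀ {m} (F g : Subset m) → ⟦ inside Vec.∷ F ⊆? inside Vec.∷ g ⟧ ≡ ⟦ F ⊆? g ⟧
  in⊆in F g = ⟦⟧-cong (inside Vec.∷ F ⊆? inside Vec.∷ g) (F ⊆? g) Subset.drop-∷-⊆ Subset.in⊆in

  out⊆ : ∀ {m} (F g : Subset m) b → ⟦ outside Vec.∷ F ⊆? b Vec.∷ g ⟧ ≡ ⟦ F ⊆? g ⟧
  out⊆ F g b = ⟦⟧-cong (outside Vec.∷ F ⊆? b Vec.∷ g) (F ⊆? g) Subset.drop-∷-⊆ Subset.out⊆

supersets-small : ∀ {m} (F : Subset m) {E} → E < ∣ F ∣ → supersets F E ≡ 0
supersets-small F {E} E<∣F∣ = ∑-vanish _ λ g → trans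
  (sym (⟦⟧-× (∣ g ∣ ℕ.≟ E) (F ⊆? g)))
  (⟦⟧-no ((∣ g ∣ ℕ.≟ E) ×-dec (F ⊆? g))
    (λ (∣g∣≡E , F⊆g) → ℕ.<⇒≱ E<∣F∣ (subst (∣ F ∣ ≤_) ∣g∣≡E (Subset.p⊆q⇒∣p∣≤∣q∣ F⊆g))))

supersets-inside : ∀ {m} (F : Subset m) E → supersets (inside Vec.∷ F) (suc E) ≡ supersets F E
supersets-inside {m} F E = trans (∑-allSubsets-suc m _) (trans (cong₂ _+_
  (∑-cong (allSubsets m) (λ g → cong₂ _*_ (suc-≟ ∣ g ∣ E) (in⊆in F g)))
  (∑-vanish {m} _ (λ g → trans
    (cong (⟦ ∣ g ∣ ℕ.≟ suc E ⟧ *_) (⟦⟧-no (inside Vec.∷ F ⊆? outside Vec.∷ g)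
      (λ sub → 0∉ (sub Vec.here))))
    (ℕ.*-zeroʳ ⟦ ∣ g ∣ ℕ.≟ suc E ⟧))))
  (ℕ.+-identityʳ (supersets F E)))
  where
  0∉ : ∀ {m} {g : Subset m} → ¬ (zero ∈ outside Vec.∷ g)
  0∉ ()

supersets-outside-zero : ∀ {m} (F : Subset m) → supersets (outside Vec.∷ F) 0 ≡ supersets F 0
supersets-outside-zero {m} F = trans (∑-allSubsets-suc m _) (cong₂ _+_
  (∑-vanish {m} _ (λ g → refl))
  (∑-cong (allSubsets m) (λ g → cong (⟦ ∣ g ∣ ℕ.≟ 0 ⟧ *_) (out⊆ F g outside))))

supersets-outside-suc : ∀ {m} (F : Subset m) E →
  supersets (outside Vec.∷ F) (suc E) ≡ supersets F E + supersets F (suc E)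
supersets-outside-suc {m} F E = trans (∑-allSubsets-suc m _) (cong₂ _+_
  (∑-cong (allSubsets m) (λ g → cong₂ _*_ (suc-≟ ∣ g ∣ E) (out⊆ F g inside)))
  (∑-cong (allSubsets m) (λ g → cong (⟦ ∣ g ∣ ℕ.≟ suc E ⟧ *_) (out⊆ F g outside))))

-- A superset of `F` with j further elements is a choice of j elements of the complement. In the
-- induction a position inside `F` is forced, and a position outside it gives Pascal's rule.
supersets-count : ∀ {m} (F : Subset m) j → supersets F (∣ F ∣ + j) ≡ ∣ ∁ F ∣ C j
supersets-count Vec.[] zero    = refl
supersets-count Vec.[] (suc j) = refl
supersets-count (inside Vec.∷ F) j = trans (supersets-inside F (∣ F ∣ + j)) (supersets-count F j)
-- For j = 0 Pascal's rule degenerates: a set that used the new position would have too few elements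
-- left to contain `F`. The size of `F` is split because `supersets` reduces differently at 0 and at
-- a successor.
supersets-count (outside Vec.∷ F) zero with ∣ F ∣ in eq | supersets-count F zero
... | zero  | ih = trans (supersets-outside-zero F) ih
... | suc k | ih = trans (supersets-outside-suc F (k + 0)) (cong₂ _+_
  (supersets-small F (ℕ.≤-reflexive (trans (cong suc (ℕ.+-identityʳ k)) (sym eq)))) ih)
supersets-count (outside Vec.∷ F) (suc j) = begin
  supersets (outside Vec.∷ F) (∣ F ∣ + suc j)
    ≡⟨ cong (supersets (outside Vec.∷ F)) (ℕ.+-suc ∣ F ∣ j) ⟩
  supersets (outside Vec.∷ F) (suc (∣ F ∣ + j))
    ≡⟨ supersets-outside-suc F (∣ F ∣ + j) ⟩
  supersets F (∣ F ∣ + j) + supersets F (suc (∣ F ∣ + j))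
    ≡⟨ cong₂ _+_ (supersets-count F j)
         (trans (cong (supersets F) (sym (ℕ.+-suc ∣ F ∣ j))) (supersets-count F (suc j))) ⟩
  ∣ ∁ F ∣ C j + ∣ ∁ F ∣ C suc j
    ≡⟨ nCk+nC[k+1]≡[n+1]C[k+1] ∣ ∁ F ∣ j ⟩
  suc ∣ ∁ F ∣ C suc j ∎
  where open ≡-Reasoning

∣p∣+∣∁p∣≡n : ∀ {m} (p : Subset m) → ∣ p ∣ + ∣ ∁ p ∣ ≡ m
∣p∣+∣∁p∣≡n {m} p = trans (cong (∣ p ∣ +_) (Subset.∣∁p∣≡n∸∣p∣ p)) (ℕ.m+[n∸m]≡n (Subset.∣p∣≤n p))

length-Ω : ∀ n E → length (Ω n E) ≡ length (pairs n) C E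
length-Ω n E = begin
  length (Ω n E)
    ≡⟨ length-filter≡∑ (λ g → ∣ g ∣ ℕ.≟ E) (allGraphs n) ⟩
  ∑[ g ← allGraphs n ] ⟦ ∣ g ∣ ℕ.≟ E ⟧
    ≡⟨ ∑-cong (allGraphs n) (λ g → trans (sym (ℕ.*-identityʳ _))
         (cong (⟦ ∣ g ∣ ℕ.≟ E ⟧ *_) (sym (⟦⟧-yes (∅ ⊆? g) (Subset.⊆-min g))))) ⟩
  supersets ∅ E
    ≡⟨ cong (λ k → supersets ∅ (k + E)) (Subset.∣⊥∣≡0 M) ⟨
  supersets ∅ (∣ ∅ ∣ + E)
    ≡⟨ supersets-count ∅ E ⟩
  ∣ ∁ ∅ ∣ C E
    ≡⟨ cong (_C E) (trans (cong (_+ ∣ ∁ ∅ ∣) (sym (Subset.∣⊥∣≡0 M))) (∣p∣+∣∁p∣≡n ∅)) ⟩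
  M C E ∎
  where
  open ≡-Reasoning
  M : ℕ
  M = length (pairs n)
  ∅ : Graph n
  ∅ = Subset.⊥

-- Cleared of denominators, a random graph with `E` edges contains `F` with probability P(E, N,
-- |F|). If `F` has more than `E` edges, both sides vanish.
Ω-containing : ∀ n E (F : Graph n) →
  (length (pairs n) P ∣ F ∣) * ∑[ g ← Ω n E ] ⟦ F ⊆? g ⟧ ≡ length (Ω n E) * (E P ∣ F ∣)
Ω-containing n E F = trans
  (cong ((length (pairs n) P ∣ F ∣) *_) (∑-filter (λ g → ∣ g ∣ ℕ.≟ E) (allGraphs n) _))
  (trans (by-size (∣ F ∣ ℕ.≤? E)) (cong (_* (E P ∣ F ∣)) (sym (length-Ω n E))))
  where
  open ≡-Reasoning
  by-size : Dec (∣ F ∣ ≤ E) →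
    (length (pairs n) P ∣ F ∣) * supersets F E ≡ (length (pairs n) C E) * (E P ∣ F ∣)
  by-size (no ≰) = trans
    (cong ((length (pairs n) P ∣ F ∣) *_) (supersets-small F (ℕ.≰⇒> ≰)))
    (trans (ℕ.*-zeroʳ (length (pairs n) P ∣ F ∣)) (sym (trans
      (cong ((length (pairs n) C E) *_) (k>n⇒nPk≡0 (ℕ.≰⇒> ≰))) (ℕ.*-zeroʳ (length (pairs n) C E)))))
  by-size (yes ≤E) = begin
    (length (pairs n) P ∣ F ∣) * supersets F E
      ≡⟨ cong₂ (λ M E → (M P ∣ F ∣) * supersets F E) (sym (∣p∣+∣∁p∣≡n F)) (sym E≡) ⟩
    ((∣ F ∣ + ∣ ∁ F ∣) P ∣ F ∣) * supersets F (∣ F ∣ + j)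
      ≡⟨ cong (((∣ F ∣ + ∣ ∁ F ∣) P ∣ F ∣) *_) (supersets-count F j) ⟩
    ((∣ F ∣ + ∣ ∁ F ∣) P ∣ F ∣) * (∣ ∁ F ∣ C j)
      ≡⟨ P*C≡C*P ∣ F ∣ ∣ ∁ F ∣ j ⟩
    ((∣ F ∣ + ∣ ∁ F ∣) C (∣ F ∣ + j)) * ((∣ F ∣ + j) P ∣ F ∣)
      ≡⟨ cong₂ (λ M E → (M C E) * (E P ∣ F ∣)) (∣p∣+∣∁p∣≡n F) E≡ ⟩
    (length (pairs n) C E) * (E P ∣ F ∣) ∎
    where
    j : ℕ
    j = E ∸ ∣ F ∣
    E≡ : ∣ F ∣ + j ≡ E
    E≡ = ℕ.m+[n∸m]≡n ≤E

-- The first two moments as counts of graphs containing given edge sets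

module Moments (v : ℕ) (H : Graph v) (n : ℕ) where

  open Copies v H n

  length-copies : ∀ g → length (copies v n H g) ≡ ∑[ S ← Kn-copies ] ⟦ edges n S ⊆? g ⟧
  length-copies g = begin
    length (copies v n H g)
      ≡⟨ length-filter≡∑ (copy? g) (allSubgraphs n) ⟩
    ∑[ S ← allSubgraphs n ] ⟦ copy? g S ⟧
      ≡⟨ ∑-cong (allSubgraphs n) (λ S → trans
           (⟦⟧-cong (copy? g S) (copy? (complete n) S ×-dec (edges n S ⊆? g))
             (λ ((F⊆g , ends) , iso) → ((Subset.⊆⊤ , ends) , iso) , F⊆g)
             (λ (((_ , ends) , iso) , F⊆g) → (F⊆g , ends) , iso))
           (⟦⟧-× (copy? (complete n) S) (edges n S ⊆? g))) ⟩
    ∑[ S ← allSubgraphs n ] (⟦ copy? (complete n) S ⟧ * ⟦ edges n S ⊆? g ⟧)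
      ≡⟨ ∑-filter (copy? (complete n)) (allSubgraphs n) _ ⟨
    ∑[ S ← Kn-copies ] ⟦ edges n S ⊆? g ⟧ ∎
    where
    open ≡-Reasoning
    copy? : ∀ g S → Dec (IsSubgraph n S g × Isomorphic v n H S)
    copy? g S = isSubgraph? n S g ×-dec isomorphic? v n H S

  containing : ℕ → Graph n → ℕ
  containing E F = ∑[ g ← Ω n E ] ⟦ F ⊆? g ⟧

  first-moment : ∀ E → ∑[ g ← Ω n E ] length (copies v n H g) ≡ ∑[ S ← Kn-copies ] containing E (edges n S)
  first-moment E = trans (∑-cong (Ω n E) length-copies) (∑-swap (Ω n E) Kn-copies _)

  -- A graph contains two copies exactly if it contains the union of their edge sets, whose size 2ℓ
  -- - k depends only on the number k of common edges.
  second-moment : ∀ E → ∑[ g ← Ω n E ] (length (copies v n H g) * length (copies v n H g)) ≡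
    ∑[ S ← Kn-copies ] ∑[ S′ ← Kn-copies ] containing E (edges n S ∪ edges n S′)
  second-moment E = begin
    ∑[ g ← Ω n E ] (length (copies v n H g) * length (copies v n H g))
      ≡⟨ ∑-cong (Ω n E) (λ g → trans (cong₂ _*_ (length-copies g) (length-copies g))
           (∑-*-∑ Kn-copies Kn-copies _ _)) ⟩
    ∑[ g ← Ω n E ] ∑[ S ← Kn-copies ] ∑[ S′ ← Kn-copies ] (⟦ edges n S ⊆? g ⟧ * ⟦ edges n S′ ⊆? g ⟧)
      ≡⟨ ∑-cong (Ω n E) (λ g → ∑-cong Kn-copies (λ S → ∑-cong Kn-copies (λ S′ → ∪⊆ (edges n S) (edges n S′) g))) ⟩
    ∑[ g ← Ω n E ] ∑[ S ← Kn-copies ] ∑[ S′ ← Kn-copies ] ⟦ edges n S ∪ edges n S′ ⊆? g ⟧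
      ≡⟨ trans (∑-swap (Ω n E) Kn-copies _) (∑-cong Kn-copies (λ S → ∑-swap (Ω n E) Kn-copies _)) ⟩
    ∑[ S ← Kn-copies ] ∑[ S′ ← Kn-copies ] containing E (edges n S ∪ edges n S′) ∎
    where
    open ≡-Reasoning
    ∪⊆ : ∀ (F G g : Graph n) → ⟦ F ⊆? g ⟧ * ⟦ G ⊆? g ⟧ ≡ ⟦ F ∪ G ⊆? g ⟧
    ∪⊆ F G g = trans (sym (⟦⟧-× (F ⊆? g) (G ⊆? g)))
      (⟦⟧-cong ((F ⊆? g) ×-dec (G ⊆? g)) (F ∪ G ⊆? g)
        (λ (F⊆g , G⊆g) x∈ → [ F⊆g , G⊆g ]′ (Subset.x∈p∪q⁻ F G x∈))
        (λ sub → (λ x∈ → sub (Subset.x∈p∪q⁺ (inj₁ x∈))) , (λ x∈ → sub (Subset.x∈p∪q⁺ (inj₂ x∈)))))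

  ∣edges∪edges∣ : ∀ {S S′} → S ∈ˡ Kn-copies → S′ ∈ˡ Kn-copies →
    ∣ edges n S ∪ edges n S′ ∣ ≡ 2 * ∣ H ∣ ∸ ∣ edges n S ∩ edges n S′ ∣
  ∣edges∪edges∣ {S} {S′} S∈ S′∈ = begin
    ∣ F ∪ G ∣                               ≡⟨ ℕ.m+n∸n≡m ∣ F ∪ G ∣ ∣ F ∩ G ∣ ⟨
    ∣ F ∪ G ∣ + ∣ F ∩ G ∣ ∸ ∣ F ∩ G ∣       ≡⟨ cong (_∸ ∣ F ∩ G ∣) (trans (∣p∪q∣+∣p∩q∣ F G)
                                               (cong₂ _+_ (∣edges∣ S∈) (trans (∣edges∣ S′∈) (sym (ℕ.+-identityʳ ∣ H ∣))))) ⟩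
    2 * ∣ H ∣ ∸ ∣ F ∩ G ∣                   ∎
    where
    open ≡-Reasoning
    F G : Graph n
    F = edges n S
    G = edges n S′

-- Natural numbers in ℚ

cast : ℕ → ℚ
cast n = ℤ.+ n ℚ./ 1

-- `ratio` reduces fractions by their gcd and does not compute on variables; identities are
-- therefore checked on unnormalised fractions, where equality means equal cross products.
toℚᵘ-ratio : ∀ a b → ℚ.toℚᵘ (ratio a (suc b)) ℚᵘ.≃ mkℚᵘ (ℤ.+ a) b
toℚᵘ-ratio a b = ℚ.toℚᵘ-fromℚᵘ (mkℚᵘ (ℤ.+ a) b)

cast-+ : ∀ m n → cast (m + n) ≡ cast m ℚ.+ cast n
cast-+ m n = ℚ.toℚᵘ-injective (begin-equality
  ℚ.toℚᵘ (cast (m + n))                    ≃⟨ toℚᵘ-ratio (m + n) 0 ⟩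
  mkℚᵘ (ℤ.+ (m + n)) 0                       ≃⟨ *≡* (cong (ℤ._* ℤ.+ 1) (sym (cong₂ ℤ._+_ (ℤ.*-identityʳ (ℤ.+ m)) (ℤ.*-identityʳ (ℤ.+ n))))) ⟩
  mkℚᵘ (ℤ.+ m) 0 ℚᵘ.+ mkℚᵘ (ℤ.+ n) 0           ≃⟨ ℚᵘ.+-cong (toℚᵘ-ratio m 0) (toℚᵘ-ratio n 0) ⟨
  ℚ.toℚᵘ (cast m) ℚᵘ.+ ℚ.toℚᵘ (cast n)     ≃⟨ ℚ.toℚᵘ-homo-+ (cast m) (cast n) ⟨
  ℚ.toℚᵘ (cast m ℚ.+ cast n)               ∎)
  where open ℚᵘ.≤-Reasoning

cast-* : ∀ m n → cast (m * n) ≡ cast m ℚ.* cast n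
cast-* m n = ℚ.toℚᵘ-injective (begin-equality
  ℚ.toℚᵘ (cast (m * n))                    ≃⟨ toℚᵘ-ratio (m * n) 0 ⟩
  mkℚᵘ (ℤ.+ (m * n)) 0                       ≃⟨ *≡* (cong (ℤ._* ℤ.+ 1) (ℤ.pos-* m n)) ⟩
  mkℚᵘ (ℤ.+ m) 0 ℚᵘ.* mkℚᵘ (ℤ.+ n) 0           ≃⟨ ℚᵘ.*-cong (toℚᵘ-ratio m 0) (toℚᵘ-ratio n 0) ⟨
  ℚ.toℚᵘ (cast m) ℚᵘ.* ℚ.toℚᵘ (cast n)     ≃⟨ ℚ.toℚᵘ-homo-* (cast m) (cast n) ⟨
  ℚ.toℚᵘ (cast m ℚ.* cast n)               ∎)
  where open ℚᵘ.≤-Reasoning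

cast*ratio : ∀ a b → 0 < b → cast b ℚ.* ratio a b ≡ cast a
cast*ratio a (suc b) _ = ℚ.toℚᵘ-injective (begin-equality
  ℚ.toℚᵘ (cast (suc b) ℚ.* ratio a (suc b))               ≃⟨ ℚ.toℚᵘ-homo-* (cast (suc b)) (ratio a (suc b)) ⟩
  ℚ.toℚᵘ (cast (suc b)) ℚᵘ.* ℚ.toℚᵘ (ratio a (suc b))     ≃⟨ ℚᵘ.*-cong (toℚᵘ-ratio (suc b) 0) (toℚᵘ-ratio a b) ⟩
  mkℚᵘ (ℤ.+ suc b) 0 ℚᵘ.* mkℚᵘ (ℤ.+ a) b                      ≃⟨ *≡* (trans (ℤ.*-identityʳ _)
                                                               (trans (ℤ.*-comm (ℤ.+ suc b) (ℤ.+ a)) (cong (λ t → ℤ.+ a ℤ.* ℤ.+ suc t) (sym (ℕ.+-identityʳ b))))) ⟩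
  mkℚᵘ (ℤ.+ a) 0                                            ≃⟨ toℚᵘ-ratio a 0 ⟨
  ℚ.toℚᵘ (cast a)                                         ∎)
  where open ℚᵘ.≤-Reasoning

cast-mono : ∀ {m n} → m ≤ n → cast m ℚ.≤ cast n
cast-mono {m} {n} m≤n = ℚ.toℚᵘ-cancel-≤ (begin
  ℚ.toℚᵘ (cast m)  ≃⟨ toℚᵘ-ratio m 0 ⟩
  mkℚᵘ (ℤ.+ m) 0     ≤⟨ *≤* (ℤ.*-monoʳ-≤-nonNeg (ℤ.+ 1) (ℤ.+≤+ m≤n)) ⟩
  mkℚᵘ (ℤ.+ n) 0     ≃⟨ toℚᵘ-ratio n 0 ⟨
  ℚ.toℚᵘ (cast n)  ∎)
  where open ℚᵘ.≤-Reasoning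

cast≥0 : ∀ n → 0ℚ ℚ.≤ cast n
cast≥0 n = cast-mono (z≤n {n})

cast-pos : ∀ {n} → 0 < n → ℚ.Positive (cast n)
cast-pos 0<n = ℚ.positive (ℚ.<-≤-trans (ℚ.positive⁻¹ 1ℚ) (cast-mono 0<n))

cast-cancel : ∀ {b x y} → 0 < b → cast b ℚ.* x ≡ cast b ℚ.* y → x ≡ y
cast-cancel {b} {x} {y} 0<b eq = ℚ.≤-antisym
  (ℚ.*-cancelˡ-≤-pos (cast b) {{cast-pos 0<b}} (ℚ.≤-reflexive eq))
  (ℚ.*-cancelˡ-≤-pos (cast b) {{cast-pos 0<b}} (ℚ.≤-reflexive (sym eq)))

cast-∸ : ∀ {m n} → n ≤ m → cast (m ∸ n) ≡ cast m ℚ.- cast n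
cast-∸ {m} {n} n≤m = trans
  (solve 2 (λ a b → a := (a :+ b) :- b) refl (cast (m ∸ n)) (cast n))
  (cong (ℚ._- cast n) (trans (sym (cast-+ (m ∸ n) n)) (cong cast (ℕ.m∸n+n≡m n≤m))))
  where open ℚ.+-*-Solver

ratio-unique : ∀ {a b x} → 0 < b → cast b ℚ.* x ≡ cast a → x ≡ ratio a b
ratio-unique {a} {b} 0<b eq = cast-cancel 0<b (trans eq (sym (cast*ratio a b 0<b)))

ratio≡cast* : ∀ a b → ratio a b ≡ cast a ℚ.* ratio 1 b
ratio≡cast* a zero    = sym (ℚ.*-zeroʳ (cast a))
ratio≡cast* a (suc b) = sym (ratio-unique {a} {suc b} (s≤s z≤n) (begin
  cast (suc b) ℚ.* (cast a ℚ.* ratio 1 (suc b))  ≡⟨ solve 3 (λ x y z → x :* (y :* z) := y :* (x :* z)) refl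
                                                       (cast (suc b)) (cast a) (ratio 1 (suc b)) ⟩
  cast a ℚ.* (cast (suc b) ℚ.* ratio 1 (suc b))  ≡⟨ cong (cast a ℚ.*_) (cast*ratio 1 (suc b) (s≤s z≤n)) ⟩
  cast a ℚ.* 1ℚ                                  ≡⟨ ℚ.*-identityʳ (cast a) ⟩
  cast a                                         ∎))
  where open ≡-Reasoning
        open ℚ.+-*-Solver

archimedean : ∀ q → ∃[ K ] q ℚ.≤ cast K
archimedean q@(ℚ.mkℚ (ℤ.+ a) d _) = a , ℚ.toℚᵘ-cancel-≤ (begin
  mkℚᵘ (ℤ.+ a) d     ≤⟨ *≤* (ℤ.*-monoˡ-≤-nonNeg (ℤ.+ a) (ℤ.+≤+ (s≤s (z≤n {d})))) ⟩
  mkℚᵘ (ℤ.+ a) 0     ≃⟨ toℚᵘ-ratio a 0 ⟨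
  ℚ.toℚᵘ (cast a)  ∎)
  where open ℚᵘ.≤-Reasoning
archimedean q@(ℚ.mkℚ ℤ.-[1+ a ] d _) = 0 , ℚ.<⇒≤ (ℚ.negative⁻¹ q)

∣cast∣ : ∀ n → ℚ.∣ cast n ∣ ≡ cast n
∣cast∣ n = ℚ.0≤p⇒∣p∣≡p (cast≥0 n)

∣*∣≤ : ∀ {x y b d} → ℚ.∣ x ∣ ℚ.≤ b → ℚ.∣ y ∣ ℚ.≤ d → ℚ.∣ x ℚ.* y ∣ ℚ.≤ b ℚ.* d
∣*∣≤ {x} {y} {b} {d} x≤b y≤d = begin
  ℚ.∣ x ℚ.* y ∣        ≡⟨ ℚ.∣p*q∣≡∣p∣*∣q∣ x y ⟩
  ℚ.∣ x ∣ ℚ.* ℚ.∣ y ∣  ≤⟨ ℚ.*-monoʳ-≤-nonNeg ℚ.∣ y ∣ {{ℚ.nonNegative (ℚ.0≤∣p∣ y)}} x≤b ⟩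
  b ℚ.* ℚ.∣ y ∣        ≤⟨ ℚ.*-monoˡ-≤-nonNeg b {{ℚ.nonNegative (ℚ.≤-trans (ℚ.0≤∣p∣ x) x≤b)}} y≤d ⟩
  b ℚ.* d              ∎
  where open ℚ.≤-Reasoning

∣+∣≤ : ∀ {x y b d} → ℚ.∣ x ∣ ℚ.≤ b → ℚ.∣ y ∣ ℚ.≤ d → ℚ.∣ x ℚ.+ y ∣ ℚ.≤ b ℚ.+ d
∣+∣≤ {x} {y} x≤b y≤d = ℚ.≤-trans (ℚ.∣p+q∣≤∣p∣+∣q∣ x y) (ℚ.+-mono-≤ x≤b y≤d)

infixr 8 _^ℚ_

_^ℚ_ : ℚ → ℕ → ℚ
x ^ℚ zero  = 1ℚ
x ^ℚ suc k = x ℚ.* x ^ℚ k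

^ℚ-+ : ∀ x j k → x ^ℚ (j + k) ≡ x ^ℚ j ℚ.* x ^ℚ k
^ℚ-+ x zero    k = sym (ℚ.*-identityˡ (x ^ℚ k))
^ℚ-+ x (suc j) k = trans (cong (x ℚ.*_) (^ℚ-+ x j k)) (sym (ℚ.*-assoc x (x ^ℚ j) (x ^ℚ k)))

-- O-estimates that are uniform in a rational approximation of p

nC2≥ : ∀ m n → suc m ≤ n → m ≤ n C 2
nC2≥ m (suc n) (s≤s m≤n) = ℕ.≤-trans m≤n (ℕ.≤-trans (ℕ.m≤m+n n (n C 2))
  (ℕ.≤-reflexive (trans (cong (_+ n C 2) (sym (nC1≡n n))) (nCk+nC[k+1]≡[n+1]C[k+1] n 1))))

-- Asymptotic statements are proved for rational approximations x of p,
-- uniformly in x, and passed to the limit afterwards.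
module Asymptotics (E : ℕ → ℕ) (B : ℕ) where

  N : ℕ → ℚ
  N n = cast (n C 2)

  -- For each large `n` the late terms of the sequence `p` satisfy this with one fixed `B`, but how
  -- late they must be depends on `n`. Estimates are therefore required for all pairs (n, x), not
  -- for a chosen x along all n.
  record Near (n : ℕ) (x : ℚ) : Set where
    constructor near
    field
      x≥0   : 0ℚ ℚ.≤ x
      x≤1   : x ℚ.≤ 1ℚ
      close : ℚ.∣ cast (E n) ℚ.- x ℚ.* N n ∣ ℚ.≤ cast B
  open Near public

  infix 4 _≪_ _≈_

  record _≪_ (a : ℕ → ℚ → ℚ) (g : ℕ → ℕ) : Set where
    constructor ≪-intro
    field
      K n₀  : ℕ
      bound : ∀ n x → n₀ ≤ n → Near n x → ℚ.∣ a n x ∣ ℚ.≤ cast (K * g n)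

  one : ℕ → ℕ
  one _ = 1

  module _ {a b : ℕ → ℚ → ℚ} where

    ≪-cong : ∀ {g} n₁ → (∀ n x → n₁ ≤ n → Near n x → a n x ≡ b n x) → a ≪ g → b ≪ g
    ≪-cong n₁ eq (≪-intro K n₀ a≤) = ≪-intro K (n₀ ℕ.⊔ n₁) λ n x n≥ nr →
      subst (λ t → ℚ.∣ t ∣ ℚ.≤ _) (eq n x (ℕ.m⊔n≤o⇒n≤o n₀ n₁ n≥) nr)
        (a≤ n x (ℕ.m⊔n≤o⇒m≤o n₀ n₁ n≥) nr)

    ≪-≗ : ∀ {g} → (∀ n x → a n x ≡ b n x) → a ≪ g → b ≪ g
    ≪-≗ eq = ≪-cong 0 (λ n x _ _ → eq n x)

    ≪-+ : ∀ {g} → a ≪ g → b ≪ g → (λ n x → a n x ℚ.+ b n x) ≪ g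
    ≪-+ {g} (≪-intro K n₀ a≤) (≪-intro L n₁ b≤) = ≪-intro (K + L) (n₀ ℕ.⊔ n₁) λ n x n≥ nr →
      ℚ.≤-trans (∣+∣≤ (a≤ n x (ℕ.m⊔n≤o⇒m≤o n₀ n₁ n≥) nr) (b≤ n x (ℕ.m⊔n≤o⇒n≤o n₀ n₁ n≥) nr))
        (ℚ.≤-reflexive (trans (sym (cast-+ (K * g n) (L * g n))) (cong cast (sym (ℕ.*-distribʳ-+ (g n) K L)))))

    ≪-* : ∀ {g h} → a ≪ g → b ≪ h → (λ n x → a n x ℚ.* b n x) ≪ (λ n → g n * h n)
    ≪-* {g} {h} (≪-intro K n₀ a≤) (≪-intro L n₁ b≤) = ≪-intro (K * L) (n₀ ℕ.⊔ n₁) λ n x n≥ nr →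
      ℚ.≤-trans (∣*∣≤ (a≤ n x (ℕ.m⊔n≤o⇒m≤o n₀ n₁ n≥) nr) (b≤ n x (ℕ.m⊔n≤o⇒n≤o n₀ n₁ n≥) nr))
        (ℚ.≤-reflexive (trans (sym (cast-* (K * g n) (L * h n))) (cong cast
          (solve 4 (λ k l g h → k :* g :* (l :* h) := k :* l :* (g :* h)) refl K L (g n) (h n)))))
      where open +-*-Solver using (solve; _:*_; _:=_)

  module _ {a : ℕ → ℚ → ℚ} where

    ≪-neg : ∀ {g} → a ≪ g → (λ n x → ℚ.- a n x) ≪ g
    ≪-neg (≪-intro K n₀ a≤) = ≪-intro K n₀ λ n x n≥ nr →
      ℚ.≤-trans (ℚ.≤-reflexive (ℚ.∣-p∣≡∣p∣ (a n x))) (a≤ n x n≥ nr)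

    ≪-mono : ∀ {g h} L n₁ → (∀ n → n₁ ≤ n → g n ≤ L * h n) → a ≪ g → a ≪ h
    ≪-mono {g} {h} L n₁ g≤ (≪-intro K n₀ a≤) = ≪-intro (K * L) (n₀ ℕ.⊔ n₁) λ n x n≥ nr →
      ℚ.≤-trans (a≤ n x (ℕ.m⊔n≤o⇒m≤o n₀ n₁ n≥) nr) (cast-mono (ℕ.≤-trans
        (ℕ.*-monoʳ-≤ K (g≤ n (ℕ.m⊔n≤o⇒n≤o n₀ n₁ n≥))) (ℕ.≤-reflexive (sym (ℕ.*-assoc K L (h n))))))

    ≪-weight : ∀ {g h} → (∀ n → g n ≡ h n) → a ≪ g → a ≪ h
    ≪-weight {g} {h} eq = ≪-mono 1 0 (λ n _ → ℕ.≤-reflexive (trans (eq n) (sym (ℕ.*-identityˡ (h n)))))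

    ≪-1*ˡ : ∀ {g} → a ≪ (λ n → 1 * g n) → a ≪ g
    ≪-1*ˡ {g} = ≪-weight (λ n → ℕ.*-identityˡ (g n))

    ≪-1*ʳ : ∀ {g} → a ≪ (λ n → g n * 1) → a ≪ g
    ≪-1*ʳ {g} = ≪-weight (λ n → ℕ.*-identityʳ (g n))

  ≪-- : ∀ {a b g} → a ≪ g → b ≪ g → (λ n x → a n x ℚ.- b n x) ≪ g
  ≪-- p q = ≪-+ p (≪-neg q)

  ≪-*ᵇ : ∀ {a b g} → a ≪ g → b ≪ one → (λ n x → a n x ℚ.* b n x) ≪ g
  ≪-*ᵇ p q = ≪-1*ʳ (≪-* p q)

  ≪-cast : ∀ (f : ℕ → ℕ) → (λ n x → cast (f n)) ≪ f
  ≪-cast f = ≪-intro 1 0 λ n x _ _ → ℚ.≤-reflexive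
    (trans (∣cast∣ (f n)) (cong cast (sym (ℕ.*-identityˡ (f n)))))

  ≪-const : ∀ q → (λ n x → q) ≪ one
  ≪-const q = let K , q≤K = archimedean ℚ.∣ q ∣ in ≪-intro K 0 λ n x _ _ →
    ℚ.≤-trans q≤K (ℚ.≤-reflexive (cong cast (sym (ℕ.*-identityʳ K))))

  ≪-id : (λ n x → x) ≪ one
  ≪-id = ≪-intro 1 0 λ n x _ nr → ℚ.≤-trans (ℚ.≤-reflexive (ℚ.0≤p⇒∣p∣≡p (x≥0 nr))) (x≤1 nr)

  ≪-^ : ∀ k → (λ n x → x ^ℚ k) ≪ one
  ≪-^ zero    = ≪-const 1ℚ
  ≪-^ (suc k) = ≪-*ᵇ ≪-id (≪-^ k)

  n²≤4N : ∀ n → 2 ≤ n → n * n ≤ 4 * (n C 2)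
  n²≤4N n 2≤n = ℕ.+-cancelʳ-≤ (n * n) _ _ (begin
    n * n + n * n               ≡⟨ cong (λ t → t + t) (sym (2*nC2+n≡n*n n)) ⟩
    (2 * c₂ + n) + (2 * c₂ + n) ≡⟨ solve 2 (λ c n → (con 2 :* c :+ n) :+ (con 2 :* c :+ n) := con 4 :* c :+ con 2 :* n) refl c₂ n ⟩
    4 * c₂ + 2 * n              ≤⟨ ℕ.+-monoʳ-≤ (4 * c₂) (ℕ.*-monoˡ-≤ n 2≤n) ⟩
    4 * c₂ + n * n              ∎)
    where
    open ℕ.≤-Reasoning
    open +-*-Solver using (solve; _:*_; _:=_; _:+_; con)
    c₂ : ℕ
    c₂ = n C 2

  -- N has exact order n², so an estimate for N·a loses nothing against one for a. Quotients by N
  -- are handled in this way throughout.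
  ≪-N⁻¹ : ∀ {a g} → (λ n x → N n ℚ.* a n x) ≪ (λ n → n * n * g n) → a ≪ g
  ≪-N⁻¹ {a} {g} (≪-intro K n₀ Na≤) = ≪-intro (K * 4) (n₀ ℕ.⊔ 2) λ n x n≥ nr →
    let 2≤n = ℕ.m⊔n≤o⇒n≤o n₀ 2 n≥ in
    ℚ.*-cancelˡ-≤-pos (N n) {{cast-pos (nC2≥ 1 n 2≤n)}} (begin
      N n ℚ.* ℚ.∣ a n x ∣          ≡⟨ cong (ℚ._* ℚ.∣ a n x ∣) (sym (∣cast∣ (n C 2))) ⟩
      ℚ.∣ N n ∣ ℚ.* ℚ.∣ a n x ∣    ≡⟨ ℚ.∣p*q∣≡∣p∣*∣q∣ (N n) (a n x) ⟨
      ℚ.∣ N n ℚ.* a n x ∣          ≤⟨ Na≤ n x (ℕ.m⊔n≤o⇒m≤o n₀ 2 n≥) nr ⟩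
      cast (K * (n * n * g n))     ≤⟨ cast-mono (ℕ.*-monoʳ-≤ K (ℕ.*-monoˡ-≤ (g n) (n²≤4N n 2≤n))) ⟩
      cast (K * (4 * (n C 2) * g n))  ≡⟨ cong cast (solve 3 (λ k c g → k :* (con 4 :* c :* g) := c :* (k :* con 4 :* g)) refl K (n C 2) (g n)) ⟩
      cast ((n C 2) * (K * 4 * g n))  ≡⟨ cast-* (n C 2) (K * 4 * g n) ⟩
      N n ℚ.* cast (K * 4 * g n)   ∎)
    where
    open ℚ.≤-Reasoning
    open +-*-Solver using (solve; _:*_; _:=_; con)

  ≪-N : ∀ {a g} → a ≪ g → (λ n x → N n ℚ.* a n x) ≪ (λ n → n * n * g n)
  ≪-N {a} {g} p = ≪-mono 1 0 (λ n _ → ℕ.≤-trans (ℕ.*-monoˡ-≤ (g n) (N≤ n)) (ℕ.≤-reflexive (sym (ℕ.*-identityˡ _))))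
    (≪-* (≪-cast (_C 2)) p)
    where
    N≤ : ∀ n → n C 2 ≤ n * n
    N≤ n = ℕ.≤-trans (ℕ.≤-trans (ℕ.m≤m+n (n C 2) _) (ℕ.m≤m+n (2 * (n C 2)) n)) (ℕ.≤-reflexive (2*nC2+n≡n*n n))

  -- This means a = b + O(1/N) with bounded b. Boundedness is part of the relation because of
  -- products: N (ac - bd) = N (a - b) d + N (c - d) a.
  record _≈_ (a b : ℕ → ℚ → ℚ) : Set where
    constructor ≈-intro
    field
      bounded : b ≪ one
      N[a-b]  : (λ n x → N n ℚ.* (a n x ℚ.- b n x)) ≪ one
  open _≈_ public

  ≈-refl : ∀ {a} → a ≪ one → a ≈ a
  ≈-refl {a} p = ≈-intro p (≪-≗ (λ n x → sym (trans (cong (N n ℚ.*_) (ℚ.+-inverseʳ (a n x))) (ℚ.*-zeroʳ (N n))))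
    (≪-const 0ℚ))

  ≈⇒≪ : ∀ {a b} → a ≈ b → a ≪ one
  ≈⇒≪ {a} {b} (≈-intro b≪ N[a-b]≪) = ≪-≗
    (λ n x → solve 2 (λ a b → (a :- b) :+ b := a) refl (a n x) (b n x))
    (≪-+ (≪-N⁻¹ (≪-mono 1 1 one≤ N[a-b]≪)) b≪)
    where
    open ℚ.+-*-Solver
    one≤ : ∀ n → 1 ≤ n → 1 ≤ 1 * (n * n * 1)
    one≤ (suc n) _ = s≤s z≤n

  ≈-cong : ∀ {a a′ b b′} n₁ → (∀ n x → n₁ ≤ n → Near n x → a n x ≡ a′ n x) →
    (∀ n x → b n x ≡ b′ n x) → a ≈ b → a′ ≈ b′
  ≈-cong n₁ eq eq′ (≈-intro b≪ close) = ≈-intro (≪-≗ eq′ b≪)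
    (≪-cong n₁ (λ n x n≥ nr → cong₂ (λ s t → N n ℚ.* (s ℚ.- t)) (eq n x n≥ nr) (eq′ n x)) close)

  ≈-+ : ∀ {a b c d} → a ≈ b → c ≈ d → (λ n x → a n x ℚ.+ c n x) ≈ (λ n x → b n x ℚ.+ d n x)
  ≈-+ {a} {b} {c} {d} p q = ≈-intro (≪-+ (bounded p) (bounded q)) (≪-≗
    (λ n x → solve 5 (λ m a b c d → m :* (a :- b) :+ m :* (c :- d) := m :* ((a :+ c) :- (b :+ d))) refl
      (N n) (a n x) (b n x) (c n x) (d n x))
    (≪-+ (N[a-b] p) (N[a-b] q)))
    where open ℚ.+-*-Solver

  ≈-neg : ∀ {a b} → a ≈ b → (λ n x → ℚ.- a n x) ≈ (λ n x → ℚ.- b n x)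
  ≈-neg {a} {b} p = ≈-intro (≪-neg (bounded p)) (≪-≗
    (λ n x → solve 3 (λ m a b → :- (m :* (a :- b)) := m :* ((:- a) :- (:- b))) refl (N n) (a n x) (b n x))
    (≪-neg (N[a-b] p)))
    where open ℚ.+-*-Solver

  ≈-- : ∀ {a b c d} → a ≈ b → c ≈ d → (λ n x → a n x ℚ.- c n x) ≈ (λ n x → b n x ℚ.- d n x)
  ≈-- p q = ≈-+ p (≈-neg q)

  ≈-* : ∀ {a b c d} → a ≈ b → c ≈ d → (λ n x → a n x ℚ.* c n x) ≈ (λ n x → b n x ℚ.* d n x)
  ≈-* {a} {b} {c} {d} p q = ≈-intro (≪-*ᵇ (bounded p) (bounded q)) (≪-≗
    (λ n x → solve 5 (λ m a b c d → m :* (a :- b) :* d :+ m :* (c :- d) :* a := m :* (a :* c :- b :* d)) refl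
      (N n) (a n x) (b n x) (c n x) (d n x))
    (≪-+ (≪-*ᵇ (N[a-b] p) (bounded q)) (≪-*ᵇ (N[a-b] q) (≈⇒≪ p))))
    where open ℚ.+-*-Solver

-- P(E, N, m) and the covariances up to their leading terms

ratio-1-* : ∀ a b → 0 < a → 0 < b → ratio 1 (a * b) ≡ ratio 1 a ℚ.* ratio 1 b
ratio-1-* a@(suc _) b@(suc _) 0<a 0<b = sym (ratio-unique {1} {a * b} (s≤s z≤n) (begin
  cast (a * b) ℚ.* (ratio 1 a ℚ.* ratio 1 b)
    ≡⟨ cong (ℚ._* (ratio 1 a ℚ.* ratio 1 b)) (cast-* a b) ⟩
  (cast a ℚ.* cast b) ℚ.* (ratio 1 a ℚ.* ratio 1 b)
    ≡⟨ solve 4 (λ a b c d → (a :* b) :* (c :* d) := (a :* c) :* (b :* d)) refl (cast a) (cast b) (ratio 1 a) (ratio 1 b) ⟩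
  (cast a ℚ.* ratio 1 a) ℚ.* (cast b ℚ.* ratio 1 b)
    ≡⟨ cong₂ ℚ._*_ (cast*ratio 1 a 0<a) (cast*ratio 1 b 0<b) ⟩
  1ℚ ∎))
  where open ≡-Reasoning
        open ℚ.+-*-Solver

-- The difference may be taken in ℚ without a condition: for k > n both falling factorials are 0.
cast-P-suc : ∀ n k → cast (n P suc k) ≡ (cast n ℚ.- cast k) ℚ.* cast (n P k)
cast-P-suc n k with ℕ.≤-<-connex k n
... | inj₁ k≤n = trans (cong cast (P-suc n k)) (trans (cast-* (n ∸ k) (n P k))
  (cong (ℚ._* cast (n P k)) (cast-∸ k≤n)))
... | inj₂ n<k = trans (cong cast (k>n⇒nPk≡0 (ℕ.m<n⇒m<1+n n<k)))
  (sym (trans (cong (λ t → (cast n ℚ.- cast k) ℚ.* cast t) (k>n⇒nPk≡0 n<k)) (ℚ.*-zeroʳ (cast n ℚ.- cast k))))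

P>0 : ∀ {n k} → k ≤ n → 0 < n P k
P>0 {n} {zero}  _   = s≤s z≤n
P>0 {n} {suc k} k<n = subst (0 <_) (sym (P-suc n k))
  (ℕ.*-mono-≤ (ℕ.m<n⇒0<n∸m k<n) (P>0 (ℕ.<⇒≤ k<n)))

module Products (E : ℕ → ℕ) (B : ℕ) where

  open Asymptotics E B

  -- `u k` stands for 1/(N - k), `ρ k` for the factor (E - k)/(N - k), and `Π l m` for the product
  -- of the m factors from index l on; `Π 0 m` is P(E, N, m) once N ≥ m. The offset l allows P(E, N,
  -- 2ℓ) to be split in the middle.
  u : ℕ → ℕ → ℚ → ℚ
  u k n x = ratio 1 (n C 2 ∸ k)

  ρ : ℕ → ℕ → ℚ → ℚ
  ρ k n x = (cast (E n) ℚ.- cast k) ℚ.* u k n x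

  Π : ℕ → ℕ → ℕ → ℚ → ℚ
  Π l zero    n x = 1ℚ
  Π l (suc m) n x = Π l m n x ℚ.* ρ (l + m) n x

  Π-+ : ∀ l m n x → Π 0 (l + m) n x ≡ Π 0 l n x ℚ.* Π l m n x
  Π-+ l zero    n x = trans (cong (λ k → Π 0 k n x) (ℕ.+-identityʳ l)) (sym (ℚ.*-identityʳ (Π 0 l n x)))
  Π-+ l (suc m) n x = trans (cong (λ k → Π 0 k n x) (ℕ.+-suc l m))
    (trans (cong (ℚ._* ρ (l + m) n x) (Π-+ l m n x)) (ℚ.*-assoc (Π 0 l n x) (Π l m n x) (ρ (l + m) n x)))

  Pr≡Π : ∀ m n x → m ≤ n C 2 → Pr (E n) (n C 2) m ≡ Π 0 m n x
  Pr≡Π zero    n x _    = refl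
  Pr≡Π (suc m) n x m<N = begin
    ratio (E n P suc m) (n C 2 P suc m)
      ≡⟨ ratio≡cast* (E n P suc m) (n C 2 P suc m) ⟩
    cast (E n P suc m) ℚ.* ratio 1 (n C 2 P suc m)
      ≡⟨ cong₂ ℚ._*_ (cast-P-suc (E n) m) (trans (cong (ratio 1) (P-suc (n C 2) m))
           (ratio-1-* (n C 2 ∸ m) (n C 2 P m) (ℕ.m<n⇒0<n∸m m<N) (P>0 (ℕ.<⇒≤ m<N)))) ⟩
    ((cast (E n) ℚ.- cast m) ℚ.* cast (E n P m)) ℚ.* (u m n x ℚ.* ratio 1 (n C 2 P m))
      ≡⟨ solve 4 (λ a b c d → (a :* b) :* (c :* d) := (b :* d) :* (a :* c)) refl
           (cast (E n) ℚ.- cast m) (cast (E n P m)) (u m n x) (ratio 1 (n C 2 P m)) ⟩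
    (cast (E n P m) ℚ.* ratio 1 (n C 2 P m)) ℚ.* ρ m n x
      ≡⟨ cong (ℚ._* ρ m n x) (trans (sym (ratio≡cast* (E n P m) (n C 2 P m))) (Pr≡Π m n x (ℕ.<⇒≤ m<N))) ⟩
    Π 0 m n x ℚ.* ρ m n x ∎
    where open ≡-Reasoning
          open ℚ.+-*-Solver

  k<N : ∀ k n → k + 2 ≤ n → k < n C 2
  k<N k n k+2≤n = nC2≥ (suc k) n (subst (_≤ n) (ℕ.+-comm k 2) k+2≤n)

  [N-k]u≡1 : ∀ k n x → k + 2 ≤ n → (N n ℚ.- cast k) ℚ.* u k n x ≡ 1ℚ
  [N-k]u≡1 k n x n≥ = trans (cong (ℚ._* u k n x) (sym (cast-∸ (ℕ.<⇒≤ (k<N k n n≥)))))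
    (cast*ratio 1 (n C 2 ∸ k) (ℕ.m<n⇒0<n∸m (k<N k n n≥)))

  u-≪ : ∀ k → u k ≪ one
  u-≪ k = ≪-intro 1 (k + 2) λ n x n≥ _ → u≤1 n x (ℕ.m<n⇒0<n∸m (k<N k n n≥))
    where
    u≤1 : ∀ n x → 0 < n C 2 ∸ k → ℚ.∣ u k n x ∣ ℚ.≤ 1ℚ
    u≤1 n x 0<M = ℚ.*-cancelˡ-≤-pos (cast M) {{cast-pos 0<M}} (begin
      cast M ℚ.* ℚ.∣ u k n x ∣          ≡⟨ cong (ℚ._* ℚ.∣ u k n x ∣) (sym (∣cast∣ M)) ⟩
      ℚ.∣ cast M ∣ ℚ.* ℚ.∣ u k n x ∣    ≡⟨ ℚ.∣p*q∣≡∣p∣*∣q∣ (cast M) (u k n x) ⟨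
      ℚ.∣ cast M ℚ.* u k n x ∣          ≡⟨ cong ℚ.∣_∣ (cast*ratio 1 M 0<M) ⟩
      cast 1                            ≤⟨ cast-mono 0<M ⟩
      cast M                            ≡⟨ ℚ.*-identityʳ (cast M) ⟨
      cast M ℚ.* 1ℚ                     ∎)
      where
      open ℚ.≤-Reasoning
      M : ℕ
      M = n C 2 ∸ k

  -- N/(N - k) = 1 + k/(N - k). The next lemma repeats this once: N (N u - 1) = k N u.
  Nu-≪ : ∀ k → (λ n x → N n ℚ.* u k n x) ≪ one
  Nu-≪ k = ≪-cong (k + 2)
    (λ n x n≥ _ → trans (cong (ℚ._+ cast k ℚ.* u k n x) (sym ([N-k]u≡1 k n x n≥)))
      (solve 3 (λ m k u → (m :- k) :* u :+ k :* u := m :* u) refl (N n) (cast k) (u k n x)))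
    (≪-+ (≪-const 1ℚ) (≪-*ᵇ (≪-const (cast k)) (u-≪ k)))
    where open ℚ.+-*-Solver

  Nu≈1 : ∀ k → (λ n x → N n ℚ.* u k n x) ≈ (λ n x → 1ℚ)
  Nu≈1 k = ≈-intro (≪-const 1ℚ) (≪-cong (k + 2)
    (λ n x n≥ _ → trans
      (solve 3 (λ m k u → k :* (m :* u) := m :* (m :* u :- (m :- k) :* u)) refl (N n) (cast k) (u k n x))
      (cong (λ t → N n ℚ.* (N n ℚ.* u k n x ℚ.- t)) ([N-k]u≡1 k n x n≥)))
    (≪-*ᵇ (≪-const (cast k)) (Nu-≪ k)))
    where open ℚ.+-*-Solver

  E-xN-≪ : (λ n x → cast (E n) ℚ.- x ℚ.* N n) ≪ one
  E-xN-≪ = ≪-intro B 0 λ n x _ nr → ℚ.≤-trans (close nr) (ℚ.≤-reflexive (cong cast (sym (ℕ.*-identityʳ B))))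

  -- N (ρ - x) = N u ((E - xN) - k(1 - x)), a product of bounded factors.
  ρ≈x : ∀ k → ρ k ≈ (λ n x → x)
  ρ≈x k = ≈-intro ≪-id (≪-cong (k + 2)
    (λ n x n≥ _ → trans
      (solve 5 (λ m e k u x → (m :* u) :* ((e :- x :* m) :- k :* (con 1ℚ :- x))
                 := m :* ((e :- k) :* u :- x :* ((m :- k) :* u))) refl
        (N n) (cast (E n)) (cast k) (u k n x) x)
      (cong (λ t → N n ℚ.* (ρ k n x ℚ.- t)) (trans (cong (x ℚ.*_) ([N-k]u≡1 k n x n≥)) (ℚ.*-identityʳ x))))
    (≪-*ᵇ (Nu-≪ k) (≪-- E-xN-≪ (≪-*ᵇ (≪-const (cast k)) (≪-- (≪-const 1ℚ) ≪-id)))))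
    where open ℚ.+-*-Solver

  Π≈x^ : ∀ l m → Π l m ≈ (λ n x → x ^ℚ m)
  Π≈x^ l zero    = ≈-refl (≪-const 1ℚ)
  Π≈x^ l (suc m) = ≈-cong 0 (λ _ _ _ _ → refl) (λ n x → ℚ.*-comm (x ^ℚ m) x)
    (≈-* (Π≈x^ l m) (ρ≈x (l + m)))

  -- The difference of the two factors is exactly -l (1 - ρ_i)/(N - l - i). Here `ρ≈x` would be too
  -- coarse, since the unknown E - xN contributes at the same order 1/N to either factor; it drops
  -- out of the difference.
  ρ-shift : ∀ l i → (λ n x → N n ℚ.* (ρ (l + i) n x ℚ.- ρ i n x)) ≈ (λ n x → ℚ.- (cast l ℚ.* (1ℚ ℚ.- x)))
  ρ-shift l i = ≈-cong (l + i + 2)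
    (λ n x n≥ _ → sym (difference n x ([N-k]u≡1 (l + i) n x n≥)
      ([N-k]u≡1 i n x (ℕ.≤-trans (ℕ.+-monoˡ-≤ 2 (ℕ.m≤n+m i l)) n≥))))
    (λ n x → cong (λ t → ℚ.- (cast l ℚ.* t)) (ℚ.*-identityˡ (1ℚ ℚ.- x)))
    (≈-neg (≈-* (≈-refl (≪-const (cast l))) (≈-* (Nu≈1 (l + i)) (≈-- (≈-refl (≪-const 1ℚ)) (ρ≈x i)))))
    where
    open ≡-Reasoning
    open ℚ.+-*-Solver
    difference : ∀ n x → (N n ℚ.- cast (l + i)) ℚ.* u (l + i) n x ≡ 1ℚ → (N n ℚ.- cast i) ℚ.* u i n x ≡ 1ℚ →
      N n ℚ.* (ρ (l + i) n x ℚ.- ρ i n x) ≡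
      ℚ.- (cast l ℚ.* ((N n ℚ.* u (l + i) n x) ℚ.* (1ℚ ℚ.- ρ i n x)))
    difference n x eq′ eq = begin
      m ℚ.* ((e ℚ.- cast (l + i)) ℚ.* w′ ℚ.- (e ℚ.- b) ℚ.* w)
        -- Both fractions are brought to the common denominator (N - i)(N - l - i).
        ≡⟨ cong₂ (λ s t → m ℚ.* (s ℚ.- t))
             (sym (trans (cong ((e ℚ.- cast (l + i)) ℚ.* w′ ℚ.*_) eq) (ℚ.*-identityʳ ((e ℚ.- cast (l + i)) ℚ.* w′))))
             (sym (trans (cong ((e ℚ.- b) ℚ.* w ℚ.*_) eq′) (ℚ.*-identityʳ ((e ℚ.- b) ℚ.* w)))) ⟩
      m ℚ.* ((e ℚ.- cast (l + i)) ℚ.* w′ ℚ.* ((m ℚ.- b) ℚ.* w) ℚ.-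
             (e ℚ.- b) ℚ.* w ℚ.* ((m ℚ.- cast (l + i)) ℚ.* w′))
        ≡⟨ cong (λ c → m ℚ.* ((e ℚ.- c) ℚ.* w′ ℚ.* ((m ℚ.- b) ℚ.* w) ℚ.- (e ℚ.- b) ℚ.* w ℚ.* ((m ℚ.- c) ℚ.* w′)))
             (cast-+ l i) ⟩
      m ℚ.* ((e ℚ.- (a ℚ.+ b)) ℚ.* w′ ℚ.* ((m ℚ.- b) ℚ.* w) ℚ.- (e ℚ.- b) ℚ.* w ℚ.* ((m ℚ.- (a ℚ.+ b)) ℚ.* w′))
        ≡⟨ solve 6 (λ m e a b w w′ →
             m :* ((e :- (a :+ b)) :* w′ :* ((m :- b) :* w) :- (e :- b) :* w :* ((m :- (a :+ b)) :* w′))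
             := :- (a :* ((m :* w′) :* ((m :- b) :* w :- (e :- b) :* w)))) refl m e a b w w′ ⟩
      ℚ.- (a ℚ.* ((m ℚ.* w′) ℚ.* ((m ℚ.- b) ℚ.* w ℚ.- (e ℚ.- b) ℚ.* w)))
        ≡⟨ cong (λ t → ℚ.- (a ℚ.* ((m ℚ.* w′) ℚ.* (t ℚ.- ρ i n x)))) eq ⟩
      ℚ.- (a ℚ.* ((m ℚ.* w′) ℚ.* (1ℚ ℚ.- ρ i n x))) ∎
      where
      m e a b w w′ : ℚ
      m = N n
      e = cast (E n)
      a = cast l
      b = cast i
      w = u i n x
      w′ = u (l + i) n x

  -- The derivative of x^m, defined by the product rule so that it follows the recursion of `Π`.
  dpow : ℕ → ℚ → ℚ
  dpow zero    x = 0ℚ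
  dpow (suc m) x = dpow m x ℚ.* x ℚ.+ x ^ℚ m

  dpow-suc : ∀ m x → dpow (suc m) x ≡ cast (suc m) ℚ.* x ^ℚ m
  dpow-suc zero    x = solve 1 (λ x → con 0ℚ :* x :+ con 1ℚ := con 1ℚ :* con 1ℚ) refl x
    where open ℚ.+-*-Solver
  dpow-suc (suc m) x = trans (cong (λ t → t ℚ.* x ℚ.+ x ^ℚ suc m) (dpow-suc m x)) (trans
    (solve 3 (λ c x y → c :* y :* x :+ x :* y := (con 1ℚ :+ c) :* (x :* y)) refl (cast (suc m)) x (x ^ℚ m))
    (cong (ℚ._* x ^ℚ suc m) (sym (cast-+ 1 (suc m)))))
    where open ℚ.+-*-Solver

  -- A shift by l changes every factor by about -l (1 - x)/N, so by the product rule the product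
  -- changes by this times the derivative of x^m.
  Π-shift : ∀ l m → (λ n x → N n ℚ.* (Π l m n x ℚ.- Π 0 m n x)) ≈
                     (λ n x → ℚ.- (cast l ℚ.* (1ℚ ℚ.- x)) ℚ.* dpow m x)
  Π-shift l zero = ≈-cong 0
    (λ n x _ _ → sym (trans (cong (N n ℚ.*_) (ℚ.+-inverseʳ 1ℚ)) (ℚ.*-zeroʳ (N n))))
    (λ n x → sym (ℚ.*-zeroʳ (ℚ.- (cast l ℚ.* (1ℚ ℚ.- x))))) (≈-refl (≪-const 0ℚ))
  Π-shift l (suc m) = ≈-cong 0
    (λ n x _ _ → solve 5 (λ m a b r s → m :* (a :- b) :* r :+ b :* (m :* (r :- s)) := m :* (a :* r :- b :* s)) refl
      (N n) (Π l m n x) (Π 0 m n x) (ρ (l + m) n x) (ρ m n x))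
    (λ n x → solve 4 (λ c g x y → c :* g :* x :+ y :* c := c :* (g :* x :+ y)) refl
      (ℚ.- (cast l ℚ.* (1ℚ ℚ.- x))) (dpow m x) x (x ^ℚ m))
    (≈-+ (≈-* (Π-shift l m) (ρ≈x (l + m))) (≈-* (Π≈x^ 0 m) (ρ-shift l m)))
    where open ℚ.+-*-Solver

  -- The covariance of the indicators of two copies of H with k common edges.
  covariance : ℕ → ℕ → ℕ → ℚ → ℚ
  covariance ℓ k n x = Π 0 (2 * ℓ ∸ k) n x ℚ.- Π 0 ℓ n x ℚ.* Π 0 ℓ n x

  -- For ℓ ≥ 1 this is x^(2ℓ-1) - x^(2ℓ), the leading term of the covariance for one common edge.
  λ₁ : ℕ → ℚ → ℚ
  λ₁ ℓ x = x ^ℚ (2 * ℓ ∸ 1) ℚ.* (1ℚ ℚ.- x)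

  -- The leading terms x^(2ℓ) cancel, so the next order is needed. With P(E, N, 2ℓ) = `Π 0 ℓ` ·
  -- `Π ℓ ℓ`, the covariance is `Π 0 ℓ` (`Π ℓ ℓ` - `Π 0 ℓ`), to which `Π-shift` applies.
  N*covariance₀ : ∀ ℓ-1 → let ℓ = suc ℓ-1 in
    (λ n x → N n ℚ.* covariance ℓ 0 n x) ≈ (λ n x → ℚ.- (cast ℓ ℚ.* cast ℓ ℚ.* λ₁ ℓ x))
  N*covariance₀ ℓ-1 = ≈-cong 0
    (λ n x _ _ → trans
      (solve 3 (λ m a b → a :* (m :* (b :- a)) := m :* (a :* b :- a :* a)) refl (N n) (Π 0 ℓ n x) (Π ℓ ℓ n x))
      (cong (λ t → N n ℚ.* (t ℚ.- Π 0 ℓ n x ℚ.* Π 0 ℓ n x))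
        (trans (sym (Π-+ ℓ ℓ n x)) (cong (λ k → Π 0 k n x) (cong (λ j → ℓ + j) (sym (ℕ.+-identityʳ ℓ)))))))
    (λ n x → trans (cong (λ t → x ^ℚ ℓ ℚ.* (ℚ.- (cast ℓ ℚ.* (1ℚ ℚ.- x)) ℚ.* t)) (dpow-suc ℓ-1 x)) (trans
      (solve 4 (λ c x y z → y :* ((:- (c :* (con 1ℚ :- x))) :* (c :* z)) := :- (c :* c :* ((z :* y) :* (con 1ℚ :- x)))) refl
        (cast ℓ) x (x ^ℚ ℓ) (x ^ℚ ℓ-1))
      (cong (λ t → ℚ.- (cast ℓ ℚ.* cast ℓ ℚ.* (t ℚ.* (1ℚ ℚ.- x))))
        (trans (sym (^ℚ-+ x ℓ-1 ℓ)) (cong (λ k → x ^ℚ (ℓ-1 + k)) (sym (ℕ.+-identityʳ ℓ)))))))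
    (≈-* (Π≈x^ 0 ℓ) (Π-shift ℓ ℓ))
    where
    open ℚ.+-*-Solver
    ℓ : ℕ
    ℓ = suc ℓ-1

  covariance≈ : ∀ ℓ k → covariance ℓ k ≈ (λ n x → x ^ℚ (2 * ℓ ∸ k) ℚ.- x ^ℚ (2 * ℓ))
  covariance≈ ℓ k = ≈-cong 0 (λ _ _ _ _ → refl)
    (λ n x → cong (λ t → x ^ℚ (2 * ℓ ∸ k) ℚ.- t)
      (trans (sym (^ℚ-+ x ℓ ℓ)) (cong (λ j → x ^ℚ (ℓ + j)) (sym (ℕ.+-identityʳ ℓ)))))
    (≈-- (Π≈x^ 0 (2 * ℓ ∸ k)) (≈-* (Π≈x^ 0 ℓ) (Π≈x^ 0 ℓ)))

-- The moments as exact expressions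

sumℚ-cast : ∀ {A : Set} (xs : List A) (f : A → ℕ) → sumℚ (map (cast ∘ f) xs) ≡ cast (∑ xs f)
sumℚ-cast []       f = refl
sumℚ-cast (x ∷ xs) f = trans (cong (cast (f x) ℚ.+_) (sumℚ-cast xs f)) (sym (cast-+ (f x) (∑ xs f)))

sumℚ-cong-∈ : ∀ {A : Set} (xs : List A) {f g : A → ℚ} → (∀ {x} → x ∈ˡ xs → f x ≡ g x) →
              sumℚ (map f xs) ≡ sumℚ (map g xs)
sumℚ-cong-∈ []       eq = refl
sumℚ-cong-∈ (x ∷ xs) eq = cong₂ ℚ._+_ (eq (here refl)) (sumℚ-cong-∈ xs (eq ∘ there))

sumℚ-*ʳ : ∀ {A : Set} (xs : List A) (f : A → ℚ) r → sumℚ (map (λ x → f x ℚ.* r) xs) ≡ sumℚ (map f xs) ℚ.* r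
sumℚ-*ʳ []       f r = sym (ℚ.*-zeroˡ r)
sumℚ-*ʳ (x ∷ xs) f r = trans (cong (f x ℚ.* r ℚ.+_) (sumℚ-*ʳ xs f r)) (sym (ℚ.*-distribʳ-+ r (f x) _))

sumℚ-const : ∀ {A : Set} (xs : List A) r → sumℚ (map (λ _ → r) xs) ≡ cast (length xs) ℚ.* r
sumℚ-const []       r = sym (ℚ.*-zeroˡ r)
sumℚ-const (x ∷ xs) r = trans (cong (r ℚ.+_) (sumℚ-const xs r)) (trans
  (solve 2 (λ r l → r :+ l :* r := (con 1ℚ :+ l) :* r) refl r (cast (length xs)))
  (cong (ℚ._* r) (sym (cast-+ 1 (length xs)))))
  where open ℚ.+-*-Solver using (solve; _:=_; _:+_; _:*_; con)

sumℚ-deviations : ∀ {A : Set} (xs : List A) (X : A → ℚ) μ →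
  sumℚ (map (λ g → (X g ℚ.- μ) ℚ.* (X g ℚ.- μ)) xs) ≡
  sumℚ (map (λ g → X g ℚ.* X g) xs) ℚ.- (μ ℚ.+ μ) ℚ.* sumℚ (map X xs) ℚ.+ cast (length xs) ℚ.* (μ ℚ.* μ)
sumℚ-deviations []       X μ = solve 1 (λ μ → con 0ℚ := con 0ℚ :- (μ :+ μ) :* con 0ℚ :+ con 0ℚ :* (μ :* μ)) refl μ
  where open ℚ.+-*-Solver using (solve; _:=_; _:+_; _:-_; _:*_; con)
sumℚ-deviations (x ∷ xs) X μ = trans
  (cong ((X x ℚ.- μ) ℚ.* (X x ℚ.- μ) ℚ.+_) (sumℚ-deviations xs X μ)) (trans
  (solve 5 (λ x μ a b l → (x :- μ) :* (x :- μ) :+ (a :- (μ :+ μ) :* b :+ l :* (μ :* μ))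
     := (x :* x :+ a) :- (μ :+ μ) :* (x :+ b) :+ (con 1ℚ :+ l) :* (μ :* μ)) refl
     (X x) μ (sumℚ (map (λ g → X g ℚ.* X g) xs)) (sumℚ (map X xs)) (cast (length xs)))
  (cong (λ l → (X x ℚ.* X x ℚ.+ sumℚ (map (λ g → X g ℚ.* X g) xs)) ℚ.-
               (μ ℚ.+ μ) ℚ.* (X x ℚ.+ sumℚ (map X xs)) ℚ.+ l ℚ.* (μ ℚ.* μ)) (sym (cast-+ 1 (length xs)))))
  where open ℚ.+-*-Solver using (solve; _:=_; _:+_; _:-_; _:*_; con)

∑< : ℕ → (ℕ → ℚ) → ℚ
∑< zero    f = 0ℚ
∑< (suc K) f = ∑< K f ℚ.+ f K

∑<-cong : ∀ K {f g} → (∀ k → f k ≡ g k) → ∑< K f ≡ ∑< K g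
∑<-cong zero    eq = refl
∑<-cong (suc K) eq = cong₂ ℚ._+_ (∑<-cong K eq) (eq K)

∑<-+ : ∀ K f g → ∑< K (λ k → f k ℚ.+ g k) ≡ ∑< K f ℚ.+ ∑< K g
∑<-+ zero    f g = refl
∑<-+ (suc K) f g = trans (cong (ℚ._+ (f K ℚ.+ g K)) (∑<-+ K f g))
  (solve 4 (λ a b c d → (a :+ b) :+ (c :+ d) := (a :+ c) :+ (b :+ d)) refl (∑< K f) (∑< K g) (f K) (g K))
  where open ℚ.+-*-Solver using (solve; _:=_; _:+_)

∑<-*ˡ : ∀ K r f → ∑< K (λ k → r ℚ.* f k) ≡ r ℚ.* ∑< K f
∑<-*ˡ zero    r f = sym (ℚ.*-zeroʳ r)
∑<-*ˡ (suc K) r f = trans (cong (ℚ._+ r ℚ.* f K) (∑<-*ˡ K r f)) (sym (ℚ.*-distribˡ-+ r (∑< K f) (f K)))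

∑<-⟦⟧ : ∀ K k₀ (φ : ℕ → ℚ) → k₀ < K → ∑< K (λ k → cast ⟦ k₀ ℕ.≟ k ⟧ ℚ.* φ k) ≡ φ k₀
∑<-⟦⟧ (suc K) k₀ φ k₀<1+K with ℕ.m≤n⇒m<n∨m≡n (ℕ.≤-pred k₀<1+K)
... | inj₁ k₀<K = trans
  (cong₂ (λ s t → s ℚ.+ cast t ℚ.* φ K) (∑<-⟦⟧ K k₀ φ k₀<K) (⟦⟧-no (k₀ ℕ.≟ K) (ℕ.<⇒≢ k₀<K)))
  (trans (cong (φ k₀ ℚ.+_) (ℚ.*-zeroˡ (φ K))) (ℚ.+-identityʳ (φ k₀)))
... | inj₂ refl = trans
  (cong₂ (λ s t → s ℚ.+ cast t ℚ.* φ K) (earlier K ℕ.≤-refl) (⟦⟧-yes (k₀ ℕ.≟ k₀) refl))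
  (trans (cong (0ℚ ℚ.+_) (ℚ.*-identityˡ (φ K))) (ℚ.+-identityˡ (φ K)))
  where
  earlier : ∀ J → J ≤ k₀ → ∑< J (λ k → cast ⟦ k₀ ℕ.≟ k ⟧ ℚ.* φ k) ≡ 0ℚ
  earlier zero    _    = refl
  earlier (suc J) J<k₀ = trans
    (cong₂ (λ s t → s ℚ.+ cast t ℚ.* φ J) (earlier J (ℕ.<⇒≤ J<k₀)) (⟦⟧-no (k₀ ℕ.≟ J) (ℕ.<⇒≢ J<k₀ ∘ sym)))
    (trans (cong (0ℚ ℚ.+_) (ℚ.*-zeroˡ (φ J))) refl)

-- Collecting the terms by the value of `κ` turns sums over pairs of copies into sums over k
-- weighted by C_k.
sumℚ-by-value : ∀ {A : Set} (xs : List A) (κ : A → ℕ) K → (∀ {x} → x ∈ˡ xs → κ x < K) → ∀ (φ : ℕ → ℚ) →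
  sumℚ (map (φ ∘ κ) xs) ≡ ∑< K (λ k → cast (length (filter (λ x → κ x ℕ.≟ k) xs)) ℚ.* φ k)
sumℚ-by-value []       κ K κ< φ = sym (trans (∑<-cong K (λ k → ℚ.*-zeroˡ (φ k))) (vanish K))
  where
  vanish : ∀ K → ∑< K (λ _ → 0ℚ) ≡ 0ℚ
  vanish zero    = refl
  vanish (suc K) = trans (ℚ.+-identityʳ (∑< K (λ _ → 0ℚ))) (vanish K)
sumℚ-by-value (x ∷ xs) κ K κ< φ = begin
  φ (κ x) ℚ.+ sumℚ (map (φ ∘ κ) xs)
    ≡⟨ cong₂ ℚ._+_ (sym (∑<-⟦⟧ K (κ x) φ (κ< (here refl)))) (sumℚ-by-value xs κ K (κ< ∘ there) φ) ⟩
  ∑< K (λ k → cast ⟦ κ x ℕ.≟ k ⟧ ℚ.* φ k) ℚ.+ ∑< K (λ k → cast (count k xs) ℚ.* φ k)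
    ≡⟨ ∑<-+ K _ _ ⟨
  ∑< K (λ k → cast ⟦ κ x ℕ.≟ k ⟧ ℚ.* φ k ℚ.+ cast (count k xs) ℚ.* φ k)
    ≡⟨ ∑<-cong K (λ k → trans (sym (ℚ.*-distribʳ-+ (φ k) (cast ⟦ κ x ℕ.≟ k ⟧) (cast (count k xs))))
         (cong (ℚ._* φ k) (trans (sym (cast-+ ⟦ κ x ℕ.≟ k ⟧ (count k xs))) (cong cast (sym (count-∷ k)))))) ⟩
  ∑< K (λ k → cast (count k (x ∷ xs)) ℚ.* φ k) ∎
  where
  open ≡-Reasoning
  count : ℕ → List _ → ℕ
  count k xs = length (filter (λ x → κ x ℕ.≟ k) xs)
  count-∷ : ∀ k → count k (x ∷ xs) ≡ ⟦ κ x ℕ.≟ k ⟧ + count k xs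
  count-∷ k = trans (length-filter≡∑ (λ x → κ x ℕ.≟ k) (x ∷ xs))
    (cong (⟦ κ x ℕ.≟ k ⟧ +_) (sym (length-filter≡∑ (λ x → κ x ℕ.≟ k) xs)))

length-cartesianProduct : ∀ {A B : Set} (xs : List A) (ys : List B) →
                          length (cartesianProduct xs ys) ≡ length xs * length ys
length-cartesianProduct xs ys = begin
  length (cartesianProduct xs ys)    ≡⟨ length≡∑ (cartesianProduct xs ys) ⟩
  ∑[ _ ← cartesianProduct xs ys ] 1  ≡⟨ ∑-prod xs ys (λ _ → 1) ⟩
  ∑[ _ ← xs ] ∑[ _ ← ys ] 1          ≡⟨ ∑-cong xs (λ _ → sym (length≡∑ ys)) ⟩
  ∑[ _ ← xs ] length ys              ≡⟨ ∑-const xs (length ys) ⟩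
  length xs * length ys              ∎
  where open ≡-Reasoning

c≡∣Kn-copies∣ : ∀ v H n → c v H n ≡ cast (length (Copies.Kn-copies v H n))
c≡∣Kn-copies∣ v H n = sym (ratio-unique (symmetries>0 v H)
  (trans (sym (cast-* (symmetries v H) (length Kn-copies))) (cong cast Kn-copies-count)))
  where open Copies v H n

module Probability (v : ℕ) (H : Graph v) (n E : ℕ) (E≤N : E ≤ n C 2) (ℓ≤N : ∣ H ∣ ≤ n C 2) where

  open Copies v H n
  open SharedEdges v H n
  open Moments v H n

  private
    w : ℚ
    w = ratio 1 (length (Ω n E))
    ℓ : ℕ
    ℓ = ∣ H ∣
    X : Graph n → ℕ
    X g = length (copies v n H g)
    Kn² : List (Subgraph n × Subgraph n)
    Kn² = cartesianProduct Kn-copies Kn-copies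
    shared : Subgraph n × Subgraph n → ℕ
    shared (S , S′) = ∣ edges n S ∩ edges n S′ ∣

  ∣Ω∣>0 : 0 < length (Ω n E)
  ∣Ω∣>0 = subst (0 <_) (sym (length-Ω n E)) (C>0 (subst (E ≤_) (sym (length-pairs n)) E≤N))

  ∣Ω∣w≡1 : cast (length (Ω n E)) ℚ.* w ≡ 1ℚ
  ∣Ω∣w≡1 = cast*ratio 1 (length (Ω n E)) ∣Ω∣>0

  containing-Pr : ∀ F → cast (containing E F) ℚ.* w ≡ Pr E (n C 2) ∣ F ∣
  containing-Pr F = ratio-unique (P>0 (subst (∣ F ∣ ≤_) (length-pairs n) (Subset.∣p∣≤n F))) (begin
    cast (n C 2 P ∣ F ∣) ℚ.* (cast (containing E F) ℚ.* w)
      ≡⟨ ℚ.*-assoc (cast (n C 2 P ∣ F ∣)) (cast (containing E F)) w ⟨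
    cast (n C 2 P ∣ F ∣) ℚ.* cast (containing E F) ℚ.* w
      ≡⟨ cong (ℚ._* w) (trans (sym (cast-* (n C 2 P ∣ F ∣) (containing E F))) (trans
           (cong cast (trans (cong (λ M → (M P ∣ F ∣) * containing E F) (sym (length-pairs n))) (Ω-containing n E F)))
           (cast-* (length (Ω n E)) (E P ∣ F ∣)))) ⟩
    cast (length (Ω n E)) ℚ.* cast (E P ∣ F ∣) ℚ.* w
      ≡⟨ solve 3 (λ a b c → a :* b :* c := a :* c :* b) refl (cast (length (Ω n E))) (cast (E P ∣ F ∣)) w ⟩
    cast (length (Ω n E)) ℚ.* w ℚ.* cast (E P ∣ F ∣)
      ≡⟨ trans (cong (ℚ._* cast (E P ∣ F ∣)) ∣Ω∣w≡1) (ℚ.*-identityˡ (cast (E P ∣ F ∣))) ⟩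
    cast (E P ∣ F ∣) ∎)
    where
    open ≡-Reasoning
    open ℚ.+-*-Solver using (solve; _:=_; _:*_)

  ∑-containing : ∀ {A : Set} (xs : List A) (F : A → Graph n) →
    cast (∑ xs (containing E ∘ F)) ℚ.* w ≡ sumℚ (map (λ x → Pr E (n C 2) ∣ F x ∣) xs)
  ∑-containing xs F = begin
    cast (∑ xs (containing E ∘ F)) ℚ.* w                     ≡⟨ cong (ℚ._* w) (sumℚ-cast xs (containing E ∘ F)) ⟨
    sumℚ (map (λ x → cast (containing E (F x))) xs) ℚ.* w    ≡⟨ sumℚ-*ʳ xs _ w ⟨
    sumℚ (map (λ x → cast (containing E (F x)) ℚ.* w) xs)    ≡⟨ sumℚ-cong-∈ xs (λ {x} _ → containing-Pr (F x)) ⟩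
    sumℚ (map (λ x → Pr E (n C 2) ∣ F x ∣) xs)               ∎
    where open ≡-Reasoning

  mean≡ : 𝔼 n E (T v n H) ≡ c v H n ℚ.* Pr E (n C 2) ℓ
  mean≡ = begin
    sumℚ (map (cast ∘ X) (Ω n E)) ℚ.* w
      ≡⟨ cong (ℚ._* w) (trans (sumℚ-cast (Ω n E) X) (cong cast (first-moment E))) ⟩
    cast (∑ Kn-copies (containing E ∘ edges n)) ℚ.* w
      ≡⟨ ∑-containing Kn-copies (edges n) ⟩
    sumℚ (map (λ S → Pr E (n C 2) ∣ edges n S ∣) Kn-copies)
      ≡⟨ sumℚ-cong-∈ Kn-copies (λ S∈ → cong (Pr E (n C 2)) (∣edges∣ S∈)) ⟩
    sumℚ (map (λ S → Pr E (n C 2) ℓ) Kn-copies)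
      ≡⟨ sumℚ-const Kn-copies (Pr E (n C 2) ℓ) ⟩
    cast (length Kn-copies) ℚ.* Pr E (n C 2) ℓ
      ≡⟨ cong (ℚ._* Pr E (n C 2) ℓ) (c≡∣Kn-copies∣ v H n) ⟨
    c v H n ℚ.* Pr E (n C 2) ℓ ∎
    where open ≡-Reasoning

  module _ (K : ℕ) (ℓ<K : ℓ < K) where

    private
      shared<K : ∀ {SS} → SS ∈ˡ Kn² → shared SS < K
      shared<K {S , S′} SS∈ = ℕ.≤-<-trans (Subset.∣p∩q∣≤∣p∣ (edges n S) (edges n S′))
        (subst (_< K) (sym (∣edges∣ (proj₁ (∈-cartesianProduct⁻ Kn-copies Kn-copies SS∈)))) ℓ<K)

    by-shared : ∀ (φ : ℕ → ℚ) → sumℚ (map (φ ∘ shared) Kn²) ≡ ∑< K (λ k → cast (Cpairs v H k n) ℚ.* φ k)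
    by-shared = sumℚ-by-value Kn² shared K shared<K

    ∑Cpairs : ∑< K (λ k → cast (Cpairs v H k n) ℚ.* 1ℚ) ≡ cast (length Kn-copies) ℚ.* cast (length Kn-copies)
    ∑Cpairs = begin
      ∑< K (λ k → cast (Cpairs v H k n) ℚ.* 1ℚ)
        ≡⟨ by-shared (λ _ → 1ℚ) ⟨
      sumℚ (map (λ _ → 1ℚ) Kn²)
        ≡⟨ trans (sumℚ-const Kn² 1ℚ) (ℚ.*-identityʳ (cast (length Kn²))) ⟩
      cast (length Kn²)
        ≡⟨ trans (cong cast (length-cartesianProduct Kn-copies Kn-copies))
                 (cast-* (length Kn-copies) (length Kn-copies)) ⟩
      cast (length Kn-copies) ℚ.* cast (length Kn-copies) ∎
      where open ≡-Reasoning

    -- The average number of common edges of two copies is ℓ²/N; ∑ C_k replaces c_n² so that both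
    -- sides are linear in the C_k.
    ∑k*Cpairs : cast (n C 2) ℚ.* ∑< K (λ k → cast (Cpairs v H k n) ℚ.* cast k) ≡
                cast ℓ ℚ.* cast ℓ ℚ.* ∑< K (λ k → cast (Cpairs v H k n) ℚ.* 1ℚ)
    ∑k*Cpairs = begin
      cast (n C 2) ℚ.* ∑< K (λ k → cast (Cpairs v H k n) ℚ.* cast k)
        ≡⟨ cong (cast (n C 2) ℚ.*_) (trans (sym (by-shared cast)) (trans (sumℚ-cast Kn² shared)
             (cong cast (∑-prod Kn-copies Kn-copies shared)))) ⟩
      cast (n C 2) ℚ.* cast (∑[ S ← Kn-copies ] ∑[ S′ ← Kn-copies ] ∣ edges n S ∩ edges n S′ ∣)
        ≡⟨ trans (sym (cast-* (n C 2) _)) (trans (cong cast mean-shared-edges)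
             (trans (cast-* (ℓ * length Kn-copies) (ℓ * length Kn-copies))
               (cong₂ ℚ._*_ (cast-* ℓ (length Kn-copies)) (cast-* ℓ (length Kn-copies))))) ⟩
      (cast ℓ ℚ.* cast (length Kn-copies)) ℚ.* (cast ℓ ℚ.* cast (length Kn-copies))
        ≡⟨ solve 2 (λ a b → (a :* b) :* (a :* b) := a :* a :* (b :* b)) refl (cast ℓ) (cast (length Kn-copies)) ⟩
      cast ℓ ℚ.* cast ℓ ℚ.* (cast (length Kn-copies) ℚ.* cast (length Kn-copies))
        ≡⟨ cong (cast ℓ ℚ.* cast ℓ ℚ.*_) ∑Cpairs ⟨
      cast ℓ ℚ.* cast ℓ ℚ.* ∑< K (λ k → cast (Cpairs v H k n) ℚ.* 1ℚ) ∎
      where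
      open ≡-Reasoning
      open ℚ.+-*-Solver using (solve; _:=_; _:*_)

    second-moment≡ : sumℚ (map (λ g → cast (X g) ℚ.* cast (X g)) (Ω n E)) ℚ.* w ≡
                     ∑< K (λ k → cast (Cpairs v H k n) ℚ.* Pr E (n C 2) (2 * ℓ ∸ k))
    second-moment≡ = begin
      sumℚ (map (λ g → cast (X g) ℚ.* cast (X g)) (Ω n E)) ℚ.* w
        ≡⟨ cong (ℚ._* w) (trans (sumℚ-cong-∈ (Ω n E) (λ {g} _ → sym (cast-* (X g) (X g)))) (trans
             (sumℚ-cast (Ω n E) (λ g → X g * X g)) (cong cast (trans (second-moment E)
               (sym (∑-prod Kn-copies Kn-copies (λ (S , S′) → containing E (edges n S ∪ edges n S′)))))))) ⟩
      cast (∑ Kn² (λ (S , S′) → containing E (edges n S ∪ edges n S′))) ℚ.* w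
        ≡⟨ ∑-containing Kn² (λ (S , S′) → edges n S ∪ edges n S′) ⟩
      sumℚ (map (λ (S , S′) → Pr E (n C 2) ∣ edges n S ∪ edges n S′ ∣) Kn²)
        ≡⟨ sumℚ-cong-∈ Kn² (λ SS∈ → let S∈ , S′∈ = ∈-cartesianProduct⁻ Kn-copies Kn-copies SS∈ in
             cong (Pr E (n C 2)) (∣edges∪edges∣ S∈ S′∈)) ⟩
      sumℚ (map ((λ k → Pr E (n C 2) (2 * ℓ ∸ k)) ∘ shared) Kn²)
        ≡⟨ by-shared (λ k → Pr E (n C 2) (2 * ℓ ∸ k)) ⟩
      ∑< K (λ k → cast (Cpairs v H k n) ℚ.* Pr E (n C 2) (2 * ℓ ∸ k)) ∎
      where open ≡-Reasoning

    -- The square of the mean is c_n² P(E, N, ℓ)², and c_n² = ∑ C_k distributes it over the terms of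
    -- the second moment.
    variance≡ : Var n E (T v n H) ≡ ∑< K (λ k → cast (Cpairs v H k n) ℚ.*
                  (Pr E (n C 2) (2 * ℓ ∸ k) ℚ.- Pr E (n C 2) ℓ ℚ.* Pr E (n C 2) ℓ))
    variance≡ = begin
      sumℚ (map (λ g → (cast (X g) ℚ.- μ) ℚ.* (cast (X g) ℚ.- μ)) (Ω n E)) ℚ.* w
        ≡⟨ cong (ℚ._* w) (sumℚ-deviations (Ω n E) (cast ∘ X) μ) ⟩
      (s₂ ℚ.- (μ ℚ.+ μ) ℚ.* s₁ ℚ.+ cast (length (Ω n E)) ℚ.* (μ ℚ.* μ)) ℚ.* w
        ≡⟨ solve 5 (λ a b l μ w → (a :- (μ :+ μ) :* b :+ l :* (μ :* μ)) :* w
                     := a :* w :- (μ :+ μ) :* (b :* w) :+ (l :* w) :* (μ :* μ)) refl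
             s₂ s₁ (cast (length (Ω n E))) μ w ⟩
      s₂ ℚ.* w ℚ.- (μ ℚ.+ μ) ℚ.* μ ℚ.+ (cast (length (Ω n E)) ℚ.* w) ℚ.* (μ ℚ.* μ)
        ≡⟨ cong (λ t → s₂ ℚ.* w ℚ.- (μ ℚ.+ μ) ℚ.* μ ℚ.+ t ℚ.* (μ ℚ.* μ)) ∣Ω∣w≡1 ⟩
      s₂ ℚ.* w ℚ.- (μ ℚ.+ μ) ℚ.* μ ℚ.+ 1ℚ ℚ.* (μ ℚ.* μ)
        ≡⟨ solve 2 (λ a μ → a :- (μ :+ μ) :* μ :+ con 1ℚ :* (μ :* μ) := a :+ (:- (μ :* μ))) refl (s₂ ℚ.* w) μ ⟩
      s₂ ℚ.* w ℚ.- μ ℚ.* μ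
        ≡⟨ cong₂ ℚ._-_ second-moment≡ (trans (cong (λ t → t ℚ.* t) (trans mean≡ (cong (ℚ._* π) (c≡∣Kn-copies∣ v H n))))
             (trans (solve 2 (λ l q → (l :* q) :* (l :* q) := (q :* q) :* (l :* l)) refl (cast (length Kn-copies)) π)
               (cong (π ℚ.* π ℚ.*_) (sym ∑Cpairs)))) ⟩
      ∑< K (λ k → Cₖ k ℚ.* Pr E (n C 2) (2 * ℓ ∸ k)) ℚ.- (π ℚ.* π) ℚ.* ∑< K (λ k → Cₖ k ℚ.* 1ℚ)
        ≡⟨ cong (∑< K (λ k → Cₖ k ℚ.* Pr E (n C 2) (2 * ℓ ∸ k)) ℚ.+_) (trans
             (ℚ.neg-distribˡ-* (π ℚ.* π) (∑< K (λ k → Cₖ k ℚ.* 1ℚ)))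
             (sym (∑<-*ˡ K (ℚ.- (π ℚ.* π)) (λ k → Cₖ k ℚ.* 1ℚ)))) ⟩
      ∑< K (λ k → Cₖ k ℚ.* Pr E (n C 2) (2 * ℓ ∸ k)) ℚ.+ ∑< K (λ k → ℚ.- (π ℚ.* π) ℚ.* (Cₖ k ℚ.* 1ℚ))
        ≡⟨ ∑<-+ K _ _ ⟨
      ∑< K (λ k → Cₖ k ℚ.* Pr E (n C 2) (2 * ℓ ∸ k) ℚ.+ ℚ.- (π ℚ.* π) ℚ.* (Cₖ k ℚ.* 1ℚ))
        ≡⟨ ∑<-cong K (λ k → solve 3 (λ c r q → c :* r :+ (:- q) :* (c :* con 1ℚ) := c :* (r :- q)) refl
             (Cₖ k) (Pr E (n C 2) (2 * ℓ ∸ k)) (π ℚ.* π)) ⟩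
      ∑< K (λ k → Cₖ k ℚ.* (Pr E (n C 2) (2 * ℓ ∸ k) ℚ.- π ℚ.* π)) ∎
      where
      open ≡-Reasoning
      open ℚ.+-*-Solver using (solve; _:=_; _:+_; _:-_; :-_; _:*_; con)
      μ s₁ s₂ π : ℚ
      μ = 𝔼 n E (T v n H)
      s₁ = sumℚ (map (cast ∘ X) (Ω n E))
      s₂ = sumℚ (map (λ g → cast (X g) ℚ.* cast (X g)) (Ω n E))
      π = Pr E (n C 2) ℓ
      Cₖ : ℕ → ℚ
      Cₖ k = cast (Cpairs v H k n)

-- Asymptotics of the moments

∣H∣≤vC2 : ∀ v (H : Graph v) → ∣ H ∣ ≤ v C 2
∣H∣≤vC2 v H = subst (∣ H ∣ ≤_) (length-pairs v) (Subset.∣p∣≤n H)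

C2-mono : ∀ {m n} → m ≤ n → m C 2 ≤ n C 2
C2-mono {m} {zero}  z≤n = ℕ.≤-refl
C2-mono {m} {suc n} m≤1+n with ℕ.m≤n⇒m<n∨m≡n m≤1+n
... | inj₂ refl = ℕ.≤-refl
... | inj₁ m<1+n = ℕ.≤-trans (C2-mono (ℕ.≤-pred m<1+n)) (ℕ.≤-trans (ℕ.m≤n+m (n C 2) (n C 1))
  (ℕ.≤-reflexive (nCk+nC[k+1]≡[n+1]C[k+1] n 1)))

-- Here t is 2ℓ, left variable so that it can be replaced by 4 + m. The numerals are casts because
-- the real terms of the theorem have these rational entries.
C₂-target C₃-target : ℕ → ℚ → ℚ
C₂-target t x = x ^ℚ (t ∸ 2) ℚ.* (cast 1 ℚ.- x) ^ℚ 2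
C₃-target t x = x ^ℚ (t ∸ 3) ℚ.* (cast 1 ℚ.- cast 3 ℚ.* x ^ℚ 2 ℚ.+ cast 2 ℚ.* x ^ℚ 3)

module Assembly (v : ℕ) (2≤v : 2 ≤ v) (H : Graph v) (1<ℓ : 1 < ∣ H ∣)
                (E : ℕ → ℕ) (E≤N : ∀ n → E n ≤ n C 2) (B : ℕ) where

  open Asymptotics E B
  open Products E B

  -- The exponent of the final error. The other exponents are written as sums with `W`, which keeps
  -- truncated subtraction out of the estimates.
  W : ℕ
  W = 2 * v ∸ 4

  shares : ℕ → ℕ → ℚ → ℚ
  shares k n x = cast (Cpairs v H k n)

  v+v≡4+W : v + v ≡ 4 + W
  v+v≡4+W = trans (cong (v +_) (sym (ℕ.+-identityʳ v))) (sym (ℕ.m+[n∸m]≡n (ℕ.*-monoʳ-≤ 2 2≤v)))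

  v≡2+ : v ≡ 2 + (v ∸ 2)
  v≡2+ = sym (ℕ.m+[n∸m]≡n 2≤v)

  ℓ≤nC2 : ∀ n → v ≤ n → ∣ H ∣ ≤ n C 2
  ℓ≤nC2 n v≤n = ℕ.≤-trans (∣H∣≤vC2 v H) (C2-mono v≤n)

  shares-≪ : ∀ k t e → t + e ≡ v + v →
    (∀ n f g → Inj f → Inj g → ∣ Copies.imageEdges v H n f ∩ Copies.imageEdges v H n g ∣ ≡ k →
      t ≤ SharedEdges.common v H n f g) →
    shares k ≪ (λ n → n ^ e)
  shares-≪ k t e eq sharing = ≪-intro (suc v ^ v) 1 λ { n@(suc _) x _ _ →
    ℚ.≤-trans (ℚ.≤-reflexive (∣cast∣ (Cpairs v H k n))) (cast-mono {Cpairs v H k n} {suc v ^ v * n ^ e}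
      (ℕ.*-cancelʳ-≤ _ _ (n ^ t) {{ℕ.m^n≢0 n t}} (ℕ.≤-trans
        (PairBounds.Cpairs≤ v H n k t (sharing n))
        (ℕ.≤-reflexive (trans (cong (λ j → suc v ^ v * n ^ j) (trans (sym eq) (ℕ.+-comm t e)))
          (trans (cong (suc v ^ v *_) (ℕ.^-distribˡ-+-* n e t)) (sym (ℕ.*-assoc (suc v ^ v) (n ^ e) (n ^ t)))))))))}

  shares₀-≪ : shares 0 ≪ (λ n → n ^ (4 + W))
  shares₀-≪ = shares-≪ 0 0 (4 + W) (sym v+v≡4+W) (λ _ _ _ _ _ _ → z≤n)

  shares₁-≪ : shares 1 ≪ (λ n → n ^ (2 + W))
  shares₁-≪ = shares-≪ 1 2 (2 + W) (sym v+v≡4+W)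
    (λ n f g p q eq → SharedEdges.common≥2 v H n f g p q (ℕ.≤-reflexive (sym eq)))

  shares₂-≪ : shares 2 ≪ (λ n → n ^ (1 + W))
  shares₂-≪ = shares-≪ 2 3 (1 + W) (sym v+v≡4+W)
    (λ n f g p q eq → SharedEdges.common≥3 v H n f g p q (ℕ.≤-reflexive (sym eq)))

  -- Three common edges may form a triangle, so they force no more vertices than two do. That is why
  -- C_3 enters the variance beside C_2.
  shares₃-≪ : shares 3 ≪ (λ n → n ^ (1 + W))
  shares₃-≪ = shares-≪ 3 3 (1 + W) (sym v+v≡4+W)
    (λ n f g p q eq → SharedEdges.common≥3 v H n f g p q (subst (2 ≤_) (sym eq) (s≤s (s≤s z≤n))))

  shares≥4-≪ : ∀ j → shares (4 + j) ≪ (λ n → n ^ W)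
  shares≥4-≪ j = shares-≪ (4 + j) 4 W (sym v+v≡4+W)
    (λ n f g p q eq → SharedEdges.common≥4 v H n f g p q (subst (4 ≤_) (sym eq) (ℕ.m≤m+n 4 j)))

  triangleFree⇒shares₃-≪ : TriangleFree v H → shares 3 ≪ (λ n → n ^ W)
  triangleFree⇒shares₃-≪ H-free = shares-≪ 3 4 W (sym v+v≡4+W)
    (λ n f g p q eq → SharedEdges.triangleFree⇒common≥4 v H n f g p q H-free (ℕ.≤-reflexive (sym eq)))

  λ₀ : ℚ → ℚ
  λ₀ = λ₁ ∣ H ∣

  target : ℕ → ℚ → ℚ
  target 2 x = C₂-target (2 * ∣ H ∣) x
  target 3 x = C₃-target (2 * ∣ H ∣) x
  target _ x = 0ℚ

  -- With this choice of λ₀ the terms of order N⁰ cancel in χ 0, and those of order N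
  -- cancel in χ 1, χ 2 and χ 3.
  χ : ℕ → ℕ → ℚ → ℚ
  χ k n x = N n ℚ.* (covariance ∣ H ∣ k n x ℚ.- λ₀ x ℚ.* cast k ℚ.- target k x) ℚ.+ cast ∣ H ∣ ℚ.* cast ∣ H ∣ ℚ.* λ₀ x

  λ₀-≪ : (λ n x → λ₀ x) ≪ one
  λ₀-≪ = ≪-*ᵇ (≪-^ (2 * ∣ H ∣ ∸ 1)) (≪-- (≪-const 1ℚ) ≪-id)

  ℓ²λ₀-≪ : (λ n x → cast ∣ H ∣ ℚ.* cast ∣ H ∣ ℚ.* λ₀ x) ≪ one
  ℓ²λ₀-≪ = ≪-*ᵇ (≪-const (cast ∣ H ∣ ℚ.* cast ∣ H ∣)) λ₀-≪

  C₂-target-≪ : (λ n x → C₂-target (2 * ∣ H ∣) x) ≪ one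
  C₂-target-≪ = ≪-*ᵇ (≪-^ (2 * ∣ H ∣ ∸ 2)) (≪-*ᵇ 1-x (≪-*ᵇ 1-x (≪-const 1ℚ)))
    where
    1-x : (λ n x → cast 1 ℚ.- x) ≪ one
    1-x = ≪-- (≪-const (cast 1)) ≪-id

  C₃-target-≪ : (λ n x → C₃-target (2 * ∣ H ∣) x) ≪ one
  C₃-target-≪ = ≪-*ᵇ (≪-^ (2 * ∣ H ∣ ∸ 3)) (≪-+ (≪-- (≪-const (cast 1)) (≪-*ᵇ (≪-const (cast 3)) (≪-^ 2)))
    (≪-*ᵇ (≪-const (cast 2)) (≪-^ 3)))

  target-≪ : ∀ k → (λ n x → target k x) ≪ one
  target-≪ 0 = ≪-const 0ℚ
  target-≪ 1 = ≪-const 0ℚ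
  target-≪ 2 = C₂-target-≪
  target-≪ 3 = C₃-target-≪
  target-≪ (suc (suc (suc (suc _)))) = ≪-const 0ℚ

  -- C_0 can be as large as n^(2v), so `χ 0` has to be O(1/N) and not merely bounded.
  Nχ₀-≪ : (λ n x → N n ℚ.* χ 0 n x) ≪ one
  Nχ₀-≪ with ∣ H ∣ in eq
  ... | suc ℓ-1 = ≪-≗
    (λ n x → cong (N n ℚ.*_) (solve 4 (λ m c l y → m :* c :- (:- (l :* l :* y)) :=
        m :* (c :- y :* con 0ℚ :- con 0ℚ) :+ l :* l :* y) refl
      (N n) (covariance (suc ℓ-1) 0 n x) (cast (suc ℓ-1)) (λ₁ (suc ℓ-1) x)))
    (N[a-b] (N*covariance₀ ℓ-1))
    where open ℚ.+-*-Solver using (solve; _:=_; _:+_; _:-_; :-_; _:*_; con)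

  -- With the exponent in the form 4 + m the powers with truncated exponents unfold, and the
  -- identities below become polynomial identities in x and y = x^m.
  2ℓ≡4+ : ∃[ m ] 2 * ∣ H ∣ ≡ 4 + m
  2ℓ≡4+ = 2 * ∣ H ∣ ∸ 4 , sym (ℕ.m+[n∸m]≡n (ℕ.*-monoʳ-≤ 2 1<ℓ))

  private
    -- For t = 2ℓ and `τ` the k-th target, the leading term of the bracket in `χ k`, with the
    -- covariance replaced by x^(2ℓ-k) - x^(2ℓ). It vanishes identically for k = 1, 2, 3.
    excess : ℕ → ℕ → (ℚ → ℚ) → ℚ → ℚ
    excess t k τ x = x ^ℚ (t ∸ k) ℚ.- x ^ℚ t ℚ.- x ^ℚ (t ∸ 1) ℚ.* (1ℚ ℚ.- x) ℚ.* cast k ℚ.- τ x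

  excess₁ : ∀ x → excess (2 * ∣ H ∣) 1 (target 1) x ≡ 0ℚ
  excess₁ x = subst (λ t → excess t 1 (target 1) x ≡ 0ℚ) (sym (proj₂ 2ℓ≡4+))
    (solve 2 (λ x y → x :* (x :* (x :* y)) :- x :* (x :* (x :* (x :* y)))
        :- x :* (x :* (x :* y)) :* (con 1ℚ :- x) :* con (cast 1) :- con 0ℚ := con 0ℚ) refl x (x ^ℚ proj₁ 2ℓ≡4+))
    where open ℚ.+-*-Solver using (solve; _:=_; _:+_; _:-_; _:*_; con)

  excess₂ : ∀ x → excess (2 * ∣ H ∣) 2 (C₂-target (2 * ∣ H ∣)) x ≡ 0ℚ
  excess₂ x = subst (λ t → excess t 2 (C₂-target t) x ≡ 0ℚ) (sym (proj₂ 2ℓ≡4+))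
    (solve 2 (λ x y → x :* (x :* y) :- x :* (x :* (x :* (x :* y)))
        :- x :* (x :* (x :* y)) :* (con 1ℚ :- x) :* con (cast 2)
        :- x :* (x :* y) :* ((con (cast 1) :- x) :* ((con (cast 1) :- x) :* con 1ℚ)) := con 0ℚ) refl x (x ^ℚ proj₁ 2ℓ≡4+))
    where open ℚ.+-*-Solver using (solve; _:=_; _:+_; _:-_; _:*_; con)

  excess₃ : ∀ x → excess (2 * ∣ H ∣) 3 (C₃-target (2 * ∣ H ∣)) x ≡ 0ℚ
  excess₃ x = subst (λ t → excess t 3 (C₃-target t) x ≡ 0ℚ) (sym (proj₂ 2ℓ≡4+))
    (solve 2 (λ x y → x :* y :- x :* (x :* (x :* (x :* y)))
        :- x :* (x :* (x :* y)) :* (con 1ℚ :- x) :* con (cast 3)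
        :- x :* y :* (con (cast 1) :- con (cast 3) :* (x :* (x :* con 1ℚ)) :+ con (cast 2) :* (x :* (x :* (x :* con 1ℚ))))
        := con 0ℚ) refl x (x ^ℚ proj₁ 2ℓ≡4+))
    where open ℚ.+-*-Solver using (solve; _:=_; _:+_; _:-_; _:*_; con)

  χ-≪ : ∀ k → (∀ x → excess (2 * ∣ H ∣) k (target k) x ≡ 0ℚ) → χ k ≪ one
  χ-≪ k excess≡0 = ≪-+ (≪-≗
    (λ n x → cong (N n ℚ.*_) (trans (cong (λ t → (covariance ∣ H ∣ k n x ℚ.- λ₀ x ℚ.* cast k ℚ.- target k x) ℚ.- t) (excess≡0 x))
      (ℚ.+-identityʳ (covariance ∣ H ∣ k n x ℚ.- λ₀ x ℚ.* cast k ℚ.- target k x))))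
    (N[a-b] (≈-- (≈-- (covariance≈ ∣ H ∣ k) (≈-refl (≪-*ᵇ λ₀-≪ (≪-const (cast k))))) (≈-refl (target-≪ k))))) ℓ²λ₀-≪

  -- No cancellation is sought for k ≥ 4: the loss of a factor N = O(n²) is offset by C_k =
  -- O(n^(2v-4)).
  χ≥4-≪ : ∀ k → χ k ≪ (λ n → n * n * 1)
  χ≥4-≪ k = ≪-+ (≪-N (≪-- (≪-- (≈⇒≪ (covariance≈ ∣ H ∣ k)) (≪-*ᵇ λ₀-≪ (≪-const (cast k)))) (target-≪ k)))
    (≪-mono 1 1 (λ { (suc n) _ → s≤s z≤n }) ℓ²λ₀-≪)

  private
    n²* : ∀ n e → n ^ (2 + e) ≡ n * n * n ^ e
    n²* n e = sym (ℕ.*-assoc n n (n ^ e))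

  -- The common order is n^(2v-2), from which division by N leaves n^(2v-4). It arises as n^(2v) ·
  -- n^(-2) for k = 0, as n^(2v-2) · 1 for k = 1, and as n^(2v-4) · n² for k ≥ 4; for k = 2 and 3 a
  -- factor n is to spare.
  shares*χ-≪ : ∀ k → (λ n x → shares k n x ℚ.* χ k n x) ≪ (λ n → n ^ (2 + W))
  shares*χ-≪ 0 = ≪-N⁻¹ (≪-weight (λ n → n²* n (2 + W)) (≪-≗
    (λ n x → solve 3 (λ s m y → s :* (m :* y) := m :* (s :* y)) refl (shares 0 n x) (N n) (χ 0 n x))
    (≪-*ᵇ shares₀-≪ Nχ₀-≪)))
    where open ℚ.+-*-Solver using (solve; _:=_; _:*_)
  shares*χ-≪ 1 = ≪-*ᵇ shares₁-≪ (χ-≪ 1 excess₁)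
  shares*χ-≪ 2 = ≪-mono 1 1 (λ { n@(suc _) _ → ℕ.≤-trans (ℕ.m≤n*m (n ^ (1 + W)) n) (ℕ.m≤n*m _ 1) })
    (≪-*ᵇ shares₂-≪ (χ-≪ 2 excess₂))
  shares*χ-≪ 3 = ≪-mono 1 1 (λ { n@(suc _) _ → ℕ.≤-trans (ℕ.m≤n*m (n ^ (1 + W)) n) (ℕ.m≤n*m _ 1) })
    (≪-*ᵇ shares₃-≪ (χ-≪ 3 excess₃))
  shares*χ-≪ k@(suc (suc (suc (suc j)))) = ≪-weight
    (λ n → trans (cong (n ^ W *_) (ℕ.*-identityʳ (n * n))) (trans (ℕ.*-comm (n ^ W) (n * n)) (sym (n²* n W))))
    (≪-* (shares≥4-≪ j) (χ≥4-≪ k))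

  ≪-∑< : ∀ K {f : ℕ → ℕ → ℚ → ℚ} {g} → (∀ k → f k ≪ g) → (λ n x → ∑< K (λ k → f k n x)) ≪ g
  ≪-∑< zero    f≪ = ≪-intro 0 0 λ n x _ _ → ℚ.≤-refl
  ≪-∑< (suc K) f≪ = ≪-+ (≪-∑< K f≪) (f≪ K)

  leading : ℕ → ℚ → ℚ
  leading n x = shares 2 n x ℚ.* target 2 x ℚ.+ shares 3 n x ℚ.* target 3 x

  -- The range always reaches k = 3, even for ℓ = 2, where C_3 = 0.
  ∑-target : ∀ j n x → ∑< (4 + j) (λ k → shares k n x ℚ.* target k x) ≡ leading n x
  ∑-target zero n x = solve 4 (λ a b c d → con 0ℚ :+ a :* con 0ℚ :+ b :* con 0ℚ :+ c :+ d := c :+ d) refl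
    (shares 0 n x) (shares 1 n x) (shares 2 n x ℚ.* target 2 x) (shares 3 n x ℚ.* target 3 x)
    where open ℚ.+-*-Solver using (solve; _:=_; _:+_; _:*_; con)
  ∑-target (suc j) n x = trans (cong₂ ℚ._+_ (∑-target j n x) (ℚ.*-zeroʳ (shares (4 + j) n x))) (ℚ.+-identityʳ _)

  -- The threshold yields n ≥ v and N ≥ 2ℓ, so that every P(E, N, m) that occurs has m ≤ N and
  -- equals the product `Π 0 m`.
  variance-covariance : ∀ n x → v + suc (2 * ∣ H ∣) ≤ n →
    Var n (E n) (T v n H) ≡ ∑< (4 + ∣ H ∣) (λ k → shares k n x ℚ.* covariance ∣ H ∣ k n x)
  variance-covariance n x n≥ = trans
    (Probability.variance≡ v H n (E n) (E≤N n) (ℓ≤nC2 n (ℕ.m+n≤o⇒m≤o v n≥)) (4 + ∣ H ∣) (ℕ.m≤n+m (suc ∣ H ∣) 3))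
    (∑<-cong (4 + ∣ H ∣) (λ k → cong (shares k n x ℚ.*_) (cong₂ ℚ._-_
      (Pr≡Π (2 * ∣ H ∣ ∸ k) n x (ℕ.≤-trans (ℕ.m∸n≤m (2 * ∣ H ∣) k) 2ℓ≤N))
      (cong₂ ℚ._*_ (Pr≡Π ∣ H ∣ n x ℓ≤N) (Pr≡Π ∣ H ∣ n x ℓ≤N)))))
    where
    2ℓ≤N : 2 * ∣ H ∣ ≤ n C 2
    2ℓ≤N = nC2≥ (2 * ∣ H ∣) n (ℕ.m+n≤o⇒n≤o v n≥)
    ℓ≤N : ∣ H ∣ ≤ n C 2
    ℓ≤N = ℕ.≤-trans (ℕ.m≤n*m ∣ H ∣ 2) 2ℓ≤N

  -- Since N ∑ k C_k = ℓ² ∑ C_k, the terms with λ₀ do not change the sum.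
  N[variance-leading] : ∀ n x → v + suc (2 * ∣ H ∣) ≤ n →
    ∑< (4 + ∣ H ∣) (λ k → shares k n x ℚ.* χ k n x) ≡ N n ℚ.* (Var n (E n) (T v n H) ℚ.- leading n x)
  N[variance-leading] n x n≥ = begin
    ∑< K (λ k → s k ℚ.* χ k n x)
      ≡⟨ ∑<-cong K (λ k → solve 7 (λ s m c y k τ l → s :* (m :* (c :- y :* k :- τ) :+ l :* y) :=
             m :* (s :* c) :+ ((:- (y :* m)) :* (s :* k) :+ ((:- m) :* (s :* τ) :+ (l :* y) :* (s :* con 1ℚ)))) refl
           (s k) (N n) (covariance ∣ H ∣ k n x) (λ₀ x) (cast k) (target k x) (cast ∣ H ∣ ℚ.* cast ∣ H ∣)) ⟩
    ∑< K (λ k → N n ℚ.* a k ℚ.+ (r₁ ℚ.* b k ℚ.+ (r₂ ℚ.* τ k ℚ.+ r₃ ℚ.* s₁ k)))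
      ≡⟨ trans (∑<-+ K _ _) (cong₂ ℚ._+_ (∑<-*ˡ K (N n) a)
           (trans (∑<-+ K _ _) (cong₂ ℚ._+_ (∑<-*ˡ K r₁ b)
             (trans (∑<-+ K _ _) (cong₂ ℚ._+_ (∑<-*ˡ K r₂ τ) (∑<-*ˡ K r₃ s₁)))))) ⟩
    N n ℚ.* ∑< K a ℚ.+ (r₁ ℚ.* ∑< K b ℚ.+ (r₂ ℚ.* ∑< K τ ℚ.+ r₃ ℚ.* ∑< K s₁))
      ≡⟨ cong₂ (λ s t → N n ℚ.* s ℚ.+ (r₁ ℚ.* ∑< K b ℚ.+ (r₂ ℚ.* t ℚ.+ r₃ ℚ.* ∑< K s₁)))
           (sym (variance-covariance n x n≥)) (∑-target ∣ H ∣ n x) ⟩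
    N n ℚ.* Var n (E n) (T v n H) ℚ.+ (r₁ ℚ.* ∑< K b ℚ.+ (r₂ ℚ.* leading n x ℚ.+ r₃ ℚ.* ∑< K s₁))
      ≡⟨ solve 7 (λ m V y β L l σ → m :* V :+ ((:- (y :* m)) :* β :+ ((:- m) :* L :+ (l :* y) :* σ)) :=
             m :* (V :- L) :+ (y :* (l :* σ) :- y :* (m :* β))) refl
           (N n) (Var n (E n) (T v n H)) (λ₀ x) (∑< K b) (leading n x) (cast ∣ H ∣ ℚ.* cast ∣ H ∣) (∑< K s₁) ⟩
    N n ℚ.* (Var n (E n) (T v n H) ℚ.- leading n x) ℚ.+
      (λ₀ x ℚ.* (cast ∣ H ∣ ℚ.* cast ∣ H ∣ ℚ.* ∑< K s₁) ℚ.- λ₀ x ℚ.* (N n ℚ.* ∑< K b))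
      ≡⟨ cong (λ t → N n ℚ.* (Var n (E n) (T v n H) ℚ.- leading n x) ℚ.+ (λ₀ x ℚ.* (cast ∣ H ∣ ℚ.* cast ∣ H ∣ ℚ.* ∑< K s₁) ℚ.- λ₀ x ℚ.* t))
           (Probability.∑k*Cpairs v H n (E n) (E≤N n) (ℓ≤nC2 n (ℕ.m+n≤o⇒m≤o v n≥)) K (ℕ.m≤n+m (suc ∣ H ∣) 3)) ⟩
    N n ℚ.* (Var n (E n) (T v n H) ℚ.- leading n x) ℚ.+
      (λ₀ x ℚ.* (cast ∣ H ∣ ℚ.* cast ∣ H ∣ ℚ.* ∑< K s₁) ℚ.- λ₀ x ℚ.* (cast ∣ H ∣ ℚ.* cast ∣ H ∣ ℚ.* ∑< K s₁))
      ≡⟨ trans (cong (N n ℚ.* (Var n (E n) (T v n H) ℚ.- leading n x) ℚ.+_) (ℚ.+-inverseʳ (λ₀ x ℚ.* (cast ∣ H ∣ ℚ.* cast ∣ H ∣ ℚ.* ∑< K s₁))))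
           (ℚ.+-identityʳ (N n ℚ.* (Var n (E n) (T v n H) ℚ.- leading n x))) ⟩
    N n ℚ.* (Var n (E n) (T v n H) ℚ.- leading n x) ∎
    where
    open ≡-Reasoning
    open ℚ.+-*-Solver using (solve; _:=_; _:+_; _:-_; :-_; _:*_; con)
    K : ℕ
    K = 4 + ∣ H ∣
    s a b τ s₁ : ℕ → ℚ
    s k = shares k n x
    a k = s k ℚ.* covariance ∣ H ∣ k n x
    b k = s k ℚ.* cast k
    τ k = s k ℚ.* target k x
    s₁ k = s k ℚ.* 1ℚ
    r₁ r₂ r₃ : ℚ
    r₁ = ℚ.- (λ₀ x ℚ.* N n)
    r₂ = ℚ.- N n
    r₃ = cast ∣ H ∣ ℚ.* cast ∣ H ∣ ℚ.* λ₀ x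

  variance-≪ : (λ n x → Var n (E n) (T v n H) ℚ.- leading n x) ≪ (λ n → n ^ W)
  variance-≪ = ≪-N⁻¹ (≪-weight (λ n → n²* n W)
    (≪-cong (v + suc (2 * ∣ H ∣)) (λ n x n≥ _ → N[variance-leading] n x n≥) (≪-∑< (4 + ∣ H ∣) shares*χ-≪)))

  variance-≪′ : (λ n x → Var n (E n) (T v n H)) ≪ (λ n → n ^ (1 + W))
  variance-≪′ = ≪-≗ (λ n x → solve 2 (λ V L → (V :- L) :+ L := V) refl (Var n (E n) (T v n H)) (leading n x))
    (≪-+ (≪-mono 1 1 (λ { n@(suc _) _ → ℕ.≤-trans (ℕ.m≤n*m (n ^ W) n) (ℕ.m≤n*m _ 1) }) variance-≪)
      (≪-+ (≪-*ᵇ shares₂-≪ (target-≪ 2)) (≪-*ᵇ shares₃-≪ (target-≪ 3))))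
    where open ℚ.+-*-Solver using (solve; _:=_; _:+_; _:-_)

  module _ (H-free : TriangleFree v H) where

    triangleFree⇒C₃-≪ : (λ n x → shares 3 n x ℚ.* target 3 x) ≪ (λ n → n ^ W)
    triangleFree⇒C₃-≪ = ≪-*ᵇ (triangleFree⇒shares₃-≪ H-free) (target-≪ 3)

    triangleFree⇒variance-≪ : (λ n x → Var n (E n) (T v n H) ℚ.- shares 2 n x ℚ.* target 2 x) ≪ (λ n → n ^ W)
    triangleFree⇒variance-≪ = ≪-≗
      (λ n x → solve 3 (λ V a b → (V :- (a :+ b)) :+ b := V :- a) refl
        (Var n (E n) (T v n H)) (shares 2 n x ℚ.* target 2 x) (shares 3 n x ℚ.* target 3 x))
      (≪-+ variance-≪ triangleFree⇒C₃-≪)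
      where open ℚ.+-*-Solver using (solve; _:=_; _:+_; _:-_)

  -- The mean and its expansion in powers of n

  c-≪ : (λ n x → c v H n) ≪ (λ n → n ^ v)
  c-≪ = ≪-mono 1 0 (λ n _ → ℕ.≤-trans (∣Kn-copies∣≤ n) (ℕ.m≤n*m _ 1))
    (≪-≗ (λ n x → sym (c≡∣Kn-copies∣ v H n)) (≪-cast (λ n → length (Copies.Kn-copies v H n))))
    where
    ∣Kn-copies∣≤ : ∀ n → length (Copies.Kn-copies v H n) ≤ n ^ v
    ∣Kn-copies∣≤ n = ℕ.≤-trans (ℕ.m≤n*m _ (symmetries v H) {{ℕ.>-nonZero (symmetries>0 v H)}})
      (ℕ.≤-trans (ℕ.≤-reflexive (Copies.Kn-copies-count v H n)) (P≤^ n v))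

  mean≡c*Pr : ∀ n → v ≤ n → 𝔼 n (E n) (T v n H) ≡ c v H n ℚ.* Pr (E n) (n C 2) ∣ H ∣
  mean≡c*Pr n v≤n = Probability.mean≡ v H n (E n) (E≤N n) (ℓ≤nC2 n v≤n)

  -- P(E, N, ℓ) = x^ℓ + O(1/N), multiplied by c_n = O(n^v).
  mean-≪ : (λ n x → 𝔼 n (E n) (T v n H) ℚ.- c v H n ℚ.* x ^ℚ ∣ H ∣) ≪ (λ n → n ^ (v ∸ 2))
  mean-≪ = ≪-N⁻¹ (≪-weight (λ n → trans (cong (n ^_) v≡2+) (n²* n (v ∸ 2))) (≪-cong v
    (λ n x v≤n _ → trans
      (solve 4 (λ c m a b → c :* (m :* (a :- b)) := m :* (c :* a :- c :* b)) refl (c v H n) (N n) (Π 0 ∣ H ∣ n x) (x ^ℚ ∣ H ∣))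
      (cong (λ t → N n ℚ.* (t ℚ.- c v H n ℚ.* x ^ℚ ∣ H ∣)) (trans
        (cong (c v H n ℚ.*_) (sym (Pr≡Π ∣ H ∣ n x (ℓ≤nC2 n v≤n)))) (sym (mean≡c*Pr n v≤n)))))
    (≪-*ᵇ c-≪ (N[a-b] (Π≈x^ 0 ∣ H ∣)))))
    where open ℚ.+-*-Solver using (solve; _:=_; _:-_; _:*_)

  triangular : ℕ → ℚ
  triangular v = ratio (v * (v ∸ 1)) 2

  triangular-suc : ∀ m → triangular (3 + m) ≡ triangular (2 + m) ℚ.+ cast (2 + m)
  triangular-suc m = sym (ratio-unique {(3 + m) * (2 + m)} {2} (s≤s (z≤n {1})) (begin
    cast 2 ℚ.* (triangular (2 + m) ℚ.+ cast (2 + m))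
      ≡⟨ ℚ.*-distribˡ-+ (cast 2) (triangular (2 + m)) (cast (2 + m)) ⟩
    cast 2 ℚ.* triangular (2 + m) ℚ.+ cast 2 ℚ.* cast (2 + m)
      ≡⟨ cong₂ ℚ._+_ (cast*ratio ((2 + m) * (1 + m)) 2 (s≤s (z≤n {1}))) (sym (cast-* 2 (2 + m))) ⟩
    cast ((2 + m) * (1 + m)) ℚ.+ cast (2 * (2 + m))
      ≡⟨ trans (sym (cast-+ ((2 + m) * (1 + m)) (2 * (2 + m)))) (cong cast
           (solve 1 (λ m → (con 2 :+ m) :* (con 1 :+ m) :+ con 2 :* (con 2 :+ m) := (con 3 :+ m) :* (con 2 :+ m)) refl m)) ⟩
    cast ((3 + m) * (2 + m)) ∎))
    where open ≡-Reasoning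
          open +-*-Solver using (solve; _:=_; _:+_; _:*_; con)

  fallingRemainder : ℕ → ℕ → ℚ → ℚ
  fallingRemainder w n x = cast (n P w) ℚ.- (cast (n ^ w) ℚ.- triangular w ℚ.* cast (n ^ (w ∸ 1)))

  -- Induction on the number of factors. With a = m + 2 and t = `triangular a`, the new factor n - a
  -- multiplies the old remainder by O(n) and adds a t n^(m+1), while the coefficient t grows by a.
  fallingRemainder-≪ : ∀ m → fallingRemainder (2 + m) ≪ (λ n → n ^ m)
  fallingRemainder-≪ zero = ≪-≗ (λ n x → sym (vanish n)) (≪-const 0ℚ)
    where
    open ℚ.+-*-Solver using (solve; _:=_; _:-_; _:*_; con)
    vanish : ∀ n → cast (n P 2) ℚ.- (cast (n * (n * 1)) ℚ.- triangular 2 ℚ.* cast (n * 1)) ≡ 0ℚ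
    vanish n = trans
      (cong₂ (λ s t → s ℚ.- t)
        (trans (cast-P-suc n 1) (cong ((cast n ℚ.- cast 1) ℚ.*_) (cast-P-suc n 0)))
        (cong₂ (λ s t → s ℚ.- triangular 2 ℚ.* t)
          (trans (cast-* n (n * 1)) (cong (cast n ℚ.*_) (cast-* n 1))) (cast-* n 1)))
      (solve 1 (λ n → (n :- con (cast 1)) :* ((n :- con (cast 0)) :* con 1ℚ) :-
        (n :* (n :* con (cast 1)) :- con (triangular 2) :* (n :* con (cast 1))) := con 0ℚ) refl (cast n))
  fallingRemainder-≪ (suc m) = ≪-≗
    (λ n x → sym (trans
      (cong₂ (λ s t → s ℚ.- t) (cast-P-suc n (2 + m))
        (cong₂ ℚ._-_ (trans (cast-* n (n ^ (2 + m))) (cong (cast n ℚ.*_) (cast-* n (n ^ (1 + m)))))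
          (cong₂ ℚ._*_ (triangular-suc m) (cast-* n (n ^ (1 + m))))))
      (trans
        (solve 5 (λ n a p t b → (n :- a) :* p :- (n :* (n :* b) :- (t :+ a) :* (n :* b)) :=
            (n :- a) :* (p :- (n :* b :- t :* b)) :+ (a :* t) :* b) refl
          (cast n) (cast (2 + m)) (cast (n P (2 + m))) (triangular (2 + m)) (cast (n ^ (1 + m))))
        (cong (λ t → (cast n ℚ.- cast (2 + m)) ℚ.*
            (cast (n P (2 + m)) ℚ.- (t ℚ.- triangular (2 + m) ℚ.* cast (n ^ (1 + m)))) ℚ.+
            cast (2 + m) ℚ.* triangular (2 + m) ℚ.* cast (n ^ (1 + m)))
          (sym (cast-* n (n ^ (1 + m))))))))
    (≪-+ (≪-* n-a≪n (fallingRemainder-≪ m))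
         (≪-1*ˡ (≪-* (≪-const (cast (2 + m) ℚ.* triangular (2 + m))) (≪-cast (λ n → n ^ (1 + m))))))
    where
    open ℚ.+-*-Solver using (solve; _:=_; _:-_; _:*_; _:+_)
    n-a≪n : (λ n x → cast n ℚ.- cast (2 + m)) ≪ (λ n → n)
    n-a≪n = ≪-- (≪-cast (λ n → n)) (≪-mono 1 1 (λ n 1≤n → ℕ.≤-trans 1≤n (ℕ.m≤n*m n 1)) (≪-const (cast (2 + m))))

  fallingRemainder-v : fallingRemainder v ≪ (λ n → n ^ (v ∸ 2))
  fallingRemainder-v = subst (λ w → fallingRemainder w ≪ (λ n → n ^ (w ∸ 2))) (sym v≡2+) (fallingRemainder-≪ (v ∸ 2))

  expansion : ℕ → ℚ → ℚ
  expansion n x = ratio 1 (symmetries v H) ℚ.*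
    (cast (n ^ v) ℚ.* x ^ℚ ∣ H ∣ ℚ.- triangular v ℚ.* cast (n ^ (v ∸ 1)) ℚ.* x ^ℚ ∣ H ∣)

  -- Since c_n is the falling factorial of n divided by |S_H|, only the remainder of that factorial
  -- is added to the error of `mean-≪`.
  expansion-≪ : (λ n x → 𝔼 n (E n) (T v n H) ℚ.- expansion n x) ≪ (λ n → n ^ (v ∸ 2))
  expansion-≪ = ≪-≗
    (λ n x → trans
      (solve 7 (λ M c r f a b y → (M :- c :* y) :+ (r :* (f :- (a :- b))) :* y :=
          (M :- r :* (a :* y :- b :* y)) :+ (f :* r :- c) :* y) refl
        (𝔼 n (E n) (T v n H)) (c v H n) (ratio 1 (symmetries v H)) (cast (n P v)) (cast (n ^ v))
        (triangular v ℚ.* cast (n ^ (v ∸ 1))) (x ^ℚ ∣ H ∣))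
      (trans (cong (λ t → (𝔼 n (E n) (T v n H) ℚ.- expansion n x) ℚ.+ (t ℚ.- c v H n) ℚ.* x ^ℚ ∣ H ∣)
               (sym (ratio≡cast* (n P v) (symmetries v H))))
        (trans (cong (λ t → (𝔼 n (E n) (T v n H) ℚ.- expansion n x) ℚ.+ t ℚ.* x ^ℚ ∣ H ∣) (ℚ.+-inverseʳ (c v H n)))
          (trans (cong ((𝔼 n (E n) (T v n H) ℚ.- expansion n x) ℚ.+_) (ℚ.*-zeroˡ (x ^ℚ ∣ H ∣))) (ℚ.+-identityʳ _)))))
    (≪-+ mean-≪ (≪-*ᵇ (≪-1*ˡ (≪-* (≪-const (ratio 1 (symmetries v H))) fallingRemainder-v)) (≪-^ ∣ H ∣)))
    where open ℚ.+-*-Solver using (solve; _:=_; _:-_; _:*_; _:+_)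

-- Passage to real p

seq-^ : ∀ p k i → seq (p ^ℝ k) i ≡ seq p i ^ℚ k
seq-^ p zero    i = refl
seq-^ p (suc k) i = cong (seq p i ℚ.*_) (seq-^ p k i)

-- Used to replace the real O-constant of the hypothesis on E_n by a natural number.
eventually-≤ : ∀ (r : ℝ) → ∃[ B ] ∃[ M ] ∀ i → M ≤ i → seq r i ℚ.≤ cast B
eventually-≤ r with cauchy r 1ℚ (ℚ.positive⁻¹ 1ℚ)
... | M , tail with archimedean (1ℚ ℚ.+ seq r M)
...   | B , ≤B = B , M , λ i M≤i → begin
  seq r i                             ≡⟨ solve 2 (λ s t → s := (s :- t) :+ t) refl (seq r i) (seq r M) ⟩
  (seq r i ℚ.- seq r M) ℚ.+ seq r M   ≤⟨ ℚ.+-monoˡ-≤ (seq r M) (ℚ.≤-trans (p≤∣p∣ (seq r i ℚ.- seq r M)) (tail i M M≤i ℕ.≤-refl)) ⟩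
  1ℚ ℚ.+ seq r M                      ≤⟨ ≤B ⟩
  cast B                              ∎
  where
  open ℚ.≤-Reasoning
  open ℚ.+-*-Solver using (solve; _:=_; _:-_; _:+_)
  p≤∣p∣ : ∀ p → p ℚ.≤ ℚ.∣ p ∣
  p≤∣p∣ p with ℚ.≤-total 0ℚ p
  ... | inj₁ 0≤p = ℚ.≤-reflexive (sym (ℚ.0≤p⇒∣p∣≡p 0≤p))
  ... | inj₂ p≤0 = ℚ.≤-trans p≤0 (ℚ.0≤∣p∣ p)

module _ (E : ℕ → ℕ) (p : ℝ) where

  EventuallyNear : ℕ → Set
  EventuallyNear B = ∃[ n₀ ] ∀ n → n₀ ≤ n → ∃[ M ] ∀ i → M ≤ i → Asymptotics.Near E B n (seq p i)

  -- The hypothesis on E_n is used with slack ε = 1 only, which accounts for the 1 in `B₀ + 1`.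
  eventuallyNear : fromℕ 0 <ℝ p → p <ℝ fromℕ 1 →
    (λ n → fromℕ (E n) -ℝ p *ℝ fromℕ (n C 2)) ∈O (λ _ → 1) → ∃[ B ] EventuallyNear B
  eventuallyNear (ε₀ , 0<ε₀ , M₀ , 0<p) (ε₁ , 0<ε₁ , M₁ , p<1) (D , n₀ , close) = B₀ + 1 , n₀ , λ n n≥ →
    let M₃ = proj₁ (close n n≥ 1ℚ (ℚ.positive⁻¹ 1ℚ)) in
    (M₀ ℕ.⊔ M₁) ℕ.⊔ (M₂ ℕ.⊔ M₃) , λ i M≤i →
    let M₀₁≤i = ℕ.m⊔n≤o⇒m≤o (M₀ ℕ.⊔ M₁) (M₂ ℕ.⊔ M₃) M≤i
        M₂₃≤i = ℕ.m⊔n≤o⇒n≤o (M₀ ℕ.⊔ M₁) (M₂ ℕ.⊔ M₃) M≤i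
    in Asymptotics.near
      (p≥0 i (ℕ.m⊔n≤o⇒m≤o M₀ M₁ M₀₁≤i))
      (p≤1 i (ℕ.m⊔n≤o⇒n≤o M₀ M₁ M₀₁≤i))
      (ℚ.≤-trans (close-n n n≥ i (ℕ.m⊔n≤o⇒n≤o M₂ M₃ M₂₃≤i)) (D+1≤ i (ℕ.m⊔n≤o⇒m≤o M₂ M₃ M₂₃≤i)))
    where
    open ℚ.≤-Reasoning
    B₀ M₂ : ℕ
    B₀ = proj₁ (eventually-≤ D)
    M₂ = proj₁ (proj₂ (eventually-≤ D))
    p≥0 : ∀ i → M₀ ≤ i → 0ℚ ℚ.≤ seq p i
    p≥0 i M₀≤i = begin
      0ℚ           ≤⟨ ℚ.<⇒≤ 0<ε₀ ⟩
      ε₀           ≡⟨ ℚ.+-identityˡ ε₀ ⟨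
      0ℚ ℚ.+ ε₀    ≤⟨ 0<p i M₀≤i ⟩
      seq p i      ∎
    p≤1 : ∀ i → M₁ ≤ i → seq p i ℚ.≤ 1ℚ
    p≤1 i M₁≤i = begin
      seq p i           ≡⟨ ℚ.+-identityʳ (seq p i) ⟨
      seq p i ℚ.+ 0ℚ    ≤⟨ ℚ.+-monoʳ-≤ (seq p i) (ℚ.<⇒≤ 0<ε₁) ⟩
      seq p i ℚ.+ ε₁    ≤⟨ p<1 i M₁≤i ⟩
      1ℚ                ∎
    close-n : ∀ n (n≥ : n₀ ≤ n) i → proj₁ (close n n≥ 1ℚ (ℚ.positive⁻¹ 1ℚ)) ≤ i →
      ℚ.∣ cast (E n) ℚ.- seq p i ℚ.* cast (n C 2) ∣ ℚ.≤ seq D i ℚ.* cast 1 ℚ.+ 1ℚ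
    close-n n n≥ i = proj₂ (close n n≥ 1ℚ (ℚ.positive⁻¹ 1ℚ)) i
    D+1≤ : ∀ i → M₂ ≤ i → seq D i ℚ.* cast 1 ℚ.+ 1ℚ ℚ.≤ cast (B₀ + 1)
    D+1≤ i M₂≤i = begin
      seq D i ℚ.* cast 1 ℚ.+ 1ℚ  ≡⟨ cong (ℚ._+ 1ℚ) (ℚ.*-identityʳ (seq D i)) ⟩
      seq D i ℚ.+ 1ℚ         ≤⟨ ℚ.+-monoˡ-≤ 1ℚ (proj₂ (proj₂ (eventually-≤ D)) i M₂≤i) ⟩
      cast B₀ ℚ.+ cast 1      ≡⟨ cast-+ B₀ 1 ⟨
      cast (B₀ + 1)           ∎

  module _ {B : ℕ} (near-p : EventuallyNear B) where

    open Asymptotics E B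

    -- Real operations are pointwise, so the i-th entry of `f n` is the rational expression at x =
    -- `seq p i`, which is near for all late i. The uniform bound thus holds along a tail, even
    -- without the slack ε.
    ≪⇒∈O : ∀ f h {a g} → a ≪ g → (∀ n → g n ≡ h n) → (∀ n i → seq (f n) i ≡ a n (seq p i)) → f ∈O h
    ≪⇒∈O f h {a} {g} (≪-intro K n₀ a≤) g≡h f≡a = fromℕ K , n₀ ℕ.⊔ proj₁ near-p , λ n n≥ ε 0<ε →
      let M , near-n = proj₂ near-p n (ℕ.m⊔n≤o⇒n≤o n₀ (proj₁ near-p) n≥) in
      M , λ i M≤i → begin
        ℚ.∣ seq (f n) i ∣               ≡⟨ cong ℚ.∣_∣ (f≡a n i) ⟩
        ℚ.∣ a n (seq p i) ∣             ≤⟨ a≤ n (seq p i) (ℕ.m⊔n≤o⇒m≤o n₀ (proj₁ near-p) n≥) (near-n i M≤i) ⟩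
        cast (K * g n)                  ≡⟨ trans (cong (λ t → cast (K * t)) (g≡h n)) (cast-* K (h n)) ⟩
        cast K ℚ.* cast (h n)           ≡⟨ ℚ.+-identityʳ (cast K ℚ.* cast (h n)) ⟨
        cast K ℚ.* cast (h n) ℚ.+ 0ℚ    ≤⟨ ℚ.+-monoʳ-≤ (cast K ℚ.* cast (h n)) (ℚ.<⇒≤ 0<ε) ⟩
        cast K ℚ.* cast (h n) ℚ.+ ε     ∎
      where open ℚ.≤-Reasoning

seq-C₂ : ∀ p t κ i → seq (fromℕ κ *ℝ p ^ℝ (t ∸ 2) *ℝ (fromℕ 1 -ℝ p) ^ℝ 2) i ≡
                     cast κ ℚ.* C₂-target t (seq p i)
seq-C₂ p t κ i = trans
  (cong₂ (λ s t → cast κ ℚ.* s ℚ.* t) (seq-^ p (t ∸ 2) i) (seq-^ (fromℕ 1 -ℝ p) 2 i))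
  (ℚ.*-assoc (cast κ) (seq p i ^ℚ (t ∸ 2)) ((cast 1 ℚ.- seq p i) ^ℚ 2))

seq-C₃ : ∀ p t κ i →
  seq (fromℕ κ *ℝ p ^ℝ (t ∸ 3) *ℝ (fromℕ 1 -ℝ fromℕ 3 *ℝ p ^ℝ 2 +ℝ fromℕ 2 *ℝ p ^ℝ 3)) i ≡
  cast κ ℚ.* C₃-target t (seq p i)
seq-C₃ p t κ i = trans
  (cong₂ (λ s t → cast κ ℚ.* s ℚ.* t) (seq-^ p (t ∸ 3) i)
    (cong₂ (λ s t → cast 1 ℚ.- cast 3 ℚ.* s ℚ.+ cast 2 ℚ.* t) (seq-^ p 2 i) (seq-^ p 3 i)))
  (ℚ.*-assoc (cast κ) (seq p i ^ℚ (t ∸ 3)) (cast 1 ℚ.- cast 3 ℚ.* seq p i ^ℚ 2 ℚ.+ cast 2 ℚ.* seq p i ^ℚ 3))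

seq-expansion : ∀ p ℓ r a b t i →
  seq (fromℚ r *ℝ (fromℕ a *ℝ p ^ℝ ℓ -ℝ fromℚ t *ℝ fromℕ b *ℝ p ^ℝ ℓ)) i ≡
  r ℚ.* (cast a ℚ.* seq p i ^ℚ ℓ ℚ.- t ℚ.* cast b ℚ.* seq p i ^ℚ ℓ)
seq-expansion p ℓ r a b t i = cong (λ s → r ℚ.* (cast a ℚ.* s ℚ.- t ℚ.* cast b ℚ.* s)) (seq-^ p ℓ i)

seq-fromℚ- : ∀ q r i {s} → seq r i ≡ s → seq (fromℚ q -ℝ r) i ≡ q ℚ.- s
seq-fromℚ- q r i = cong (λ s → q ℚ.- s)

-- The real-valued terms are parameters so that their Cauchy proofs are never unfolded.
module Limit (v : ℕ) (2≤v : 2 ≤ v) (H : Graph v) (1<ℓ : 1 < ∣ H ∣) (p : ℝ)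
             (E : ℕ → ℕ) (E≤N : ∀ n → E n ≤ n C 2) {B : ℕ} (near-p : EventuallyNear E p B)
             (leadingMean expansionℝ C₂-term C₃-term : ℕ → ℝ)
             (seq-leadingMean : ∀ n i → seq (leadingMean n) i ≡ c v H n ℚ.* seq p i ^ℚ ∣ H ∣)
             (seq-expansionℝ : ∀ n i → seq (expansionℝ n) i ≡
               Assembly.expansion v 2≤v H 1<ℓ E E≤N B n (seq p i))
             (seq-C₂-term : ∀ n i → seq (C₂-term n) i ≡ cast (Cpairs v H 2 n) ℚ.* C₂-target (2 * ∣ H ∣) (seq p i))
             (seq-C₃-term : ∀ n i → seq (C₃-term n) i ≡ cast (Cpairs v H 3 n) ℚ.* C₃-target (2 * ∣ H ∣) (seq p i))
             where

  open Assembly v 2≤v H 1<ℓ E E≤N B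

  1+W≡ : ∀ n → n ^ (1 + W) ≡ n ^ (2 * v ∸ 3)
  1+W≡ n = cong (λ t → n ^ (t ∸ 3)) (sym (trans (cong (v +_) (ℕ.+-identityʳ v)) v+v≡4+W))

  mean-asymptotics : (λ n → fromℚ (𝔼 n (E n) (T v n H)) -ℝ leadingMean n) ∈O (λ n → n ^ (v ∸ 2))
  mean-asymptotics = ≪⇒∈O E p near-p (λ n → fromℚ (𝔼 n (E n) (T v n H)) -ℝ leadingMean n) (λ n → n ^ (v ∸ 2))
    mean-≪ (λ _ → refl)
    (λ n i → seq-fromℚ- (𝔼 n (E n) (T v n H)) (leadingMean n) i (seq-leadingMean n i))

  mean-expansion : (λ n → fromℚ (𝔼 n (E n) (T v n H)) -ℝ expansionℝ n) ∈O (λ n → n ^ (v ∸ 2))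
  mean-expansion = ≪⇒∈O E p near-p (λ n → fromℚ (𝔼 n (E n) (T v n H)) -ℝ expansionℝ n) (λ n → n ^ (v ∸ 2))
    expansion-≪ (λ _ → refl)
    (λ n i → seq-fromℚ- (𝔼 n (E n) (T v n H)) (expansionℝ n) i (seq-expansionℝ n i))

  variance-asymptotics :
    (λ n → fromℚ (Var n (E n) (T v n H)) -ℝ (C₂-term n +ℝ C₃-term n)) ∈O (λ n → n ^ (2 * v ∸ 4))
  variance-asymptotics = ≪⇒∈O E p near-p
    (λ n → fromℚ (Var n (E n) (T v n H)) -ℝ (C₂-term n +ℝ C₃-term n)) (λ n → n ^ (2 * v ∸ 4))
    variance-≪ (λ _ → refl)
    (λ n i → seq-fromℚ- (Var n (E n) (T v n H)) (C₂-term n +ℝ C₃-term n) i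
      (cong₂ ℚ._+_ (seq-C₂-term n i) (seq-C₃-term n i)))

  variance-bound : (λ n → fromℚ (Var n (E n) (T v n H))) ∈O (λ n → n ^ (2 * v ∸ 3))
  variance-bound = ≪⇒∈O E p near-p (λ n → fromℚ (Var n (E n) (T v n H))) (λ n → n ^ (2 * v ∸ 3))
    variance-≪′ 1+W≡ (λ n i → refl)

  module _ (H-free : TriangleFree v H) where

    triangleFree⇒C₃ : C₃-term ∈O (λ n → n ^ (2 * v ∸ 4))
    triangleFree⇒C₃ = ≪⇒∈O E p near-p C₃-term (λ n → n ^ (2 * v ∸ 4))
      (triangleFree⇒C₃-≪ H-free) (λ _ → refl) seq-C₃-term

    triangleFree⇒variance : (λ n → fromℚ (Var n (E n) (T v n H)) -ℝ C₂-term n) ∈O (λ n → n ^ (2 * v ∸ 4))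
    triangleFree⇒variance = ≪⇒∈O E p near-p
      (λ n → fromℚ (Var n (E n) (T v n H)) -ℝ C₂-term n) (λ n → n ^ (2 * v ∸ 4))
      (triangleFree⇒variance-≪ H-free) (λ _ → refl)
      (λ n i → seq-fromℚ- (Var n (E n) (T v n H)) (C₂-term n) i (seq-C₂-term n i))

2≤v : ∀ v (H : Graph v) → 1 < ∣ H ∣ → 2 ≤ v
2≤v zero          H 1<ℓ with ℕ.≤-trans 1<ℓ (∣H∣≤vC2 0 H)
... | ()
2≤v (suc zero)    H 1<ℓ with ℕ.≤-trans 1<ℓ (∣H∣≤vC2 1 H)
... | ()
2≤v (suc (suc v)) H 1<ℓ = s≤s (s≤s z≤n)

theorem1p1 :
    (v : ℕ) (H : Graph v) → 1 < ∣ H ∣ → NoIsolatedVertex v H →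
    (p : ℝ) → fromℕ 0 <ℝ p → p <ℝ fromℕ 1 →
    (E : ℕ → ℕ) → (∀ n → E n ≤ n C 2) →
    (λ n → fromℕ (E n) -ℝ p *ℝ fromℕ (n C 2)) ∈O (λ n → 1) →
    let ℓ = ∣ H ∣
        mean = λ n → 𝔼 n (E n) (T v n H)
        variance = λ n → Var n (E n) (T v n H)
        expansion = λ n →
          fromℚ (ratio 1 (symmetries v H)) *ℝ
            (fromℕ (n ^ v) *ℝ p ^ℝ ℓ
              -ℝ fromℚ (ratio (v * (v ∸ 1)) 2) *ℝ fromℕ (n ^ (v ∸ 1)) *ℝ p ^ℝ ℓ)
        C₂-term = λ n →
          fromℕ (Cpairs v H 2 n) *ℝ p ^ℝ (2 * ℓ ∸ 2) *ℝ (fromℕ 1 -ℝ p) ^ℝ 2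
        C₃-term = λ n →
          fromℕ (Cpairs v H 3 n) *ℝ p ^ℝ (2 * ℓ ∸ 3) *ℝ
            (fromℕ 1 -ℝ fromℕ 3 *ℝ p ^ℝ 2 +ℝ fromℕ 2 *ℝ p ^ℝ 3)
    in
      (∀ n → v ≤ n → mean n ≡ c v H n ℚ.* Pr (E n) (n C 2) ℓ)
    × (λ n → fromℚ (mean n) -ℝ fromℚ (c v H n) *ℝ p ^ℝ ℓ) ∈O (λ n → n ^ (v ∸ 2))
    × (λ n → fromℚ (mean n) -ℝ expansion n) ∈O (λ n → n ^ (v ∸ 2))
    × (λ n → fromℚ (variance n) -ℝ (C₂-term n +ℝ C₃-term n)) ∈O (λ n → n ^ (2 * v ∸ 4))
    × (λ n → fromℚ (variance n)) ∈O (λ n → n ^ (2 * v ∸ 3))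
    × (TriangleFree v H →
         C₃-term ∈O (λ n → n ^ (2 * v ∸ 4))
       × (λ n → fromℚ (variance n) -ℝ C₂-term n) ∈O (λ n → n ^ (2 * v ∸ 4)))
theorem1p1 v H 1<ℓ _ p 0<p p<1 E E≤N E≈pN =
  Assembly.mean≡c*Pr v (2≤v v H 1<ℓ) H 1<ℓ E E≤N 0 ,
  mean-asymptotics , mean-expansion , variance-asymptotics , variance-bound ,
  λ H-free → triangleFree⇒C₃ H-free , triangleFree⇒variance H-free
  where
  open Limit v (2≤v v H 1<ℓ) H 1<ℓ p E E≤N (proj₂ (eventuallyNear E p 0<p p<1 E≈pN))
    (λ n → fromℚ (c v H n) *ℝ p ^ℝ ∣ H ∣)
    (λ n → fromℚ (ratio 1 (symmetries v H)) *ℝ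
      (fromℕ (n ^ v) *ℝ p ^ℝ ∣ H ∣ -ℝ fromℚ (ratio (v * (v ∸ 1)) 2) *ℝ fromℕ (n ^ (v ∸ 1)) *ℝ p ^ℝ ∣ H ∣))
    (λ n → fromℕ (Cpairs v H 2 n) *ℝ p ^ℝ (2 * ∣ H ∣ ∸ 2) *ℝ (fromℕ 1 -ℝ p) ^ℝ 2)
    (λ n → fromℕ (Cpairs v H 3 n) *ℝ p ^ℝ (2 * ∣ H ∣ ∸ 3) *ℝ
      (fromℕ 1 -ℝ fromℕ 3 *ℝ p ^ℝ 2 +ℝ fromℕ 2 *ℝ p ^ℝ 3))
    (λ n i → cong (c v H n ℚ.*_) (seq-^ p ∣ H ∣ i))
    (λ n → seq-expansion p ∣ H ∣ (ratio 1 (symmetries v H)) (n ^ v) (n ^ (v ∸ 1)) (ratio (v * (v ∸ 1)) 2))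
    (λ n → seq-C₂ p (2 * ∣ H ∣) (Cpairs v H 2 n))
    (λ n → seq-C₃ p (2 * ∣ H ∣) (Cpairs v H 3 n))
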